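{- Given a Counting Computation Dynamic Logic (CCDL) formula (resp., a Counting-CTL* (CCTL*) formula) $\varphi$, one can construct a hesitant graded alternating tree automaton (HGTA) (resp., a counter-free HGTA) $\mathcal{A}_\varphi$ such that $\mathcal{L}(\mathcal{A}_\varphi)=\mathcal{L}(\varphi)$. Moreover, $\mathcal{A}_\varphi$ is symmetric if $\varphi$ is a CDL formula (resp., a CTL* formula).
   Context: Setting. $AP$ is a finite set of atomic propositions. A Kripke tree over $AP$ is a tree (prefix-closed non-empty set of words over some set of directions) in which every node has at least one child, labelled by $Lab:T\to 2^{AP}$. A tree language is a set of such labelled trees. Graded alternating tree automata (GTA). For a finite set $Q$ of states, graded $Q$-constraints are given by $\theta::=\top\mid\bot\mid\theta\vee\theta\mid\theta\wedge\theta\mid \Diamond_k\alpha\mid\Box_k\alpha$, with $k\ge1$ and $\alpha$ a positive Boolean formula over $Q$ (the atoms $\Diamond_k\alpha,\Box_k\alpha$ are the $Q$-atoms; $\Diamond_1,\Box_1$ are written $\Diamond,\Box$). A one-step interpretation $(S,I)$ with $I:S\to 2^Q$ satisfies $\Diamond_k\alpha$ iff at least $k$ elements $s\in S$ have $I(s)\models\alpha$, and $\Box_k\alpha$ iff fewer than $k$ elements $s$ have $I(s)\not\models\alpha$. A parity GTA is $\mathcal{A}=(\Sigma,Q,\delta,q_0,\Omega)$ with $\delta:Q\times\Sigma\to$ graded $Q$-constraints and $\Omega:Q\to\mathbb{N}$ a parity (max-even) condition. A run on a $\Sigma$-labelled tree is a $(Q\times T)$-labelled tree whose root is $(q_0,\varepsilon)$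 and where for each run node labelled $(q,w)$ there is a one-step interpretation $(S_w,I)$ over the children $S_w$ of $w$ satisfying $\delta(q,Lab(w))$ such that the children of the run node are labelled exactly by the pairs $(q',w')$ with $w'\in S_w$, $q'\in I(w')$; it is accepting if every infinite branch satisfies $\Omega$. $\mathcal{A}$ is symmetric if all its atoms are of the form $\Diamond\alpha$ or $\Box\alpha$. $Atoms(\mathcal{A})$ denotes the set of $Q$-atoms occurring in $\delta$; for a set $A$ of atoms, $Con(A)$ (resp. $Dis(A)$) is their conjunction (resp. disjunction). For a graded constraint $\theta$, $\mathcal{A}^{\theta}$ is the automaton obtained from $\mathcal{A}$ by adding a fresh initial state $\theta$ of highest order with $\delta(\theta,a)=\theta$ for all $a$. Hesitant GTA (HGTA). An HGTA additionally has an ordered partition $\langle Q_1,\dots,Q_n\rangle$ of $Q$ into components, each transient, existential or universal, such that: for transient $Q_i$, $\delta(q,a)$ mentions only states in $Q_j$, $j<i$; for existential $Q_i$, $\delta(q,a)$ is a disjunction of conjunctions $\Diamond q'\wedge Con(A)$ with $q'\in Q_i$ and atoms of $A$ only referring to states of order $<i$; for universal $Q_i$, $\delta(q,a)$ is a conjunction of disjunctions $\Box q'\vee Dis(A)$ with the same conditions; and $\Omega$ restricted to an existential (resp. universal) component is a Büchi (resp. co-Büchi) condition. For a non-transient $Q_i$ and $q\in Q_i$, the linearization word automaton $\mathcal{A}_{Q_i,q}$ is the nondeterministic word automaton with states $Q_i$, initial state $q$, acceptance $\Omega$ restricted to $Q_i$, over letters $(a,A)\in\Sigma\times 2^{Atoms(\mathcal{A})}$,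 with $q''\in\delta_{Q_i}(q',(a,A))$ iff $\Diamond q''\wedge Con(A)$ is a disjunct of the DNF of $\delta(q',a)$ (existential case), resp. $\Box q''\vee Dis(A)$ is a conjunct of the CNF of $\delta(q',a)$ (universal case); $\Upsilon_{Q_i}$ is the set of $A$ actually used in such transitions. A word automaton is counter-free if for all $n>0$, states $q$ and finite words $\rho$, a path from $q$ to $q$ over $\rho^n$ implies a path from $q$ to $q$ over $\rho$. An HGTA satisfies the mutual-exclusion property if for each non-transient $Q_i$ and distinct $A,A'\in\Upsilon_{Q_i}$ there are atoms $\mathsf{atom}\in A$, $\mathsf{atom}'\in A'$ with $\mathcal{L}(\mathcal{A}^{\mathsf{atom}})$ the complement of $\mathcal{L}(\mathcal{A}^{\mathsf{atom}'})$. A counter-free HGTA is an HGTA whose linearization automata are all counter-free and which satisfies the mutual-exclusion property. Logics. CCTL* state formulae: $\varphi::=\top\mid p\mid\neg\varphi\mid\varphi\wedge\varphi\mid E\psi\mid D^n\varphi$ ($n\ge1$); path formulae: $\psi::=\varphi\mid\neg\psi\mid\psi\wedge\psi\mid X\psi\mid\psi U\psi$, with the usual semantics, $E$ quantifying over infinite paths from the current node and $D^n\varphi$ meaning at least $n$ distinct children satisfy $\varphi$. CTL* is the fragment with no $D^n$, $n>1$. CCDL has the same state formulae but path formulae $\psi::=\varphi\mid\neg\psi\mid\psi\wedge\psi\mid\langle\mathcal{B}\rangle\psi$, where $\mathcal{B}$ is a testing nondeterministic finite-word automaton over $2^{AP}$ with a test function $\tau$ mapping states to CCDL path formulae; $\langle\mathcal{B}\rangle\psi$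 holds at position $i$ of a path $\pi$ iff for some $j\ge i$ there is an accepting run $q_i\dots q_j$ of $\mathcal{B}$ on $Lab(\pi(i))\dots Lab(\pi(j-1))$ with $\tau(q_k)$ holding at position $k$ for all $k\in[i,j]$, and $\psi$ holds at $j$. CDL is the fragment with no $D^n$, $n>1$. $\mathcal{L}(\varphi)$ is the set of Kripke trees whose root satisfies $\varphi$. -}

module Defs where

open import Level using (Level; 0ℓ) renaming (suc to lsuc)
open import Data.Nat using (ℕ; zero; suc; _≤_; _<_; s≤s; z≤n)
open import Data.Nat.Divisibility using (_∣_)
open import Data.Fin using (Fin; toℕ) renaming (zero to fzero; suc to fsuc)
open import Data.Bool using (Bool; true; false) renaming (_∧_ to _∧ᵇ_; _∨_ to _∨ᵇ_)
open import Data.Vec using (Vec; lookup)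
open import Data.List using (List; []; _∷_; _++_; map; concat; replicate)
open import Data.List.Relation.Unary.All using (All)
open import Data.List.Membership.Propositional using (_∈_)
open import Data.Product using (Σ; _×_; _,_; proj₁; proj₂)
open import Data.Sum using (_⊎_)
open import Data.Empty using (⊥)
open import Data.Unit using (⊤)
open import Relation.Nullary using (¬_)
open import Relation.Binary.PropositionalEquality using (_≡_; _≢_)
open import Function.Definitions using (Injective)
open import Function.Bundles using (_⇔_)

-- Kripke trees over AP = Fin nAP, with an arbitrary direction set D.
-- A node is a word over D, stored REVERSED: the child of w in direction d
-- is (d ∷ w).  Labels are subsets of AP, i.e. Vec Bool nAP.

Label : ℕ → Set
Label nAP = Vec Bool nAP

record KTree (nAP : ℕ) (D : Set) : Set₁ where
  field
    node   : List D → Set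
    root   : node []
    prefix : ∀ {d w} → node (d ∷ w) → node w
    serial : ∀ {w} → node w → Σ D λ d → node (d ∷ w)
    lab    : List D → Label nAP
open KTree public

AtLeast : {D : Set} → ℕ → (D → Set) → Set
AtLeast {D} k P = Σ (Fin k → D) λ f → Injective _≡_ _≡_ f × (∀ i → P (f i))

pnode : {D : Set} → List D → (ℕ → D) → ℕ → List D
pnode w ds zero = w
pnode w ds (suc i) = ds i ∷ pnode w ds i

IsPath : {nAP : ℕ} {D : Set} → KTree nAP D → List D → (ℕ → D) → Set
IsPath t w ds = ∀ i → node t (pnode w ds i)

module CCTL (nAP : ℕ) where
  data SF : Set
  data PF : Set
  data SF where
    tt   : SF
    ap   : Fin nAP → SF
    neg  : SF → SF
    and  : SF → SF → SF
    E    : PF → SF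
    Dg   : (n : ℕ) → 1 ≤ n → SF → SF
  data PF where
    st   : SF → PF
    pneg : PF → PF
    pand : PF → PF → PF
    X    : PF → PF
    U    : PF → PF → PF

  module _ {D : Set} (t : KTree nAP D) where
    sat  : SF → List D → Set
    psat : PF → List D → (ℕ → D) → ℕ → Set
    sat tt w = ⊤
    sat (ap p) w = lookup (lab t w) p ≡ true
    sat (neg φ) w = ¬ sat φ w
    sat (and φ ψ) w = sat φ w × sat ψ w
    sat (E ψ) w = Σ (ℕ → D) λ ds → IsPath t w ds × psat ψ w ds 0
    sat (Dg n _ φ) w = AtLeast n (λ d → node t (d ∷ w) × sat φ (d ∷ w))
    psat (st φ) w ds i = sat φ (pnode w ds i)
    psat (pneg ψ) w ds i = ¬ psat ψ w ds i
    psat (pand ψ χ) w ds i = psat ψ w ds i × psat χ w ds i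
    psat (X ψ) w ds i = psat ψ w ds (suc i)
    psat (U ψ χ) w ds i = Σ ℕ λ j → i ≤ j × psat χ w ds j
                            × (∀ k → i ≤ k → k < j → psat ψ w ds k)

  Models : SF → {D : Set} → KTree nAP D → Set
  Models φ t = sat t φ []

  IsCTL  : SF → Set
  IsCTLp : PF → Set
  IsCTL tt = ⊤
  IsCTL (ap _) = ⊤
  IsCTL (neg φ) = IsCTL φ
  IsCTL (and φ ψ) = IsCTL φ × IsCTL ψ
  IsCTL (E ψ) = IsCTLp ψ
  IsCTL (Dg n _ φ) = n ≡ 1 × IsCTL φ
  IsCTLp (st φ) = IsCTL φ
  IsCTLp (pneg ψ) = IsCTLp ψ
  IsCTLp (pand ψ χ) = IsCTLp ψ × IsCTLp χ
  IsCTLp (X ψ) = IsCTLp ψ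
  IsCTLp (U ψ χ) = IsCTLp ψ × IsCTLp χ

-- testing NFA over 2^AP (states Fin m, set of initial states, accepting states);
-- the test function τ is supplied separately in the formula constructor.
record NFA (nAP : ℕ) : Set where
  field
    m     : ℕ
    init  : Fin m → Bool
    trans : Fin m → Label nAP → Fin m → Bool
    acc   : Fin m → Bool

module CCDL (nAP : ℕ) where
  data SF : Set
  data PF : Set
  data SF where
    tt   : SF
    ap   : Fin nAP → SF
    neg  : SF → SF
    and  : SF → SF → SF
    E    : PF → SF
    Dg   : (n : ℕ) → 1 ≤ n → SF → SF
  data PF where
    st   : SF → PF
    pneg : PF → PF
    pand : PF → PF → PF
    dia  : (B : NFA nAP) → (Fin (NFA.m B) → PF) → PF → PF

  module _ {D : Set} (t : KTree nAP D) where
    sat  : SF → List D → Set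
    psat : PF → List D → (ℕ → D) → ℕ → Set
    sat tt w = ⊤
    sat (ap p) w = lookup (lab t w) p ≡ true
    sat (neg φ) w = ¬ sat φ w
    sat (and φ ψ) w = sat φ w × sat ψ w
    sat (E ψ) w = Σ (ℕ → D) λ ds → IsPath t w ds × psat ψ w ds 0
    sat (Dg n _ φ) w = AtLeast n (λ d → node t (d ∷ w) × sat φ (d ∷ w))
    psat (st φ) w ds i = sat φ (pnode w ds i)
    psat (pneg ψ) w ds i = ¬ psat ψ w ds i
    psat (pand ψ χ) w ds i = psat ψ w ds i × psat χ w ds i
    psat (dia B τ ψ) w ds i =
      Σ ℕ λ j → i ≤ j × Σ (ℕ → Fin (NFA.m B)) λ q →
          NFA.init B (q i) ≡ true
        × NFA.acc B (q j) ≡ true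
        × (∀ k → i ≤ k → k < j →
             NFA.trans B (q k) (lab t (pnode w ds k)) (q (suc k)) ≡ true)
        × (∀ k → i ≤ k → k ≤ j → psat (τ (q k)) w ds k)
        × psat ψ w ds j

  Models : SF → {D : Set} → KTree nAP D → Set
  Models φ t = sat t φ []

  IsCDL  : SF → Set
  IsCDLp : PF → Set
  IsCDL tt = ⊤
  IsCDL (ap _) = ⊤
  IsCDL (neg φ) = IsCDL φ
  IsCDL (and φ ψ) = IsCDL φ × IsCDL ψ
  IsCDL (E ψ) = IsCDLp ψ
  IsCDL (Dg n _ φ) = n ≡ 1 × IsCDL φ
  IsCDLp (st φ) = IsCDL φ
  IsCDLp (pneg ψ) = IsCDLp ψ
  IsCDLp (pand ψ χ) = IsCDLp ψ × IsCDLp χ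
  IsCDLp (dia B τ ψ) = (∀ s → IsCDLp (τ s)) × IsCDLp ψ

data PBF (Q : Set) : Set where
  ptt pff : PBF Q
  var     : Q → PBF Q
  por pand : PBF Q → PBF Q → PBF Q

evalP : {Q : Set} → (Q → Bool) → PBF Q → Bool
evalP I ptt = true
evalP I pff = false
evalP I (var q) = I q
evalP I (por a b) = evalP I a ∨ᵇ evalP I b
evalP I (pand a b) = evalP I a ∧ᵇ evalP I b

mapP : {Q R : Set} → (Q → R) → PBF Q → PBF R
mapP f ptt = ptt
mapP f pff = pff
mapP f (var q) = var (f q)
mapP f (por a b) = por (mapP f a) (mapP f b)
mapP f (pand a b) = pand (mapP f a) (mapP f b)

varsP : {Q : Set} → PBF Q → List Q
varsP ptt = []
varsP pff = []
varsP (var q) = q ∷ []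
varsP (por a b) = varsP a ++ varsP b
varsP (pand a b) = varsP a ++ varsP b

data Atom (nq : ℕ) : Set where
  dia : (k : ℕ) → 1 ≤ k → PBF (Fin nq) → Atom nq
  box : (k : ℕ) → 1 ≤ k → PBF (Fin nq) → Atom nq

grade : {nq : ℕ} → Atom nq → ℕ
grade (dia k _ _) = k
grade (box k _ _) = k

statesA : {nq : ℕ} → Atom nq → List (Fin nq)
statesA (dia _ _ α) = varsP α
statesA (box _ _ α) = varsP α

◇_ : {nq : ℕ} → Fin nq → Atom nq
◇ q = dia 1 (s≤s z≤n) (var q)

□_ : {nq : ℕ} → Fin nq → Atom nq
□ q = box 1 (s≤s z≤n) (var q)

data GC (nq : ℕ) : Set where
  top bot : GC nq
  or and  : GC nq → GC nq → GC nq
  atom    : Atom nq → GC nq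

atomsGC : {nq : ℕ} → GC nq → List (Atom nq)
atomsGC top = []
atomsGC bot = []
atomsGC (or a b) = atomsGC a ++ atomsGC b
atomsGC (and a b) = atomsGC a ++ atomsGC b
atomsGC (atom x) = x ∷ []

statesGC : {nq : ℕ} → GC nq → List (Fin nq)
statesGC θ = concat (map statesA (atomsGC θ))

-- one-step semantics: S = set of children, I : S → 2^Q
module _ {nq : ℕ} {D : Set} (S : D → Set) (I : D → Fin nq → Bool) where
  osatA : Atom nq → Set
  osatA (dia k _ α) = AtLeast k (λ d → S d × evalP (I d) α ≡ true)
  osatA (box k _ α) = ¬ AtLeast k (λ d → S d × evalP (I d) α ≡ false)

  osat : GC nq → Set
  osat top = ⊤
  osat bot = ⊥
  osat (or a b) = osat a ⊎ osat b
  osat (and a b) = osat a × osat b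
  osat (atom x) = osatA x

record GTA (nAP : ℕ) : Set where
  field
    nq : ℕ
    δ  : Fin nq → Label nAP → GC nq
    q0 : Fin nq
    Ω  : Fin nq → ℕ
open GTA public

-- run-tree nodes: reversed lists of (state, direction); the label of a run
-- node r is (rstate r, rword r)
rstate : {nq : ℕ} {D : Set} → Fin nq → List (Fin nq × D) → Fin nq
rstate q₀ [] = q₀
rstate q₀ ((q , _) ∷ _) = q

rword : {nq : ℕ} {D : Set} → List (Fin nq × D) → List D
rword = map proj₂

bnode : {X : Set} → (ℕ → X) → ℕ → List X
bnode e zero = []
bnode e (suc i) = e i ∷ bnode e i

ParityAcc : (ℕ → ℕ) → Set
ParityAcc p = Σ ℕ λ m → 2 ∣ m
  × (∀ N → Σ ℕ λ i → N ≤ i × p i ≡ m)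
  × (Σ ℕ λ N → ∀ i → N ≤ i → p i ≤ m)

record Run {nAP : ℕ} {D : Set} (A : GTA nAP) (t : KTree nAP D) : Set₁ where
  field
    R      : List (Fin (nq A) × D) → Set
    rroot  : R []
    rprefix : ∀ {x r} → R (x ∷ r) → R r
    local  : ∀ {r} → R r → Σ (D → Fin (nq A) → Bool) λ I →
               osat (λ d → node t (d ∷ rword r)) I
                    (δ A (rstate (q0 A) r) (lab t (rword r)))
             × (∀ q d → R ((q , d) ∷ r) ⇔ (node t (d ∷ rword r) × I d q ≡ true))
open Run public

AcceptingRun : {nAP : ℕ} {D : Set} {A : GTA nAP} {t : KTree nAP D} → Run A t → Set
AcceptingRun {A = A} ρ = ∀ (e : ℕ → Fin (nq A) × _) → (∀ i → R ρ (bnode e i)) →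
  ParityAcc (λ i → Ω A (rstate (q0 A) (bnode e i)))

Accepts : {nAP : ℕ} {D : Set} → GTA nAP → KTree nAP D → Set₁
Accepts A t = Σ (Run A t) AcceptingRun

SameLang : {nAP : ℕ} → GTA nAP → (∀ {D : Set} → KTree nAP D → Set) → Set₁
SameLang {nAP} A L = ∀ (D : Set) (t : KTree nAP D) → Accepts A t ⇔ L t

Symmetric : {nAP : ℕ} → GTA nAP → Set
Symmetric A = ∀ q a → All (λ x → grade x ≡ 1) (atomsGC (δ A q a))

liftA : {nq : ℕ} → Atom nq → Atom (suc nq)
liftA (dia k p α) = dia k p (mapP fsuc α)
liftA (box k p α) = box k p (mapP fsuc α)

liftGC : {nq : ℕ} → GC nq → GC (suc nq)
liftGC top = top
liftGC bot = bot
liftGC (or a b) = or (liftGC a) (liftGC b)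
liftGC (and a b) = and (liftGC a) (liftGC b)
liftGC (atom x) = atom (liftA x)

withInit : {nAP : ℕ} → (A : GTA nAP) → GC (nq A) → GTA nAP
withInit A θ = record
  { nq = suc (nq A)
  ; δ  = λ { fzero a → liftGC θ ; (fsuc q) a → liftGC (δ A q a) }
  ; q0 = fzero
  ; Ω  = λ { fzero → 0 ; (fsuc q) → Ω A q }
  }

data Kind : Set where
  transient existential universal : Kind

-- ordered partition ⟨Q_1,…,Q_ncomp⟩: comp q is the (index of the) component of q
record Partition (nq : ℕ) : Set where
  field
    ncomp : ℕ
    comp  : Fin nq → Fin ncomp
    kind  : Fin ncomp → Kind
open Partition public

disjuncts : {nq : ℕ} → GC nq → List (GC nq)
disjuncts (or a b) = disjuncts a ++ disjuncts b
disjuncts bot = []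
disjuncts top = top ∷ []
disjuncts (and a b) = and a b ∷ []
disjuncts (atom x) = atom x ∷ []

conjuncts : {nq : ℕ} → GC nq → List (GC nq)
conjuncts (and a b) = conjuncts a ++ conjuncts b
conjuncts top = []
conjuncts bot = bot ∷ []
conjuncts (or a b) = or a b ∷ []
conjuncts (atom x) = atom x ∷ []

module _ {nq : ℕ} (P : Partition nq) where

  Lower : Fin (ncomp P) → Atom nq → Set
  Lower c x = All (λ s → toℕ (comp P s) < toℕ c) (statesA x)

  -- θ is ◇q' ∧ Con(A) with q' ∈ Q_c and A referring to lower states
  ExClause : Fin (ncomp P) → GC nq → Set
  ExClause c θ = Σ (Fin nq) λ q' → comp P q' ≡ c × atom (◇ q') ∈ conjuncts θ
    × All (λ χ → χ ≡ atom (◇ q') ⊎ Σ (Atom nq) λ x → χ ≡ atom x × Lower c x) (conjuncts θ)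

  -- θ is □q' ∨ Dis(A) with q' ∈ Q_c and A referring to lower states
  UnClause : Fin (ncomp P) → GC nq → Set
  UnClause c θ = Σ (Fin nq) λ q' → comp P q' ≡ c × atom (□ q') ∈ disjuncts θ
    × All (λ χ → χ ≡ atom (□ q') ⊎ Σ (Atom nq) λ x → χ ≡ atom x × Lower c x) (disjuncts θ)

  Odd : ℕ → Set
  Odd n = ¬ (2 ∣ n)

  BuchiOn : (Fin nq → ℕ) → Fin (ncomp P) → Set
  BuchiOn Ω' c = Σ ℕ λ o → Σ ℕ λ e → Odd o × 2 ∣ e × o < e
    × (∀ q → comp P q ≡ c → Ω' q ≡ o ⊎ Ω' q ≡ e)

  CoBuchiOn : (Fin nq → ℕ) → Fin (ncomp P) → Set
  CoBuchiOn Ω' c = Σ ℕ λ o → Σ ℕ λ e → Odd o × 2 ∣ e × e < o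
    × (∀ q → comp P q ≡ c → Ω' q ≡ o ⊎ Ω' q ≡ e)

  KindCond : {nAP : ℕ} → (Fin nq → Label nAP → GC nq) → (Fin nq → ℕ) → Fin nq → Kind → Set
  KindCond δ' Ω' q transient =
    ∀ a → All (λ s → toℕ (comp P s) < toℕ (comp P q)) (statesGC (δ' q a))
  KindCond δ' Ω' q existential =
    (∀ a → All (ExClause (comp P q)) (disjuncts (δ' q a))) × BuchiOn Ω' (comp P q)
  KindCond δ' Ω' q universal =
    (∀ a → All (UnClause (comp P q)) (conjuncts (δ' q a))) × CoBuchiOn Ω' (comp P q)

IsHesitant : {nAP : ℕ} → (A : GTA nAP) → Partition (nq A) → Set
IsHesitant A P = ∀ q → KindCond P (δ A) (Ω A) q (kind P (comp P q))

HGTA : ℕ → Set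
HGTA nAP = Σ (GTA nAP) λ A → Σ (Partition (nq A)) λ P → IsHesitant A P

Letter : ℕ → ℕ → Set
Letter nAP nq = Label nAP × List (Atom nq)

module _ {nAP : ℕ} (A : GTA nAP) (P : Partition (nq A)) where

  LTrans' : Kind → Fin (nq A) → Letter nAP (nq A) → Fin (nq A) → Set
  LTrans' transient q l q'' = ⊥
  LTrans' existential q (a , As) q'' =
    comp P q'' ≡ comp P q × All (Lower P (comp P q)) As
    × Σ (GC (nq A)) λ θ → θ ∈ disjuncts (δ A q a)
      × (∀ x → (atom x ∈ conjuncts θ) ⇔ (x ≡ ◇ q'' ⊎ x ∈ As))
  LTrans' universal q (a , As) q'' =
    comp P q'' ≡ comp P q × All (Lower P (comp P q)) As
    × Σ (GC (nq A)) λ θ → θ ∈ conjuncts (δ A q a)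
      × (∀ x → (atom x ∈ disjuncts θ) ⇔ (x ≡ □ q'' ⊎ x ∈ As))

  LTrans : Fin (nq A) → Letter nAP (nq A) → Fin (nq A) → Set
  LTrans q = LTrans' (kind P (comp P q)) q

  data LPath : Fin (nq A) → List (Letter nAP (nq A)) → Fin (nq A) → Set where
    lnil  : ∀ {q} → LPath q [] q
    lcons : ∀ {q q' q'' l ρ} → LTrans q l q' → LPath q' ρ q'' → LPath q (l ∷ ρ) q''

  LinCounterFree : Set
  LinCounterFree = ∀ (n : ℕ) → 0 < n → ∀ q (ρ : List (Letter nAP (nq A))) →
    LPath q (concat (replicate n ρ)) q → LPath q ρ q

  Υ : Fin (ncomp P) → List (Atom (nq A)) → Set
  Υ c As = Σ (Fin (nq A)) λ q → Σ (Fin (nq A)) λ q'' → Σ (Label nAP) λ a →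
    comp P q ≡ c × LTrans q (a , As) q''

  SameSet : List (Atom (nq A)) → List (Atom (nq A)) → Set
  SameSet As Bs = ∀ x → (x ∈ As) ⇔ (x ∈ Bs)

  MutualExclusion : Set₁
  MutualExclusion = ∀ c → kind P c ≢ transient → ∀ As Bs → Υ c As → Υ c Bs →
    ¬ SameSet As Bs →
    Σ (Atom (nq A)) λ x → Σ (Atom (nq A)) λ y → x ∈ As × y ∈ Bs ×
      (∀ (D : Set) (t : KTree nAP D) →
         Accepts (withInit A (atom x)) t ⇔ (¬ Accepts (withInit A (atom y)) t))

CounterFree : {nAP : ℕ} → HGTA nAP → Set₁
CounterFree (A , P , _) = LinCounterFree A P × MutualExclusion A P

{-# OPTIONS --safe #-}
module Submission where

-- An alternating automaton for φ has a state for every subformula, a pair of dual states for every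
-- state of the Büchi automaton of each path quantifier, and takes as alphabet of that Büchi automaton
-- the truth values of the graded atoms about the children (a complete choice of each such atom or its
-- dual, which gives mutual exclusion). Correctness is by induction on the rank of components: in a
-- universal component the dual of an accepting path would be a rejecting branch, and in an existential
-- component the run always approaches the next final state as fast as possible.
--
-- Path formulas are translated into generalised Büchi automata that predict, at each position, whether
-- the formula holds there. For CTL* these predictions are determined by the future of the word, so over
-- a periodic word they are periodic; for ⟨B⟩ψ a breakpoint construction is used. A nondeterministic
-- degeneralisation then preserves counter-freeness.

open import Defs
open import Level using (Lift; lift; lower) renaming (suc to lsuc; zero to lzero)
open import Axiom.ExcludedMiddle using (ExcludedMiddle)
open import Data.Bool using (Bool; true; false; not; if_then_else_; _∧_)
import Data.Bool.Properties as Bool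
open import Data.Empty using (⊥; ⊥-elim)
open import Data.Fin using (Fin; toℕ; combine; remQuot; fromℕ<) renaming (zero to fzero; suc to fsuc)
open import Data.Fin.Properties using (combine-monoˡ-<; combine-injectiveʳ; remQuot-combine; toℕ-injective; toℕ-fromℕ<)
open import Data.List using
  (List; []; _∷_; _++_; map; concatMap; length; filter; cartesianProduct; foldr; concat; replicate; allFin)
import Data.List as List
open import Data.List.Membership.Propositional using (_∈_; lose; find)
open import Data.List.Membership.Propositional.Properties
import Data.List.Properties as List
open import Data.List.Relation.Unary.All as All using (All; []; _∷_)
import Data.List.Relation.Unary.All.Properties as All
open import Data.List.Relation.Unary.Any using (here; there; index)
open import Data.List.Relation.Unary.Any.Properties using (lookup-index)
open import Data.Maybe using (Maybe; just; nothing; is-nothing)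
open import Data.Nat using
  (ℕ; zero; suc; _+_; _*_; _∸_; _%_; _/_; _≤_; _<_; _⊔_; s≤s; z≤n; NonZero; >-nonZero; >-nonZero⁻¹)
open import Data.Nat.DivMod
open import Data.Nat.Divisibility using (_∣_; divides; _∣?_)
open import Data.Nat.Properties
open import Data.Product using (Σ; ∃; _×_; _,_; proj₁; proj₂)
open import Data.Product.Function.NonDependent.Propositional using (_×-⇔_)
open import Data.Sum using (_⊎_; inj₁; inj₂; [_,_])
open import Data.Unit using (⊤; tt)
open import Data.Vec using (Vec; lookup; tabulate)
import Data.Vec as Vec
open import Data.Vec.Properties using (lookup∘tabulate; tabulate∘lookup; tabulate-cong)
open import Function using (_∘_; case_of_)
open import Function.Bundles using (_⇔_; mk⇔; Equivalence)
open import Function.Construct.Composition using (_⇔-∘_)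
open import Function.Construct.Identity using (⇔-id)
open import Function.Related.TypeIsomorphisms using (¬-cong-⇔)
open import Relation.Binary.PropositionalEquality hiding ([_]; J)
open import Relation.Nullary using (¬_; Dec; yes; no; does; contradiction)
open import Relation.Nullary.Decidable using (dec-true; dec-false; from-no)

-- Hesitancy allows one state of the own component per clause, so a path quantifier met while
-- another one reads its letter cannot be followed alongside it. It is resolved at the current node:
-- its automaton takes its first step at once, which leaves only atoms about children, of lower rank
-- than the reading state. No word automaton is determinised or complemented; negation passes to the
-- dual states, with □ for ◇ and co-Büchi for Büchi. Counter-freeness concerns all loops, accepting
-- or not, so the property wanted of a path automaton is one of arbitrary runs. The usual
-- round-robin passage to a single acceptance set would destroy it: when a loop word visits the sets
-- in an unfavourable order, the round-robin index needs several passes to return to its value. A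
-- memory that may forget has no such index. Directions form an arbitrary set, and states contain
-- formulas and automata, so satisfaction and equality are both decided by excluded middle.

record Finite {ℓ} (A : Set ℓ) : Set ℓ where
  field
    elems    : List A
    complete : ∀ a → a ∈ elems
open Finite public

∈-concatMap : ∀ {a b} {A : Set a} {B : Set b} (f : A → List B) {xs x y} →
  x ∈ xs → y ∈ f x → y ∈ concatMap f xs
∈-concatMap f {xs} x∈ y∈ = ∈-concatMap⁺ f {xs = xs} (lose x∈ y∈)

concatMap-∈ : ∀ {a b} {A : Set a} {B : Set b} (f : A → List B) xs {y} →
  y ∈ concatMap f xs → Σ A λ x → x ∈ xs × y ∈ f x
concatMap-∈ f xs y∈ = find (∈-concatMap⁻ f {xs = xs} y∈)

infixr 5 _◂_
_◂_ : ∀ {a} {A : Set a} → A → (ℕ → A) → ℕ → A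
(a ◂ s) zero = a
(a ◂ s) (suc i) = s i

-- Classical truth values and minimisation.

module Classical (em : ExcludedMiddle (lsuc lzero)) where

  em₀ : (P : Set) → Dec P
  em₀ P with em {Lift (lsuc lzero) P}
  ... | yes p = yes (lower p)
  ... | no ¬p = no (¬p ∘ lift)

  ⟦_⟧ : Set → Bool
  ⟦ P ⟧ = does (em₀ P)

  ⟦⟧⁺ : ∀ {P} → P → ⟦ P ⟧ ≡ true
  ⟦⟧⁺ {P} = dec-true (em₀ P)

  ⟦⟧⁻ : ∀ {P} → ⟦ P ⟧ ≡ true → P
  ⟦⟧⁻ {P} eq with em₀ P
  ... | yes p = p

  ⟦⟧-false⁺ : ∀ {P} → ¬ P → ⟦ P ⟧ ≡ false
  ⟦⟧-false⁺ {P} = dec-false (em₀ P)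

  ⟦⟧-false⁻ : ∀ {P} → ⟦ P ⟧ ≡ false → ¬ P
  ⟦⟧-false⁻ {P} eq with em₀ P
  ... | no ¬p = ¬p

  ⟦⟧-cong : ∀ {P Q} → (P → Q) → (Q → P) → ⟦ P ⟧ ≡ ⟦ Q ⟧
  ⟦⟧-cong {P} {Q} f g with em₀ P
  ... | yes p = sym (⟦⟧⁺ (f p))
  ... | no ¬p = sym (⟦⟧-false⁺ (¬p ∘ g))

  byContradiction : ∀ {P : Set} → ¬ ¬ P → P
  byContradiction {P} nn with em₀ P
  ... | yes p = p
  ... | no ¬p = ⊥-elim (nn ¬p)

  Least : (ℕ → Set) → ℕ → Set
  Least P n = P n × (∀ m → P m → n ≤ m)

  least-from : (P : ℕ → Set) → ∀ n → P n → ∃ (Least P)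
  least-from P zero p = 0 , p , λ _ _ → z≤n
  least-from P (suc n) p with em₀ (P 0)
  ... | yes p₀ = 0 , p₀ , λ _ _ → z≤n
  ... | no ¬p₀ with least-from (P ∘ suc) n p
  ...   | m , pm , min = suc m , pm , λ
    { zero p₀ → contradiction p₀ ¬p₀ ; (suc k) pk → s≤s (min k pk) }

  least : (P : ℕ → Set) → ∃ P → ∃ (Least P)
  least P (n , p) = least-from P n p

  eventually-all : ∀ {a} {A : Set a} (P : A → ℕ → Set) →
    (∀ x {m n} → m ≤ n → P x m → P x n) → (∀ x → ∃ (P x)) →
    (xs : List A) → Σ ℕ λ N → ∀ x → x ∈ xs → P x N
  eventually-all P mono ex [] = 0 , λ _ ()
  eventually-all P mono ex (x ∷ xs) with ex x | eventually-all P mono ex xs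
  ... | m , pm | n , pn = m ⊔ n , λ
    { _ (here refl) → mono x (m≤m⊔n m n) pm
    ; y (there y∈) → mono y (m≤n⊔m m n) (pn y y∈) }

  -- The least value ever attained is never left again. On the ranks along a branch this finds the
  -- point from which the branch stays at one level.
  stabilises : (f : ℕ → ℕ) → (∀ i → f (suc i) ≤ f i) → Σ ℕ λ N → ∀ i → f (i + N) ≡ f N
  stabilises f dec with least (λ v → Σ ℕ λ i → f i ≡ v) (f 0 , 0 , refl)
  ... | _ , (N , refl) , min = N , λ i → ≤-antisym (below i) (min _ (i + N , refl))
    where
    below : ∀ i → f (i + N) ≤ f N
    below zero = ≤-refl
    below (suc i) = ≤-trans (dec (i + N)) (below i)

atLeast-map : {D : Set} {k : ℕ} (P P' : D → Set) → (∀ {d} → P d → P' d) → AtLeast k P → AtLeast k P'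
atLeast-map _ _ f (g , inj , p) = g , inj , f ∘ p

atLeast-⇔ : {D : Set} {k : ℕ} (P P' : D → Set) → (∀ d → P d ⇔ P' d) → AtLeast k P ⇔ AtLeast k P'
atLeast-⇔ P P' h = mk⇔
  (atLeast-map P P' λ {d} → Equivalence.to (h d)) (atLeast-map P' P λ {d} → Equivalence.from (h d))

atLeast-one : {D : Set} (P : D → Set) → ∃ P → AtLeast 1 P
atLeast-one _ (d , p) = (λ _ → d) , (λ { {fzero} {fzero} _ → refl }) , λ _ → p

-- Word automata and the logic with automata as path quantifiers.

record NBA : Set₁ where
  field
    I         : Set
    I-finite  : Finite I
    S         : Set
    S-finite  : Finite S
    start     : S → Set
    final     : S → Set
    step      : S → (I → Bool) → S → Set
    -- Letters are functions and are compared pointwise, without function extensionality.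
    step-cong : ∀ {s v v' s'} → (∀ i → v i ≡ v' i) → step s v s' → step s v' s'

module Logic (em : ExcludedMiddle (lsuc lzero)) (nAP : ℕ) where
  open Classical em
  open NBA

  -- Branching-time formulas whose path quantifiers range over word automata: EA B φs says that
  -- B accepts, along some path, the word recording which of the φs hold.
  data SF : Set₁ where
    tt  : SF
    ap  : Fin nAP → SF
    neg : SF → SF
    and : SF → SF → SF
    Dg  : (n : ℕ) → 1 ≤ n → SF → SF
    EA  : (B : NBA) → (I B → SF) → SF

  module _ (B : NBA) {D : Set} (t : KTree nAP D) (V : List D → I B → Bool) where

    record RunFrom (s : S B) (w : List D) : Set where
      constructor runFrom
      field
        dir     : ℕ → D
        isPath  : IsPath t w dir
        run     : ℕ → S B
        run-0   : run 0 ≡ s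
        run-suc : ∀ i → step B (run i) (V (pnode w dir i)) (run (suc i))

    AcceptsFrom : S B → List D → Set
    AcceptsFrom s w = Σ (RunFrom s w) λ r → ∀ N → Σ ℕ λ i → N ≤ i × final B (RunFrom.run r i)

  sat : SF → {D : Set} → KTree nAP D → List D → Set
  sat tt t w = ⊤
  sat (ap p) t w = lookup (lab t w) p ≡ true
  sat (neg φ) t w = ¬ sat φ t w
  sat (and φ ψ) t w = sat φ t w × sat ψ t w
  sat (Dg n _ φ) t w = AtLeast n (λ d → node t (d ∷ w) × sat φ t (d ∷ w))
  sat (EA B φs) t w = Σ (S B) λ s → start B s × AcceptsFrom B t (λ u j → ⟦ sat (φs j) t u ⟧) s w

  val : {I : Set} → (I → SF) → {D : Set} → KTree nAP D → List D → I → Bool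
  val φs t u j = ⟦ sat (φs j) t u ⟧

  pnode-shift : {D : Set} (w : List D) (ds : ℕ → D) → ∀ i →
    pnode (ds 0 ∷ w) (ds ∘ suc) i ≡ pnode w ds (suc i)
  pnode-shift w ds zero = refl
  pnode-shift w ds (suc i) = cong (ds (suc i) ∷_) (pnode-shift w ds i)

  module _ {B : NBA} {D : Set} {t : KTree nAP D} {V : List D → I B → Bool} where
    open RunFrom

    tailRun : ∀ {s w} (r : RunFrom B t V s w) → RunFrom B t V (run r 1) (dir r 0 ∷ w)
    tailRun {s} {w} (runFrom ds p ρ ρ₀ st) = runFrom (ds ∘ suc)
      (λ i → subst (node t) (sym (pnode-shift w ds i)) (p (suc i)))
      (ρ ∘ suc) refl
      (λ i → subst (λ u → step B (ρ (suc i)) (V u) (ρ (suc (suc i)))) (sym (pnode-shift w ds i)) (st (suc i)))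

    headStep : ∀ {s w} (r : RunFrom B t V s w) → step B s (V w) (run r 1)
    headStep (runFrom ds p ρ refl st) = st 0

    consRun : ∀ {s w s' d} → node t w → step B s (V w) s' → RunFrom B t V s' (d ∷ w) → RunFrom B t V s w
    consRun {s} {w} {s'} {d} nw st (runFrom ds p ρ refl sts) = runFrom (d ◂ ds) path (s ◂ ρ) refl steps
      where
      path : IsPath t w (d ◂ ds)
      path zero = nw
      path (suc i) = subst (node t) (pnode-shift w (d ◂ ds) i) (p i)
      steps : ∀ i → step B ((s ◂ ρ) i) (V (pnode w (d ◂ ds) i)) (ρ i)
      steps zero = st
      steps (suc i) = subst (λ u → step B (ρ i) (V u) (ρ (suc i))) (pnode-shift w (d ◂ ds) i) (sts i)

    tailAccepts : ∀ {s w} (r : AcceptsFrom B t V s w) →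
      AcceptsFrom B t V (run (proj₁ r) 1) (dir (proj₁ r) 0 ∷ w)
    tailAccepts (r , f) = tailRun r , λ N → case f (suc N) of λ { (suc i , s≤s le , fi) → i , le , fi }

    consAccepts : ∀ {s w s' d} → node t w → step B s (V w) s' →
      AcceptsFrom B t V s' (d ∷ w) → AcceptsFrom B t V s w
    consAccepts nw st (r@(runFrom _ _ _ refl _) , f) = consRun nw st r , λ N → case f N of λ
      { (i , le , fi) → suc i , m≤n⇒m≤1+n le , fi }

-- States, ranks and transitions of the alternating automaton.

⋁ ⋀ : ∀ {n} → List (GC n) → GC n
⋁ = foldr or bot
⋀ = foldr and top

module _ {n : ℕ} {D : Set} {C : D → Set} {Int : D → Fin n → Bool} {a} {A : Set a} (g : A → GC n) where

  osat-⋁⁺ : ∀ {xs x} → x ∈ xs → osat C Int (g x) → osat C Int (⋁ (map g xs))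
  osat-⋁⁺ (here refl) o = inj₁ o
  osat-⋁⁺ (there x∈) o = inj₂ (osat-⋁⁺ x∈ o)

  osat-⋁⁻ : ∀ xs → osat C Int (⋁ (map g xs)) → Σ A λ x → x ∈ xs × osat C Int (g x)
  osat-⋁⁻ (x ∷ xs) (inj₁ o) = x , here refl , o
  osat-⋁⁻ (x ∷ xs) (inj₂ o) with osat-⋁⁻ xs o
  ... | y , y∈ , oy = y , there y∈ , oy

  osat-⋀⁺ : ∀ xs → (∀ x → x ∈ xs → osat C Int (g x)) → osat C Int (⋀ (map g xs))
  osat-⋀⁺ [] _ = tt
  osat-⋀⁺ (x ∷ xs) h = h x (here refl) , osat-⋀⁺ xs (λ y → h y ∘ there)

  osat-⋀⁻ : ∀ {xs x} → x ∈ xs → osat C Int (⋀ (map g xs)) → osat C Int (g x)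
  osat-⋀⁻ (here refl) (o , _) = o
  osat-⋀⁻ (there x∈) (_ , o) = osat-⋀⁻ x∈ o

module Automaton (em : ExcludedMiddle (lsuc lzero)) (nAP : ℕ) where
  open Classical em
  open Logic em nAP
  open NBA

  -- In fm θ the current node satisfies θ; in au B φs s some path from it is accepted by B from s.
  data Core : Set₁ where
    fm : SF → Core
    au : (B : NBA) → (I B → SF) → S B → Core

  -- The basic constraints "at least num children satisfy core".
  record Base : Set₁ where
    constructor mkBase
    field
      num   : ℕ
      1≤num : 1 ≤ num
      core  : Core
  open Base public

  -- ini b p only serves as the fresh initial state of withInit.
  data Q : Set₁ where
    st  : Bool → Core → Q
    ini : Base → Bool → Q

  CSem : Core → {D : Set} → KTree nAP D → List D → Set
  CSem (fm θ) t w = sat θ t w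
  CSem (au B φs s) t w = AcceptsFrom B t (val φs t) s w

  BSem : Base → {D : Set} → KTree nAP D → List D → Set
  BSem b t w = AtLeast (num b) (λ d → node t (d ∷ w) × CSem (core b) t (d ∷ w))

  Signed : Bool → Set → Set
  Signed true P = P
  Signed false P = ¬ P

  signed⁺ : ∀ {P} p → ⟦ P ⟧ ≡ p → Signed p P
  signed⁺ true = ⟦⟧⁻
  signed⁺ false = ⟦⟧-false⁻

  signed⁻ : ∀ {P} p → Signed p P → ⟦ P ⟧ ≡ p
  signed⁻ true = ⟦⟧⁺
  signed⁻ false = ⟦⟧-false⁺

  signed-not : ∀ {P} p → Signed p P → ¬ Signed (not p) P
  signed-not true x y = y x
  signed-not false x y = x y

  QSem : Q → {D : Set} → KTree nAP D → List D → Set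
  QSem (st p c) t w = Signed p (CSem c t w)
  QSem (ini b p) t w = Signed p (BSem b t w)

  -- The label and these atoms about the children decide the formula at a node. `Dg` contributes
  -- itself and is not entered, as its argument is a matter for the children. A quantifier
  -- contributes what its first step may need: for each state, that some child continues from it,
  -- and the atoms that evaluate the letter read here.
  base : SF → List Base
  base tt = []
  base (ap _) = []
  base (neg φ) = base φ
  base (and φ ψ) = base φ ++ base ψ
  base (Dg n p φ) = mkBase n p (fm φ) ∷ []
  base (EA B φs) =
    map (λ s → mkBase 1 (s≤s z≤n) (au B φs s)) (elems (S-finite B))
    ++ concatMap (λ j → base (φs j)) (elems (I-finite B))

  -- Only the letter part of `base (EA B φs)`: a state `au B φs s` names its successor in the
  -- leading ◇ or □ of each clause, so the remaining atoms can all be of lower rank.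
  leaves : (B : NBA) → (I B → SF) → List Base
  leaves B φs = concatMap (λ j → base (φs j)) (elems (I-finite B))

  bases : Q → List Base
  bases (st _ (fm θ)) = base θ
  bases (st _ (au B φs _)) = leaves B φs
  bases (ini b _) = b ∷ []

  ht : SF → ℕ
  ht tt = 0
  ht (ap _) = 0
  ht (neg φ) = ht φ
  ht (and φ ψ) = ht φ ⊔ ht ψ
  ht (Dg _ _ φ) = suc (ht φ)
  ht (EA B φs) = suc (foldr _⊔_ 0 (map (λ j → ht (φs j)) (elems (I-finite B))))

  -- The doubling makes room for three levels: `fm (EA B φs)` lies just above the states `au B φs s`
  -- it moves to, and these lie above every state that evaluates a letter of `B`.
  rk : Core → ℕ
  rk (fm θ) = suc (2 * ht θ)
  rk (au B φs _) = 2 * ht (EA B φs)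

  qrk : Q → ℕ
  qrk (st _ c) = rk c
  qrk (ini b _) = suc (rk (core b))

  max-upper : ∀ {a} {A : Set a} (h : A → ℕ) {xs x} → x ∈ xs → h x ≤ foldr _⊔_ 0 (map h xs)
  max-upper h {xs = y ∷ xs} (here refl) = m≤m⊔n (h y) (foldr _⊔_ 0 (map h xs))
  max-upper h {xs = y ∷ xs} (there x∈) =
    ≤-trans (max-upper h x∈) (m≤n⊔m (h y) (foldr _⊔_ 0 (map h xs)))

  ht-child : ∀ B φs j → ht (φs j) < ht (EA B φs)
  ht-child B φs j = s≤s (max-upper (ht ∘ φs) (complete (I-finite B) j))

  -- Equality occurs for the successor states of a quantifier. Entering an `EA` lowers the height,
  -- which is why the bound for `leaves` becomes strict.
  base-rk : ∀ φ {b} → b ∈ base φ → rk (core b) ≤ 2 * ht φ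
  leaves-rk : ∀ B φs {b} → b ∈ leaves B φs → rk (core b) < 2 * ht (EA B φs)
  base-rk (neg φ) b∈ = base-rk φ b∈
  base-rk (and φ ψ) b∈ with ∈-++⁻ (base φ) b∈
  ... | inj₁ l = ≤-trans (base-rk φ l) (*-monoʳ-≤ 2 (m≤m⊔n (ht φ) (ht ψ)))
  ... | inj₂ r = ≤-trans (base-rk ψ r) (*-monoʳ-≤ 2 (m≤n⊔m (ht φ) (ht ψ)))
  base-rk (Dg n p φ) (here refl) = *-monoʳ-< 2 (n<1+n (ht φ))
  base-rk (EA B φs) b∈ with ∈-++⁻ (map (λ s → mkBase 1 (s≤s z≤n) (au B φs s)) (elems (S-finite B))) b∈
  ... | inj₁ l with _ , _ , refl ← ∈-map⁻ _ l = ≤-refl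
  ... | inj₂ r = <⇒≤ (leaves-rk B φs r)
  leaves-rk B φs b∈ with concatMap-∈ (λ j → base (φs j)) (elems (I-finite B)) b∈
  ... | j , _ , b∈j = ≤-<-trans (base-rk (φs j) b∈j) (*-monoʳ-< 2 (ht-child B φs j))

  bases-rk : ∀ q {b} → b ∈ bases q → rk (core b) < qrk q
  bases-rk (st _ (fm θ)) b∈ = s≤s (base-rk θ b∈)
  bases-rk (st _ (au B φs _)) b∈ = leaves-rk B φs b∈
  bases-rk (ini _ _) (here refl) = ≤-refl

  -- A path quantifier is reduced to constraints on children by letting B read its first letter here.
  ev : Label nAP → (Base → Bool) → SF → Bool
  ev a f tt = true
  ev a f (ap p) = lookup a p
  ev a f (neg φ) = not (ev a f φ)
  ev a f (and φ ψ) = _∧_ (ev a f φ) (ev a f ψ)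
  ev a f (Dg n p φ) = f (mkBase n p (fm φ))
  ev a f (EA B φs) = ⟦ Σ (S B) (λ s → start B s × Σ (S B) λ s' →
    step B s (λ j → ev a f (φs j)) s' × f (mkBase 1 (s≤s z≤n) (au B φs s')) ≡ true) ⟧

  leaf∈ : ∀ B φs j {b} → b ∈ base (φs j) → b ∈ leaves B φs
  leaf∈ B φs j = ∈-concatMap (λ j → base (φs j)) (complete (I-finite B) j)

  leaf∈base : ∀ B φs {b} → b ∈ leaves B φs → b ∈ base (EA B φs)
  leaf∈base B φs = ∈-++⁺ʳ _

  succ∈base : ∀ B φs s → mkBase 1 (s≤s z≤n) (au B φs s) ∈ base (EA B φs)
  succ∈base B φs s = ∈-++⁺ˡ (∈-map⁺ _ (complete (S-finite B) s))

  ev-cong : ∀ a f g φ → (∀ b → b ∈ base φ → f b ≡ g b) → ev a f φ ≡ ev a g φ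
  ev-cong a f g tt h = refl
  ev-cong a f g (ap p) h = refl
  ev-cong a f g (neg φ) h = cong not (ev-cong a f g φ h)
  ev-cong a f g (and φ ψ) h = cong₂ _∧_
    (ev-cong a f g φ λ b → h b ∘ ∈-++⁺ˡ) (ev-cong a f g ψ λ b → h b ∘ ∈-++⁺ʳ (base φ))
  ev-cong a f g (Dg n p φ) h = h _ (here refl)
  ev-cong a f g (EA B φs) h = ⟦⟧-cong
    (λ { (s , i , s' , x , y) → s , i , s' , step-cong B letter x , trans (sym (h _ (succ∈base B φs s'))) y })
    (λ { (s , i , s' , x , y) → s , i , s' , step-cong B (sym ∘ letter) x , trans (h _ (succ∈base B φs s')) y })
    where
    letter : ∀ j → ev a f (φs j) ≡ ev a g (φs j)
    letter j = ev-cong a f g (φs j) λ b b∈ → h b (leaf∈base B φs (leaf∈ B φs j b∈))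

  truth : {D : Set} → KTree nAP D → List D → Base → Bool
  truth t w b = ⟦ BSem b t w ⟧

  ⟦¬⟧ : ∀ {P} → ⟦ ¬ P ⟧ ≡ not ⟦ P ⟧
  ⟦¬⟧ {P} with em₀ P
  ... | yes p = ⟦⟧-false⁺ (λ ¬p → ¬p p)
  ... | no ¬p = ⟦⟧⁺ ¬p

  ⟦×⟧ : ∀ {P P'} → ⟦ P × P' ⟧ ≡ _∧_ ⟦ P ⟧ ⟦ P' ⟧
  ⟦×⟧ {P} {P'} with em₀ P | em₀ P'
  ... | yes p | yes q = ⟦⟧⁺ (p , q)
  ... | yes p | no ¬q = ⟦⟧-false⁺ (¬q ∘ proj₂)
  ... | no ¬p | _ = ⟦⟧-false⁺ (¬p ∘ proj₁)

  -- For `EA` an accepting run is split at its first step: the start state reads the letter at w,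
  -- and the rest is an accepting run from a child, which is what the atom of grade one asserts.
  ev-truth : {D : Set} (t : KTree nAP D) (w : List D) → node t w → ∀ φ →
    ev (lab t w) (truth t w) φ ≡ ⟦ sat φ t w ⟧
  ev-truth t w nw tt = sym (⟦⟧⁺ tt)
  ev-truth t w nw (ap p) with lookup (lab t w) p in eq
  ... | true = sym (⟦⟧⁺ refl)
  ... | false = sym (⟦⟧-false⁺ λ ())
  ev-truth t w nw (neg φ) = trans (cong not (ev-truth t w nw φ)) (sym ⟦¬⟧)
  ev-truth t w nw (and φ ψ) =
    trans (cong₂ _∧_ (ev-truth t w nw φ) (ev-truth t w nw ψ)) (sym ⟦×⟧)
  ev-truth t w nw (Dg n p φ) = refl
  ev-truth t w nw (EA B φs) = ⟦⟧-cong to from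
    where
    letter : ∀ j → ev (lab t w) (truth t w) (φs j) ≡ ⟦ sat (φs j) t w ⟧
    letter j = ev-truth t w nw (φs j)
    to : _ → _
    to (s , i , s' , x , y) with ⟦⟧⁻ y
    ... | g , _ , h = s , i , consAccepts nw (step-cong B letter x) (proj₂ (h fzero))
    from : _ → _
    from (s , i , acc@(r , _)) = s , i , RunFrom.run r 1 , step-cong B (sym ∘ letter) (headStep r) ,
      ⟦⟧⁺ (atLeast-one (λ d → node t (d ∷ w) × CSem (au B φs (RunFrom.run r 1)) t (d ∷ w)) (RunFrom.dir r 0 , RunFrom.isPath r 1 , tailAccepts acc))

  -- Atoms contain automata and functions, so their equality is decided classically rather than by
  -- computation.
  update : Base → Bool → (Base → Bool) → Base → Bool
  update b x f b' = if does (em {b' ≡ b}) then x else f b'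

  choices : List Base → List (Base → Bool)
  choices [] = (λ _ → false) ∷ []
  choices (b ∷ bs) = concatMap (λ f → update b false f ∷ update b true f ∷ []) (choices bs)

  -- There are too many functions on `Base` to enumerate; the finite list `choices` suffices because
  -- `ev` looks only at the listed atoms.
  choose : (g : Base → Bool) → ∀ bs → Σ (Base → Bool) λ f → f ∈ choices bs × (∀ b → b ∈ bs → f b ≡ g b)
  choose g [] = _ , here refl , λ _ ()
  choose g (b ∷ bs) with choose g bs
  ... | f , f∈ , eq = update b (g b) f , ∈-concatMap _ f∈ (member (g b)) , agrees
    where
    member : ∀ x → update b x f ∈ update b false f ∷ update b true f ∷ []
    member false = here refl
    member true = there (here refl)
    agrees : ∀ b' → b' ∈ b ∷ bs → update b (g b) f b' ≡ g b'
    agrees b' b'∈ with em {b' ≡ b} | b'∈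
    ... | yes refl | _ = refl
    ... | no b'≢b | here b'≡b = contradiction b'≡b b'≢b
    ... | no _ | there b'∈bs = eq b' b'∈bs

  -- Two assignments either carry the same information or clash on an atom that one asserts and the
  -- other denies. Such a clash satisfies a universal clause whose assignment is wrong, and it
  -- separates two letters for mutual exclusion.
  agree? : ∀ (f g : Base → Bool) bs →
    (∀ b → b ∈ bs → f b ≡ g b) ⊎ Σ Base λ b → b ∈ bs × g b ≡ not (f b)
  agree? f g [] = inj₁ λ _ ()
  agree? f g (b ∷ bs) with f b Bool.≟ g b | agree? f g bs
  ... | no ne | _ = inj₂ (b , here refl , Bool.¬-not (ne ∘ sym))
  ... | yes _ | inj₂ (b' , b'∈ , ne) = inj₂ (b' , there b'∈ , ne)
  ... | yes eq | inj₁ h = inj₁ λ { _ (here refl) → eq ; b' (there b'∈) → h b' b'∈ }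

  -- Dualising a Büchi condition shifts its priorities by one: final states have 2 against 1 on the
  -- existential side and 1 against 0 on the universal side. The other states get 0; no branch of
  -- the run constructed below stays in them, as ranks drop strictly there.
  prio : Q → ℕ
  prio (st true (au B _ s)) = if ⟦ final B s ⟧ then 2 else 1
  prio (st false (au B _ s)) = if ⟦ final B s ⟧ then 1 else 0
  prio _ = 0

  edges : (B : NBA) → (I B → SF) → S B → Label nAP → List ((Base → Bool) × S B)
  edges B φs s a = filter (λ (f , s') → em₀ (step B s (λ j → ev a f (φs j)) s'))
    (cartesianProduct (choices (leaves B φs)) (elems (S-finite B)))

  module Delta {N : ℕ} (e : Bool → Core → Fin N) where

    -- The negation of "at least n children satisfy c" is a box on the dual state: fewer than n
    -- children fail the dual.
    at : Base → Bool → Atom N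
    at (mkBase n p c) true = dia n p (var (e true c))
    at (mkBase n p c) false = box n p (var (e false c))

    con dis : List Base → (Base → Bool) → GC N
    con bs f = ⋀ (map (λ b → atom (at b (f b))) bs)
    dis bs f = ⋁ (map (λ b → atom (at b (not (f b)))) bs)

    -- The universal clause is the De Morgan dual of the existential one: either the assignment f is
    -- wrong about some atom, or every child carries on with the dual of s'.
    exClause unClause : (B : NBA) (φs : I B → SF) → (Base → Bool) × S B → GC N
    exClause B φs (f , s') = and (atom (◇ e true (au B φs s'))) (con (leaves B φs) f)
    unClause B φs (f , s') = or (atom (□ e false (au B φs s'))) (dis (leaves B φs) f)

    mkδ : Q → Label nAP → GC N
    mkδ (st p (fm θ)) a =
      -- Both signs get a disjunction of complete assignments, since the negation of θ is just the
      -- other value of `ev`.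
      ⋁ (map (con (base θ)) (filter (λ f → ev a f θ Bool.≟ p) (choices (base θ))))
    mkδ (st true (au B φs s)) a = ⋁ (map (exClause B φs) (edges B φs s a))
    mkδ (st false (au B φs s)) a = ⋀ (map (unClause B φs) (edges B φs s a))
    mkδ (ini b p) a = atom (at b p)

-- Branches through a given run node, and parity conditions on tails.

bnode-from : {X : Set} → List X → (ℕ → X) → ℕ → List X
bnode-from r x zero = r
bnode-from r x (suc k) = x k ∷ bnode-from r x k

-- Nodes are stored reversed, so the branch through r must spell r from its far end: each element
-- moved over is put in front of the continuation.
prepend : {X : Set} → List X → (ℕ → X) → ℕ → X
prepend [] x = x
prepend (y ∷ r) x = prepend r (y ◂ x)

bnode-prepend : {X : Set} (r : List X) (x : ℕ → X) → ∀ k →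
  bnode (prepend r x) (k + length r) ≡ bnode-from r x k
bnode-prepend [] x zero = refl
bnode-prepend [] x (suc k) =
  cong₂ _∷_ (cong x (+-identityʳ k)) (bnode-prepend [] x k)
bnode-prepend (y ∷ r) x k = trans (cong (bnode (prepend (y ∷ r) x)) (+-suc k (length r)))
  (trans (bnode-prepend r (y ◂ x) (suc k)) (shift k))
  where
  shift : ∀ k → bnode-from r (y ◂ x) (suc k) ≡ bnode-from (y ∷ r) x k
  shift zero = refl
  shift (suc k) = cong (x k ∷_) (shift k)

parity-tail : ∀ (p : ℕ → ℕ) N → ParityAcc p → ParityAcc (λ k → p (k + N))
parity-tail p N (m , even , inf , M , bound) = m , even ,
  (λ L → case inf (L + N) of λ { (i , le , eq) → i ∸ N , m+n≤o⇒m≤o∸n L le ,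
    trans (cong p (m∸n+n≡m (≤-trans (m≤n+m N L) le))) eq }) ,
  M , λ i le → bound (i + N) (≤-trans le (m≤m+n i N))

parity-untail : ∀ (p : ℕ → ℕ) N → ParityAcc (λ k → p (k + N)) → ParityAcc p
parity-untail p N (m , even , inf , M , bound) = m , even ,
  (λ L → case inf L of λ { (i , le , eq) → i + N , ≤-trans le (m≤m+n i N) , eq }) ,
  M + N , λ i le → subst (λ j → p j ≤ m) (m∸n+n≡m (≤-trans (m≤n+m N M) le))
    (bound (i ∸ N) (m+n≤o⇒m≤o∸n M le))

parity-cong : ∀ {p p' : ℕ → ℕ} → (∀ k → p k ≡ p' k) → ParityAcc p → ParityAcc p'
parity-cong eq (m , even , inf , M , bound) = m , even ,
  (λ L → case inf L of λ { (i , le , eqi) → i , le , trans (sym (eq i)) eqi }) ,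
  M , λ i le → subst (_≤ m) (eq i) (bound i le)

¬2∣1 : ¬ (2 ∣ 1)
¬2∣1 = from-no (2 ∣? 1)

buchi⁻ : (b : ℕ → Bool) → ParityAcc (λ k → if b k then 2 else 1) → ∀ N → Σ ℕ λ i → N ≤ i × b i ≡ true
buchi⁻ b (m , even , inf , _) N with inf N
... | i , le , eq with b i in bi
...   | true = i , le , bi
...   | false = contradiction (subst (2 ∣_) (sym eq) even) ¬2∣1

buchi⁺ : (b : ℕ → Bool) → (∀ N → Σ ℕ λ i → N ≤ i × b i ≡ true) → ParityAcc (λ k → if b k then 2 else 1)
buchi⁺ b inf = 2 , divides 1 refl ,
  (λ N → case inf N of λ { (i , le , eq) → i , le , cong (if_then 2 else 1) eq }) ,
  0 , λ i _ → le (b i)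
  where
  le : ∀ x → (if x then 2 else 1) ≤ 2
  le true = ≤-refl
  le false = s≤s z≤n

coBuchi⁻ : (b : ℕ → Bool) → ParityAcc (λ k → if b k then 1 else 0) → Σ ℕ λ N → ∀ i → N ≤ i → b i ≡ false
coBuchi⁻ b (m , even , inf , M , bound) with inf M
... | i , _ , eq with b i
...   | true = contradiction (subst (2 ∣_) (sym eq) even) ¬2∣1
...   | false with refl ← eq = M , λ j le → low (b j) (bound j le)
  where
  low : ∀ x → (if x then 1 else 0) ≤ 0 → x ≡ false
  low false _ = refl

coBuchi⁺ : (b : ℕ → Bool) → (Σ ℕ λ N → ∀ i → N ≤ i → b i ≡ false) → ParityAcc (λ k → if b k then 1 else 0)
coBuchi⁺ b (M , h) = 0 , divides 0 refl ,
  (λ N → N ⊔ M , m≤m⊔n N M , cong (if_then 1 else 0) (h (N ⊔ M) (m≤n⊔m N M))) ,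
  M , λ i le → ≤-reflexive (cong (if_then 1 else 0) (h i le))

-- From accepting runs to truth.

module Correctness (em : ExcludedMiddle (lsuc lzero)) (nAP : ℕ) where
  open Classical em
  open Logic em nAP
  open Automaton em nAP
  open NBA
  open RunFrom

  -- A GTA whose states decode, via dec, to elements of Q; the states referred to by its
  -- constraints are encoded by enc, which is only meaningful on the cores satisfying Present.
  record Represents (G : GTA nAP) : Set₂ where
    field
      dec       : Fin (nq G) → Q
      enc       : Bool → Core → Fin (nq G)
      δ-eq      : ∀ i a → δ G i a ≡ Delta.mkδ enc (dec i) a
      Ω-eq      : ∀ i → Ω G i ≡ prio (dec i)
      Present   : Core → Set₁
      dec-enc   : ∀ p c → Present c → dec (enc p c) ≡ st p c
      base-pres : ∀ i {b} → b ∈ bases (dec i) → Present (core b)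
      step-pres : ∀ i {p B φs s} → dec i ≡ st p (au B φs s) → ∀ s' → Present (au B φs s')

  module _ {G : GTA nAP} (rep : Represents G) {D : Set} (t : KTree nAP D) where
    open Represents rep
    open Delta enc

    Node : Set
    Node = List (Fin (nq G) × D)

    stateAt : Node → Q
    stateAt r = dec (rstate (q0 G) r)

    module RunSound (ρ : Run G t) (acc : AcceptingRun ρ) where

      -- Acceptance concerns branches from the root, while g may start anywhere in the run. The path
      -- from the root to `g 0` is put in front, which stays in the run because runs are closed
      -- under prefixes, and the parity condition is then restricted to the tail.
      branch-parity : (g : ℕ → Node) (x : ℕ → Fin (nq G) × D) → (∀ k → R ρ (g k)) →
        (∀ k → g (suc k) ≡ x k ∷ g k) → ParityAcc (λ k → prio (stateAt (g k)))
      branch-parity g x rg eq =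
        parity-cong (λ k → trans (Ω-eq _) (cong (λ r → prio (stateAt r)) (same k)))
          (parity-tail _ (length (g 0)) (acc b (λ i → down (length (g 0)) i (inR i))))
        where
        b : ℕ → Fin (nq G) × D
        b = prepend (g 0) x
        from-eq : ∀ k → bnode-from (g 0) x k ≡ g k
        from-eq zero = refl
        from-eq (suc k) = trans (cong (x k ∷_) (from-eq k)) (sym (eq k))
        same : ∀ k → bnode b (k + length (g 0)) ≡ g k
        same k = trans (bnode-prepend (g 0) x k) (from-eq k)
        inR : ∀ k → R ρ (bnode b (k + length (g 0)))
        inR k = subst (R ρ) (sym (same k)) (rg k)
        down : ∀ n i → R ρ (bnode b (i + n)) → R ρ (bnode b i)
        down zero i h = subst (λ j → R ρ (bnode b j)) (+-identityʳ i) h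
        down (suc n) i h = rprefix ρ (down n (suc i) (subst (λ j → R ρ (bnode b j)) (+-suc i n) h))

      Sound : Node → Set
      Sound r = R ρ r → QSem (stateAt r) t (rword r)

      module _ {n : ℕ} (IH : ∀ r → qrk (stateAt r) < n → Sound r) where

        nodeAt : ∀ {r} → R ρ r → node t (rword r)
        nodeAt {[]} _ = root t
        nodeAt {(q , d) ∷ r} h = proj₁ (Equivalence.to (proj₂ (proj₂ (local ρ (rprefix ρ h))) q d) h)

        module AtNode {r : Node} (Rr : R ρ r) where
          C : D → Set
          C d = node t (d ∷ rword r)
          Int : D → Fin (nq G) → Bool
          Int = proj₁ (local ρ Rr)
          child : ∀ q d → C d → Int d q ≡ true → R ρ ((q , d) ∷ r)
          child q d nd eq = Equivalence.from (proj₂ (proj₂ (local ρ Rr)) q d) (nd , eq)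
          constraint : osat C Int (mkδ (stateAt r) (lab t (rword r)))
          constraint = subst (osat C Int) (δ-eq _ _) (proj₁ (proj₂ (local ρ Rr)))
          at-sound : ∀ b p → Present (core b) → rk (core b) < n →
            osatA C Int (at b p) → Signed p (BSem b t (rword r))
          at-sound b p pres lt = go p
            where
            state-eq : ∀ p → dec (enc p (core b)) ≡ st p (core b)
            state-eq p = dec-enc p (core b) pres
            below : ∀ p d → C d → Int d (enc p (core b)) ≡ true → QSem (st p (core b)) t (d ∷ rword r)
            below p d nd eq = subst (λ q → QSem q t (d ∷ rword r)) (state-eq p)
              (IH ((enc p (core b) , d) ∷ r) (subst (λ q → qrk q < n) (sym (state-eq p)) lt) (child _ d nd eq))
            go : ∀ p → osatA C Int (at b p) → Signed p (BSem b t (rword r))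
            go true o = atLeast-map (λ d → C d × Int d (enc true (core b)) ≡ true) _
              (λ { {d} (nd , eq) → nd , below true d nd eq }) o
            -- By the induction hypothesis a child satisfying the core cannot carry the dual state,
            -- so each such child counts against the box.
            go false o bs = o (atLeast-map (λ d → C d × CSem (core b) t (d ∷ rword r))
              (λ d → C d × Int d (enc false (core b)) ≡ false)
              (λ { {d} (nd , c) → nd , refute d nd c }) bs)
              where
              refute : ∀ d → C d → CSem (core b) t (d ∷ rword r) → Int d (enc false (core b)) ≡ false
              refute d nd c with Int d (enc false (core b)) in eq
              ... | true = contradiction c (below false d nd eq)
              ... | false = refl

        open AtNode

        -- The conjunction fixes the sign of every atom, so soundness of the separate atoms leaves
        -- the true assignment as the only candidate.
        con-sound : ∀ {r} (Rr : R ρ r) bs f → (∀ {b} → b ∈ bs → Present (core b) × rk (core b) < n) →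
          osat (C Rr) (Int Rr) (con bs f) → ∀ b → b ∈ bs → f b ≡ truth t (rword r) b
        con-sound Rr bs f ok o b b∈ = sym (signed⁻ (f b)
          (at-sound Rr b (f b) (proj₁ (ok b∈)) (proj₂ (ok b∈)) (osat-⋀⁻ (λ b → atom (at b (f b))) b∈ o)))

        dis-unsat : ∀ {r} (Rr : R ρ r) bs f → (∀ {b} → b ∈ bs → Present (core b) × rk (core b) < n) →
          (∀ b → b ∈ bs → f b ≡ truth t (rword r) b) → ¬ osat (C Rr) (Int Rr) (dis bs f)
        dis-unsat Rr bs f ok eq o with osat-⋁⁻ (λ b → atom (at b (not (f b)))) bs o
        ... | b , b∈ , ob = signed-not (f b) (signed⁺ (f b) (sym (eq b b∈)))
              (at-sound Rr b (not (f b)) (proj₁ (ok b∈)) (proj₂ (ok b∈)) ob)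

        fm-sound : ∀ p θ r → stateAt r ≡ st p (fm θ) → rk (fm θ) ≤ n → R ρ r → Signed p (sat θ t (rword r))
        fm-sound p θ r eq le Rr
          with osat-⋁⁻ (con (base θ)) _ (subst (λ q → osat _ _ (mkδ q _)) eq (constraint Rr))
        ... | f , f∈ , o = signed⁺ p (trans (sym (ev-truth t (rword r) (nodeAt Rr) θ))
                (trans (sym (ev-cong (lab t (rword r)) f (truth t (rword r)) θ (con-sound Rr (base θ) f ok o)))
                  (proj₂ (∈-filter⁻ (λ f → ev (lab t (rword r)) f θ Bool.≟ p) {xs = choices (base θ)} f∈))))
          where
          ok : ∀ {b} → b ∈ base θ → Present (core b) × rk (core b) < n
          ok {b} b∈ = base-pres _ (subst (λ q → b ∈ bases q) (sym eq) b∈) , ≤-trans (s≤s (base-rk θ b∈)) le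

        module AuSound (B : NBA) (φs : I B → SF) (le : 2 * ht (EA B φs) ≤ n) where

          record AuNode (p : Bool) : Set₁ where
            field
              r  : Node
              Rr : R ρ r
              s  : S B
              eq : stateAt r ≡ st p (au B φs s)
          open AuNode

          word : ∀ {p} → AuNode p → List D
          word u = rword (r u)

          ok : ∀ {p} (u : AuNode p) {b} → b ∈ leaves B φs → Present (core b) × rk (core b) < n
          ok u {b} b∈ = base-pres _ (subst (λ q → b ∈ bases q) (sym (eq u)) b∈) , <-≤-trans (leaves-rk B φs b∈) le

          pres : ∀ {p} (u : AuNode p) s' → Present (au B φs s')
          pres u = step-pres _ (eq u)

          moveTo : ∀ {p} (u : AuNode p) d s' → C (Rr u) d → Int (Rr u) d (enc p (au B φs s')) ≡ true → AuNode p
          moveTo {p} u d s' nd i = record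
            { r = (enc p (au B φs s') , d) ∷ r u ; Rr = child (Rr u) _ d nd i
            ; s = s' ; eq = dec-enc p _ (pres u s') }

          letter : ∀ u f → (∀ b → b ∈ leaves B φs → f b ≡ truth t u b) → node t u →
            ∀ j → ev (lab t u) f (φs j) ≡ val φs t u j
          letter u f h nu j = trans
            (ev-cong (lab t u) f (truth t u) (φs j) λ b b∈ → h b (leaf∈ B φs j b∈)) (ev-truth t u nu (φs j))

          record Move (u : AuNode true) : Set₁ where
            field
              d    : D
              next : AuNode true
              r-eq : r next ≡ (rstate (q0 G) (r next) , d) ∷ r u
              stp  : step B (s u) (val φs t (word u)) (s next)
          open Move

          move : ∀ u → Move u
          move u with osat-⋁⁻ (exClause B φs) _ (subst (λ q → osat _ _ (mkδ q _)) (eq u) (constraint (Rr u)))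
          ... | (f , s') , fs∈ , ((g , _ , h) , o) = record
            { d = g fzero ; next = moveTo u (g fzero) s' (proj₁ (h fzero)) (proj₂ (h fzero)) ; r-eq = refl
            ; stp = step-cong B (letter (word u) f (con-sound (Rr u) (leaves B φs) f (ok u) o) (nodeAt (Rr u)))
                (proj₂ (∈-filter⁻ (λ (f , s') → em₀ (step B (s u) (λ j → ev (lab t (word u)) f (φs j)) s'))
                  {xs = cartesianProduct (choices (leaves B φs)) (elems (S-finite B))} fs∈)) }

          -- Following the leading ◇ from node to node yields a tree path and a run of `B` together;
          -- the word read is the true one by `con-sound`, and the condition on the branch makes the
          -- run accepting.
          ex-sound : (u : AuNode true) → AcceptsFrom B t (val φs t) (s u) (word u)
          ex-sound u = runFrom ds path (s ∘ us) refl steps , λ N → case fin N of λ { (i , l , x) → i , l , ⟦⟧⁻ x }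
            where
            us : ℕ → AuNode true
            us zero = u
            us (suc k) = next (move (us k))
            ds : ℕ → D
            ds k = d (move (us k))
            pn : ∀ k → pnode (word u) ds k ≡ word (us k)
            pn zero = refl
            pn (suc k) = trans (cong (ds k ∷_) (pn k)) (sym (cong rword (r-eq (move (us k)))))
            path : IsPath t (word u) ds
            path k = subst (node t) (sym (pn k)) (nodeAt (Rr (us k)))
            steps : ∀ k → step B (s (us k)) (val φs t (pnode (word u) ds k)) (s (us (suc k)))
            steps k = subst (λ w → step B (s (us k)) (val φs t w) (s (us (suc k)))) (sym (pn k)) (stp (move (us k)))
            fin : ∀ N → Σ ℕ λ i → N ≤ i × ⟦ final B (s (us i)) ⟧ ≡ true
            fin = buchi⁻ _ (parity-cong (λ k → cong prio (eq (us k)))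
              (branch-parity (r ∘ us) _ (λ k → Rr (us k)) (λ k → r-eq (move (us k)))))

          un-sound : (u : AuNode false) → ¬ AcceptsFrom B t (val φs t) (s u) (word u)
          un-sound u (runFrom ds path σ σ₀ steps , inf) = refute (coBuchi⁻ _
              (parity-cong (λ k → cong prio (trans (eq (us k)) (cong (λ s → st false (au B φs s)) (us-s k))))
                (branch-parity (r ∘ us) _ (λ k → Rr (us k)) (λ k → refl))))
            where
            record Along (k : ℕ) : Set₁ where
              field
                nd   : AuNode false
                s-eq : s nd ≡ σ k
                w-eq : word nd ≡ pnode (word u) ds k
            open Along
            extend : ∀ k → (v : Along k) → Int (Rr (nd v)) (ds k) (enc false (au B φs (σ (suc k)))) ≡ true
            extend k v with Int (Rr (nd v)) (ds k) (enc false (au B φs (σ (suc k)))) in i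
            ... | true = refl
            -- The clause examined is the one for the true assignment and the step that `B` takes.
            -- Its disjunction of atoms is then false, so its box must hold, and the box forbids a
            -- child without the dual state.
            ... | false with choose (truth t (word (nd v))) (leaves B φs)
            ...   | f , f∈ , h with osat-⋀⁻ {C = C (Rr (nd v))} {Int = Int (Rr (nd v))} (unClause B φs)
                      (∈-filter⁺ (λ (f , s') → em₀ (step B (s (nd v)) (λ j → ev (lab t (word (nd v))) f (φs j)) s'))
                        (∈-cartesianProduct⁺ f∈ (complete (S-finite B) (σ (suc k))))
                        (step-cong B (λ j → sym (letter _ f h (nodeAt (Rr (nd v))) j))
                          (subst₂ (λ s w → step B s (val φs t w) (σ (suc k))) (sym (s-eq v)) (sym (w-eq v)) (steps k))))
                      (subst (λ q → osat _ _ (mkδ q _)) (eq (nd v)) (constraint (Rr (nd v))))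
            ...     | inj₁ no-box = ⊥-elim (no-box (atLeast-one (λ d → C (Rr (nd v)) d × Int (Rr (nd v)) d (enc false (au B φs (σ (suc k)))) ≡ false)
                        (ds k , subst (λ w → node t (ds k ∷ w)) (sym (w-eq v)) (path (suc k)) , i)))
            ...     | inj₂ o = ⊥-elim (dis-unsat (Rr (nd v)) (leaves B φs) f (ok (nd v)) h o)
            along : ∀ k → Along k
            along zero = record { nd = u ; s-eq = sym σ₀ ; w-eq = refl }
            along (suc k) = record
              { nd = moveTo (nd v) (ds k) (σ (suc k))
                  (subst (λ w → node t (ds k ∷ w)) (sym (w-eq v)) (path (suc k))) (extend k v)
              ; s-eq = refl ; w-eq = cong (ds k ∷_) (w-eq v) }
              where v = along k
            us : ℕ → AuNode false
            us k = nd (along k)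
            us-s : ∀ k → s (us k) ≡ σ k
            us-s k = s-eq (along k)
            refute : (Σ ℕ λ M → ∀ i → M ≤ i → ⟦ final B (σ i) ⟧ ≡ false) → ⊥
            refute (M , never) with inf M
            ... | i , le , fi = ⟦⟧-false⁻ (never i le) fi

        node-sound : ∀ r → qrk (stateAt r) ≤ n → Sound r
        node-sound r le Rr with stateAt r in eq
        ... | st p (fm θ) = fm-sound p θ r eq le Rr
        ... | st true (au B φs s) = AuSound.ex-sound B φs le (record { r = r ; Rr = Rr ; s = s ; eq = eq })
        ... | st false (au B φs s) = AuSound.un-sound B φs le (record { r = r ; Rr = Rr ; s = s ; eq = eq })
        ... | ini b p = at-sound Rr b p (base-pres _ (subst (λ q → b ∈ bases q) (sym eq) (here refl))) le
                (subst (λ q → osat _ _ (mkδ q _)) eq (constraint Rr))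

      sound : ∀ n r → qrk (stateAt r) < n → Sound r
      sound (suc n) r (s≤s le) = node-sound (sound n) r le

    accepts-sound : Accepts G t → QSem (dec (q0 G)) t []
    accepts-sound (ρ , acc) = RunSound.sound ρ acc _ [] ≤-refl (rroot ρ)

    -- From truth to an accepting run.

    Dist : ∀ B (φs : I B → SF) → ℕ → S B → List D → Set
    Dist B φs n s w = Σ (AcceptsFrom B t (val φs t) s w) λ a → final B (run (proj₁ a) n)

    dist-zero : ∀ {B φs s w} → Dist B φs 0 s w → final B s
    dist-zero ((runFrom _ _ _ refl _ , _) , f) = f

    -- Decreasing the distance to the next final state makes the strategy positional: no witness path has
    -- to be remembered along a branch of the run.
    record Optimal B (φs : I B → SF) (s : S B) (w : List D) (d : D) (s' : S B) (n : ℕ) : Set where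
      field
        nd   : node t (d ∷ w)
        stp  : step B s (val φs t w) s'
        dist : Dist B φs n s' (d ∷ w)
        min  : ∀ m d' s'' → node t (d' ∷ w) → step B s (val φs t w) s'' → Dist B φs m s'' (d' ∷ w) → n ≤ m

    -- The run sends to a child every state allowed here. Constraints are positive, so sending many
    -- states does no harm at a node; the limits serve the branches: a lower state must be true, an
    -- existential state follows an optimal move, a universal one a step of `B`.
    data Allowed (w : List D) (d : D) : Q → Q → Set₁ where
      drop   : ∀ {q q'} → qrk q' < qrk q → QSem q' t (d ∷ w) → Allowed w d q q'
      stay-∃ : ∀ {B φs s s'} n → Optimal B φs s w d s' n → Allowed w d (st true (au B φs s)) (st true (au B φs s'))
      stay-∀ : ∀ {B φs s s'} → step B s (val φs t w) s' → Allowed w d (st false (au B φs s)) (st false (au B φs s'))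

    allowed-sem : ∀ {w d q q'} → node t (d ∷ w) → QSem q t w → Allowed w d q q' → QSem q' t (d ∷ w)
    allowed-sem nd sem (drop _ sem') = sem'
    allowed-sem nd sem (stay-∃ n o) = proj₁ (Optimal.dist o)
    allowed-sem nd sem (stay-∀ x) acc = sem (consAccepts (prefix t nd) x acc)

    allowed-rk : ∀ {w d q q'} → Allowed w d q q' → qrk q' ≤ qrk q
    allowed-rk (drop lt _) = <⇒≤ lt
    allowed-rk (stay-∃ _ _) = ≤-refl
    allowed-rk (stay-∀ _) = ≤-refl

    -- A move that keeps the rank happens inside the component of one automaton, so a branch of
    -- constant rank can be read as a run of that automaton.
    stays : ∀ {w d q q'} → Allowed w d q q' → qrk q' ≡ qrk q →
      Σ Bool λ p → Σ NBA λ B → Σ (I B → SF) λ φs → Σ (S B) λ s → q ≡ st p (au B φs s)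
    stays (drop lt _) eq = contradiction eq (<⇒≢ lt)
    stays (stay-∃ _ _) _ = true , _ , _ , _ , refl
    stays (stay-∀ _) _ = false , _ , _ , _ , refl

    optimal : ∀ B φs s w → AcceptsFrom B t (val φs t) s w → Σ D λ d → Σ (S B) λ s' → ∃ (Optimal B φs s w d s')
    optimal B φs s w acc@(r , inf) with least
      (λ n → Σ D λ d → Σ (S B) λ s' → node t (d ∷ w) × step B s (val φs t w) s' × Dist B φs n s' (d ∷ w))
      -- Asking for a final position of at least 1 leaves one after the first step, so some
      -- successor has a finite distance.
      (case inf 1 of λ { (suc i , _ , fi) → i , dir r 0 , run r 1 , isPath r 1 , headStep r , tailAccepts acc , fi })
    ... | n , (d , s' , nd , x , ds) , min = d , s' , n , record
      { nd = nd ; stp = x ; dist = ds ; min = λ m d' s'' nd' x' ds' → min m (d' , s'' , nd' , x' , ds') }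

    allowed? : List D → Q → D → Q → Bool
    allowed? w q d q' = does (em {Allowed w d q q'})

    allowed⁺ : ∀ {w q d q'} → Allowed w d q q' → allowed? w q d q' ≡ true
    allowed⁺ {w} {q} {d} {q'} = dec-true (em {Allowed w d q q'})

    allowed⁻ : ∀ w q d q' → allowed? w q d q' ≡ true → Allowed w d q q'
    allowed⁻ w q d q' eq with em {Allowed w d q q'}
    ... | yes a = a

    RunNode : Node → Set
    RunNode [] = ⊤
    RunNode ((i , d) ∷ r) = RunNode r × node t (d ∷ rword r) × allowed? (rword r) (stateAt r) d (dec i) ≡ true

    module RunComplete (init : QSem (dec (q0 G)) t []) where

      node-sem : ∀ r → RunNode r → node t (rword r) × QSem (stateAt r) t (rword r)
      node-sem [] _ = root t , init
      node-sem ((i , d) ∷ r) (rr , nd , al) =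
        nd , allowed-sem nd (proj₂ (node-sem r rr)) (allowed⁻ (rword r) (stateAt r) d (dec i) al)

      module _ {i : Fin (nq G)} {w : List D} (nw : node t w) (sem : QSem (dec i) t w) where
        C : D → Set
        C d = node t (d ∷ w)
        Int : D → Fin (nq G) → Bool
        Int d i' = allowed? w (dec i) d (dec i')

        at-complete : ∀ b p → Present (core b) → rk (core b) < qrk (dec i) →
          Signed p (BSem b t w) → osatA C Int (at b p)
        at-complete b p pres lt = go p
          where
          below : ∀ p d → Signed p (CSem (core b) t (d ∷ w)) → Int d (enc p (core b)) ≡ true
          below p d sg = allowed⁺ (subst (Allowed w d (dec i)) (sym (dec-enc p (core b) pres)) (drop lt sg))
          go : ∀ p → Signed p (BSem b t w) → osatA C Int (at b p)
          go true = atLeast-map (λ d → C d × CSem (core b) t (d ∷ w)) (λ d → C d × Int d (enc true (core b)) ≡ true)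
            λ { {d} (nd , c) → nd , below true d c }
          go false ¬b o = ¬b (atLeast-map (λ d → C d × Int d (enc false (core b)) ≡ false)
            (λ d → C d × CSem (core b) t (d ∷ w)) (λ { {d} (nd , x) → nd , holds d x }) o)
            where
            holds : ∀ d → Int d (enc false (core b)) ≡ false → CSem (core b) t (d ∷ w)
            holds d x = byContradiction λ ¬c → case trans (sym (below false d ¬c)) x of λ ()

        base-complete : ∀ {b} p → b ∈ bases (dec i) → Signed p (BSem b t w) → osatA C Int (at b p)
        base-complete {b} p b∈ = at-complete b p (base-pres i b∈) (bases-rk (dec i) b∈)

        con-complete : ∀ bs f → (∀ {b} → b ∈ bs → b ∈ bases (dec i)) →
          (∀ b → b ∈ bs → f b ≡ truth t w b) → osat C Int (con bs f)
        con-complete bs f sub h = osat-⋀⁺ _ bs λ b b∈ →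
          base-complete (f b) (sub b∈) (signed⁺ (f b) (sym (h b b∈)))

        letter : ∀ B φs f → (∀ b → b ∈ leaves B φs → f b ≡ truth t w b) → ∀ j → ev (lab t w) f (φs j) ≡ val φs t w j
        letter B φs f h j = trans
          (ev-cong (lab t w) f (truth t w) (φs j) λ b b∈ → h b (leaf∈ B φs j b∈)) (ev-truth t w nw (φs j))

        δ-complete : ∀ q → dec i ≡ q → osat C Int (mkδ q (lab t w))
        δ-complete (st p (fm θ)) eq with choose (truth t w) (base θ)
        ... | f , f∈ , h = osat-⋁⁺ (con (base θ))
          (∈-filter⁺ (λ f → ev (lab t w) f θ Bool.≟ p) f∈
            (trans (ev-cong (lab t w) f (truth t w) θ h) (trans (ev-truth t w nw θ)
              (signed⁻ p (subst (λ q → QSem q t w) eq sem)))))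
          (con-complete (base θ) f (λ {b} → subst (λ q → b ∈ bases q) (sym eq)) h)
        δ-complete (st true (au B φs s)) eq
          with choose (truth t w) (leaves B φs) | optimal B φs s w (subst (λ q → QSem q t w) eq sem)
        ... | f , f∈ , h | d , s' , n , o = osat-⋁⁺ (exClause B φs)
          (∈-filter⁺ (λ (f , s') → em₀ (step B s (λ j → ev (lab t w) f (φs j)) s'))
            (∈-cartesianProduct⁺ f∈ (complete (S-finite B) s'))
            (step-cong B (sym ∘ letter B φs f h) (Optimal.stp o)))
          ( atLeast-one (λ d → C d × Int d (enc true (au B φs s')) ≡ true) (d , Optimal.nd o , allowed⁺
              (subst₂ (Allowed w d) (sym eq) (sym (dec-enc true _ (step-pres i eq s'))) (stay-∃ n o)))
          , con-complete (leaves B φs) f (λ {b} → subst (λ q → b ∈ bases q) (sym eq)) h )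
        δ-complete (st false (au B φs s)) eq = osat-⋀⁺ (unClause B φs) _ clause
          where
          clause : ∀ x → x ∈ edges B φs s (lab t w) → osat C Int (unClause B φs x)
          -- A wrong assignment is refuted by an atom on which it errs. For the true one the edge is
          -- an actual step of `B`, so every child is sent the dual successor and the box holds.
          clause (f , s') x∈ with agree? f (truth t w) (leaves B φs)
          ... | inj₂ (b , b∈ , ne) = inj₂ (osat-⋁⁺ (λ b → atom (at b (not (f b)))) b∈
            (base-complete (not (f b)) (subst (λ q → b ∈ bases q) (sym eq) b∈) (signed⁺ (not (f b)) ne)))
          ... | inj₁ h = inj₁ λ { (g , _ , x) → case trans (sym (moves (g fzero))) (proj₂ (x fzero)) of λ () }
            where
            moves : ∀ d → Int d (enc false (au B φs s')) ≡ true
            moves d = allowed⁺ (subst₂ (Allowed w d) (sym eq) (sym (dec-enc false _ (step-pres i eq s')))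
              (stay-∀ (step-cong B (letter B φs f h)
                (proj₂ (∈-filter⁻ (λ (f , s') → em₀ (step B s (λ j → ev (lab t w) f (φs j)) s'))
                  {xs = cartesianProduct (choices (leaves B φs)) (elems (S-finite B))} x∈)))))
        δ-complete (ini b p) eq =
          base-complete p (subst (λ q → b ∈ bases q) (sym eq) (here refl)) (subst (λ q → QSem q t w) eq sem)

      run-complete : Run G t
      run-complete = record
        { R = RunNode ; rroot = tt ; rprefix = proj₁
        ; local = λ {r} rr → let nw , sem = node-sem r rr in
            Int nw sem ,
            subst (osat (C nw sem) (Int nw sem)) (sym (δ-eq _ _)) (δ-complete nw sem _ refl) ,
            λ q d → mk⇔ proj₂ (rr ,_) }

      module Branch (e : ℕ → Fin (nq G) × D) (onRun : ∀ i → RunNode (bnode e i)) where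

        q : ℕ → Q
        q i = stateAt (bnode e i)

        word : ℕ → List D
        word i = rword (bnode e i)

        allowedAt : ∀ i → Allowed (word i) (proj₂ (e i)) (q i) (q (suc i))
        allowedAt i = allowed⁻ (word i) (q i) (proj₂ (e i)) (q (suc i)) (proj₂ (proj₂ (onRun (suc i))))

        Goal : Set
        Goal = ParityAcc (λ i → prio (q i))

        module _ (N : ℕ) (const : ∀ i → qrk (q (i + N)) ≡ qrk (q N)) where

          flat : ∀ k → qrk (q (suc k + N)) ≡ qrk (q (k + N))
          flat k = trans (const (suc k)) (sym (const k))

          d : ℕ → D
          d k = proj₂ (e (k + N))

          word-pnode : ∀ k → pnode (word N) d k ≡ word (k + N)
          word-pnode zero = refl
          word-pnode (suc k) = cong (d k ∷_) (word-pnode k)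

          module Existential (B : NBA) (φs : I B → SF) (s₀ : S B) (q₀ : q N ≡ st true (au B φs s₀)) where

            stay : ∀ {w d s q'} → Allowed w d (st true (au B φs s)) q' → qrk q' ≡ 2 * ht (EA B φs) →
              Σ (S B) λ s' → q' ≡ st true (au B φs s') × ∃ (Optimal B φs s w d s')
            stay (drop lt _) eq = contradiction eq (<⇒≢ lt)
            stay (stay-∃ n o) _ = _ , refl , n , o

            states : ∀ k → Σ (S B) λ s → q (k + N) ≡ st true (au B φs s)
            next : ∀ k → Σ (S B) λ s' → q (suc k + N) ≡ st true (au B φs s')
              × ∃ (Optimal B φs (proj₁ (states k)) (word (k + N)) (d k) s')
            states zero = s₀ , q₀
            states (suc k) = proj₁ (next k) , proj₁ (proj₂ (next k))
            next k = stay (subst (λ q' → Allowed (word (k + N)) (d k) q' (q (suc k + N))) (proj₂ (states k)) (allowedAt (k + N)))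
              (trans (flat k) (cong qrk (proj₂ (states k))))

            s : ℕ → S B
            s k = proj₁ (states k)

            opt : ∀ k → ∃ (Optimal B φs (s k) (word (k + N)) (d k) (s (suc k)))
            opt k = proj₂ (proj₂ (next k))

            -- The tail of the run that realises distance n + 1 competes at the next state with
            -- distance n, so the optimum m there is at most n. It may be smaller or realised by a
            -- different run, hence the recursion on a bound instead of on n.
            reach : ∀ bound n k → n ≤ bound →
              Optimal B φs (s k) (word (k + N)) (d k) (s (suc k)) n → Σ ℕ λ i → k ≤ i × final B (s i)
            reach _ zero k _ o = suc k , n≤1+n k , dist-zero (Optimal.dist o)
            reach (suc bound) (suc n) k (s≤s n≤) o with Optimal.dist o | opt (suc k)
            ... | acc@(r , _) , f | m , o'
              with reach bound m (suc k) (≤-trans (Optimal.min o' n (dir r 0) (run r 1) (isPath r 1) (headStep r) (tailAccepts acc , f)) n≤) o'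
            ...     | i , le , fi = i , <⇒≤ le , fi

            parity : Goal
            parity = parity-untail _ N (parity-cong (λ k → cong prio (sym (proj₂ (states k))))
              (buchi⁺ (λ k → ⟦ final B (s k) ⟧) λ M → case opt M of λ { (n , o) →
                case reach n n M ≤-refl o of λ { (i , le , fi) → i , le , ⟦⟧⁺ fi } }))

          module Universal (B : NBA) (φs : I B → SF) (s₀ : S B) (q₀ : q N ≡ st false (au B φs s₀)) where

            stay : ∀ {w d s q'} → Allowed w d (st false (au B φs s)) q' → qrk q' ≡ 2 * ht (EA B φs) →
              Σ (S B) λ s' → q' ≡ st false (au B φs s') × step B s (val φs t w) s'
            stay (drop lt _) eq = contradiction eq (<⇒≢ lt)
            stay (stay-∀ x) _ = _ , refl , x

            states : ∀ k → Σ (S B) λ s → q (k + N) ≡ st false (au B φs s)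
            next : ∀ k → Σ (S B) λ s' → q (suc k + N) ≡ st false (au B φs s')
              × step B (proj₁ (states k)) (val φs t (word (k + N))) s'
            states zero = s₀ , q₀
            states (suc k) = proj₁ (next k) , proj₁ (proj₂ (next k))
            next k = stay (subst (λ q' → Allowed (word (k + N)) (d k) q' (q (suc k + N))) (proj₂ (states k)) (allowedAt (k + N)))
              (trans (flat k) (cong qrk (proj₂ (states k))))

            s : ℕ → S B
            s k = proj₁ (states k)

            -- The branch itself is a run of `B` along a tree path; were it accepting, it would
            -- refute the negated acceptance that holds at position N.
            infinitely-final : ¬ (∀ M → Σ ℕ λ i → M ≤ i × final B (s i))
            infinitely-final inf = subst (λ q → QSem q t (word N)) q₀ (proj₂ (node-sem (bnode e N) (onRun N)))
              ( runFrom d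
                  (λ k → subst (node t) (sym (word-pnode k)) (proj₁ (node-sem (bnode e (k + N)) (onRun (k + N)))))
                  s refl
                  (λ k → subst (λ w → step B (s k) (val φs t w) (s (suc k))) (sym (word-pnode k)) (proj₂ (proj₂ (next k))))
              , inf )

            parity : Goal
            parity with em₀ (Σ ℕ λ M → ∀ i → M ≤ i → ⟦ final B (s i) ⟧ ≡ false)
            ... | yes never = parity-untail _ N (parity-cong (λ k → cong prio (sym (proj₂ (states k))))
              (coBuchi⁺ (λ k → ⟦ final B (s k) ⟧) never))
            ... | no ¬never = ⊥-elim (infinitely-final λ M → byContradiction λ none →
              ¬never (M , λ i le → ⟦⟧-false⁺ λ fi → none (i , le , fi)))

          parity : Goal
          parity with stays (allowedAt N) (const 1)
          ... | true , B , φs , s , eq = Existential.parity B φs s eq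
          ... | false , B , φs , s , eq = Universal.parity B φs s eq

        accepting : Goal
        accepting with stabilises (qrk ∘ q) (λ i → allowed-rk (allowedAt i))
        ... | N , const = parity N const

    accepts-complete : QSem (dec (q0 G)) t [] → Accepts G t
    accepts-complete init = RunComplete.run-complete init , λ e onRun →
      parity-cong (λ i → sym (Ω-eq _)) (RunComplete.Branch.accepting init e onRun)

    accepts⇔ : Accepts G t ⇔ QSem (dec (q0 G)) t []
    accepts⇔ = mk⇔ accepts-sound accepts-complete

-- Clauses, numbering of states, components and hesitancy.

module _ {n : ℕ} {a} {A : Set a} (g : A → GC n) (P : Atom n → Set) where

  All-atoms-⋁ : ∀ xs → (∀ x → x ∈ xs → All P (atomsGC (g x))) → All P (atomsGC (⋁ (map g xs)))
  All-atoms-⋁ [] h = []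
  All-atoms-⋁ (x ∷ xs) h = All.++⁺ (h x (here refl)) (All-atoms-⋁ xs λ y → h y ∘ there)

  All-atoms-⋀ : ∀ xs → (∀ x → x ∈ xs → All P (atomsGC (g x))) → All P (atomsGC (⋀ (map g xs)))
  All-atoms-⋀ [] h = []
  All-atoms-⋀ (x ∷ xs) h = All.++⁺ (h x (here refl)) (All-atoms-⋀ xs λ y → h y ∘ there)

module _ {n : ℕ} {a} {A : Set a} (g : A → GC n) where

  disjuncts-⋁ : (∀ x → disjuncts (g x) ≡ g x ∷ []) → ∀ xs → disjuncts (⋁ (map g xs)) ≡ map g xs
  disjuncts-⋁ h [] = refl
  disjuncts-⋁ h (x ∷ xs) = cong₂ _++_ (h x) (disjuncts-⋁ h xs)

  conjuncts-⋀ : (∀ x → conjuncts (g x) ≡ g x ∷ []) → ∀ xs → conjuncts (⋀ (map g xs)) ≡ map g xs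
  conjuncts-⋀ h [] = refl
  conjuncts-⋀ h (x ∷ xs) = cong₂ _++_ (h x) (conjuncts-⋀ h xs)

  lift-⋁ : ∀ (g' : A → GC (suc n)) → (∀ x → liftGC (g x) ≡ g' x) → ∀ xs → liftGC (⋁ (map g xs)) ≡ ⋁ (map g' xs)
  lift-⋁ g' h [] = refl
  lift-⋁ g' h (x ∷ xs) = cong₂ or (h x) (lift-⋁ g' h xs)

  lift-⋀ : ∀ (g' : A → GC (suc n)) → (∀ x → liftGC (g x) ≡ g' x) → ∀ xs → liftGC (⋀ (map g xs)) ≡ ⋀ (map g' xs)
  lift-⋀ g' h [] = refl
  lift-⋀ g' h (x ∷ xs) = cong₂ and (h x) (lift-⋀ g' h xs)

module _ {B : NBA} where
  open NBA B

  data Path : S → List (I → Bool) → S → Set where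
    nil  : ∀ {s} → Path s [] s
    cons : ∀ {s v s' ρ s''} → step s v s' → Path s' ρ s'' → Path s (v ∷ ρ) s''

CounterFreeNBA : NBA → Set
CounterFreeNBA B = ∀ n → 0 < n → ∀ s ρ → Path {B} s (concat (replicate n ρ)) s → Path {B} s ρ s

module Construction (em : ExcludedMiddle (lsuc lzero)) (nAP : ℕ) where
  open Classical em
  open Logic em nAP
  open Automaton em nAP
  open Correctness em nAP
  open NBA

  module _ {A : Set₁} (xs : List A) (default : Fin (length xs)) where

    -- The elements are states and tags without computable equality, so membership is decided
    -- classically. The default makes the encoding total.
    indexOf : A → Fin (length xs)
    indexOf x with em {x ∈ xs}
    ... | yes x∈ = index x∈
    ... | no _ = default

    lookup-indexOf : ∀ {x} → x ∈ xs → List.lookup xs (indexOf x) ≡ x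
    lookup-indexOf {x} x∈ with em {x ∈ xs}
    ... | yes x∈' = sym (lookup-index x∈')
    ... | no x∉ = contradiction x∈ x∉

  subs : SF → List SF
  subs tt = tt ∷ []
  subs (ap p) = ap p ∷ []
  subs (neg φ) = neg φ ∷ subs φ
  subs (and φ ψ) = and φ ψ ∷ subs φ ++ subs ψ
  subs (Dg n p φ) = Dg n p φ ∷ subs φ
  subs (EA B φs) = EA B φs ∷ concatMap (λ j → subs (φs j)) (elems (I-finite B))

  data _◃_ : SF → SF → Set₁ where
    neg◃  : ∀ {φ} → φ ◃ neg φ
    andˡ◃ : ∀ {φ ψ} → φ ◃ and φ ψ
    andʳ◃ : ∀ {φ ψ} → ψ ◃ and φ ψ
    Dg◃   : ∀ {n p φ} → φ ◃ Dg n p φ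
    EA◃   : ∀ {B φs} j → φs j ◃ EA B φs

  subs-refl : ∀ φ → φ ∈ subs φ
  subs-refl tt = here refl
  subs-refl (ap _) = here refl
  subs-refl (neg _) = here refl
  subs-refl (and _ _) = here refl
  subs-refl (Dg _ _ _) = here refl
  subs-refl (EA _ _) = here refl

  subs-child : ∀ {φ ψ} → ψ ◃ φ → ψ ∈ subs φ
  subs-child neg◃ = there (subs-refl _)
  subs-child andˡ◃ = there (∈-++⁺ˡ (subs-refl _))
  subs-child (andʳ◃ {φ}) = there (∈-++⁺ʳ (subs φ) (subs-refl _))
  subs-child Dg◃ = there (subs-refl _)
  subs-child (EA◃ {B} {φs} j) =
    there (∈-concatMap (λ j → subs (φs j)) (complete (I-finite B) j) (subs-refl (φs j)))

  subs-closed : ∀ φ {θ θ'} → θ ∈ subs φ → θ' ◃ θ → θ' ∈ subs φ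
  subs-closed tt (here refl) c = subs-child c
  subs-closed (ap _) (here refl) c = subs-child c
  subs-closed (neg φ) (here refl) c = subs-child c
  subs-closed (neg φ) (there θ∈) c = there (subs-closed φ θ∈ c)
  subs-closed (and φ ψ) (here refl) c = subs-child c
  subs-closed (and φ ψ) (there θ∈) c with ∈-++⁻ (subs φ) θ∈
  ... | inj₁ l = there (∈-++⁺ˡ (subs-closed φ l c))
  ... | inj₂ r = there (∈-++⁺ʳ (subs φ) (subs-closed ψ r c))
  subs-closed (Dg n p φ) (here refl) c = subs-child c
  subs-closed (Dg n p φ) (there θ∈) c = there (subs-closed φ θ∈ c)
  subs-closed (EA B φs) (here refl) c = subs-child c
  subs-closed (EA B φs) (there θ∈) c with concatMap-∈ (λ j → subs (φs j)) (elems (I-finite B)) θ∈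
  ... | j , j∈ , θ∈j = there (∈-concatMap (λ j → subs (φs j)) j∈ (subs-closed (φs j) θ∈j c))

  All-subs : ∀ {ℓ} (P : SF → Set ℓ) → (∀ {φ ψ} → ψ ◃ φ → P φ → P ψ) → ∀ φ {θ} → θ ∈ subs φ → P φ → P θ
  All-subs P down tt (here refl) h = h
  All-subs P down (ap _) (here refl) h = h
  All-subs P down (neg φ) (here refl) h = h
  All-subs P down (neg φ) (there θ∈) h = All-subs P down φ θ∈ (down neg◃ h)
  All-subs P down (and φ ψ) (here refl) h = h
  All-subs P down (and φ ψ) (there θ∈) h with ∈-++⁻ (subs φ) θ∈
  ... | inj₁ l = All-subs P down φ l (down andˡ◃ h)
  ... | inj₂ r = All-subs P down ψ r (down andʳ◃ h)
  All-subs P down (Dg n p φ) (here refl) h = h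
  All-subs P down (Dg n p φ) (there θ∈) h = All-subs P down φ θ∈ (down Dg◃ h)
  All-subs P down (EA B φs) (here refl) h = h
  All-subs P down (EA B φs) (there θ∈) h with concatMap-∈ (λ j → subs (φs j)) (elems (I-finite B)) θ∈
  ... | j , _ , θ∈j = All-subs P down (φs j) θ∈j (down (EA◃ j) h)

  Plain : SF → Set
  Plain tt = ⊤
  Plain (ap _) = ⊤
  Plain (neg φ) = Plain φ
  Plain (and φ ψ) = Plain φ × Plain ψ
  Plain (Dg n _ φ) = n ≡ 1 × Plain φ
  Plain (EA B φs) = ∀ j → Plain (φs j)

  AllCounterFree : SF → Set
  AllCounterFree tt = ⊤
  AllCounterFree (ap _) = ⊤
  AllCounterFree (neg φ) = AllCounterFree φ
  AllCounterFree (and φ ψ) = AllCounterFree φ × AllCounterFree ψ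
  AllCounterFree (Dg _ _ φ) = AllCounterFree φ
  AllCounterFree (EA B φs) = CounterFreeNBA B × (∀ j → AllCounterFree (φs j))

  plain-down : ∀ {φ ψ} → ψ ◃ φ → Plain φ → Plain ψ
  plain-down neg◃ h = h
  plain-down andˡ◃ h = proj₁ h
  plain-down andʳ◃ h = proj₂ h
  plain-down Dg◃ h = proj₂ h
  plain-down (EA◃ j) h = h j

  counterFree-down : ∀ {φ ψ} → ψ ◃ φ → AllCounterFree φ → AllCounterFree ψ
  counterFree-down neg◃ h = h
  counterFree-down andˡ◃ h = proj₁ h
  counterFree-down andʳ◃ h = proj₂ h
  counterFree-down Dg◃ h = h
  counterFree-down (EA◃ j) h = proj₂ h j

  plain-base : ∀ φ → Plain φ → ∀ {b} → b ∈ base φ → num b ≡ 1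
  plain-base (neg φ) h b∈ = plain-base φ h b∈
  plain-base (and φ ψ) (h , h') b∈ = [ plain-base φ h , plain-base ψ h' ] (∈-++⁻ (base φ) b∈)
  plain-base (Dg n p φ) (h , _) (here refl) = h
  plain-base (EA B φs) h b∈ with ∈-++⁻ (map (λ s → mkBase 1 (s≤s z≤n) (au B φs s)) (elems (S-finite B))) b∈
  ... | inj₁ l with _ , _ , refl ← ∈-map⁻ _ l = refl
  ... | inj₂ r with j , _ , b∈j ← concatMap-∈ (λ j → base (φs j)) (elems (I-finite B)) r = plain-base (φs j) (h j) b∈j

  State : Set₁
  State = Bool × Core

  coresOf : SF → List Core
  coresOf (EA B φs) = fm (EA B φs) ∷ map (au B φs) (elems (S-finite B))
  coresOf θ = fm θ ∷ []

  fm∈coresOf : ∀ θ → fm θ ∈ coresOf θ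
  fm∈coresOf tt = here refl
  fm∈coresOf (ap _) = here refl
  fm∈coresOf (neg _) = here refl
  fm∈coresOf (and _ _) = here refl
  fm∈coresOf (Dg _ _ _) = here refl
  fm∈coresOf (EA _ _) = here refl

  -- Tags name components: the states of one automaton on one side share a tag, since they may loop
  -- among themselves, while a transient state has a tag of its own.
  data Tag : Set₁ where
    tf : Bool → SF → Tag
    ta : Bool → (B : NBA) → (I B → SF) → Tag

  tag : State → Tag
  tag (p , fm θ) = tf p θ
  tag (p , au B φs _) = ta p B φs

  tag-rk : Tag → ℕ
  tag-rk (tf _ θ) = rk (fm θ)
  tag-rk (ta _ B φs) = 2 * ht (EA B φs)

  tag-rk≡ : ∀ q → tag-rk (tag q) ≡ rk (proj₂ q)
  tag-rk≡ (_ , fm _) = refl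
  tag-rk≡ (_ , au _ _ _) = refl

  sideKind : Bool → Kind
  sideKind true = existential
  sideKind false = universal

  tagKind : Tag → Kind
  tagKind (tf _ _) = transient
  tagKind (ta p _ _) = sideKind p

  -- The sign with which a constraint of truth value x occurs in the transitions of side p.
  signFor : Bool → Bool → Bool
  signFor true x = x
  signFor false x = not x

  module LiftDelta {N : ℕ} (enc : Bool → Core → Fin N) where
    open Delta enc
    open Delta (λ p c → fsuc (enc p c)) using ()
      renaming (at to at'; mkδ to mkδ'; con to con'; dis to dis'; exClause to exClause'; unClause to unClause')

    lift-at : ∀ b p → liftA (at b p) ≡ at' b p
    lift-at b true = refl
    lift-at b false = refl

    lift-con : ∀ bs f → liftGC (con bs f) ≡ con' bs f
    lift-con bs f = lift-⋀ _ (λ b → atom (at' b (f b))) (λ b → cong atom (lift-at b (f b))) bs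

    lift-dis : ∀ bs f → liftGC (dis bs f) ≡ dis' bs f
    lift-dis bs f = lift-⋁ _ (λ b → atom (at' b (not (f b)))) (λ b → cong atom (lift-at b (not (f b)))) bs

    -- Renaming states along `fsuc` only changes the encoding. The automaton with a fresh initial
    -- state is therefore again of the represented form, and the correctness theorem yields its
    -- language, as mutual exclusion requires.
    lift-mkδ : ∀ q a → liftGC (mkδ q a) ≡ mkδ' q a
    lift-mkδ (st p (fm θ)) a = lift-⋁ (con (base θ)) (con' (base θ)) (lift-con (base θ))
      (filter (λ f → ev a f θ Bool.≟ p) (choices (base θ)))
    lift-mkδ (st true (au B φs s)) a = lift-⋁ (exClause B φs) (exClause' B φs)
      (λ (f , s') → cong (and (atom (◇ fsuc (enc true (au B φs s'))))) (lift-con (leaves B φs) f)) (edges B φs s a)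
    lift-mkδ (st false (au B φs s)) a = lift-⋀ (unClause B φs) (unClause' B φs)
      (λ (f , s') → cong (or (atom (□ fsuc (enc false (au B φs s'))))) (lift-dis (leaves B φs) f)) (edges B φs s a)
    lift-mkδ (ini b p) a = cong atom (lift-at b p)

  Present : SF → Core → Set₁
  Present φ (fm θ) = θ ∈ subs φ
  Present φ (au B φs _) = EA B φs ∈ subs φ

  record StateCoding (φ : SF) : Set₁ where
    field
      N           : ℕ
      dec         : Fin N → State
      enc         : Bool → Core → Fin N
      dec-enc     : ∀ p c → Present φ c → dec (enc p c) ≡ (p , c)
      dec-present : ∀ i → Present φ (proj₂ (dec i))

  record ComponentCoding {φ : SF} (E : StateCoding φ) : Set₁ where
    open StateCoding E
    field
      P         : Partition N
      kind-comp : ∀ i → kind P (comp P i) ≡ tagKind (tag (dec i))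
      comp-<    : ∀ i j → rk (proj₂ (dec i)) < rk (proj₂ (dec j)) → toℕ (comp P i) < toℕ (comp P j)
      comp-tag  : ∀ i j → comp P i ≡ comp P j → tag (dec i) ≡ tag (dec j)
      tag-comp  : ∀ i j → tag (dec i) ≡ tag (dec j) → comp P i ≡ comp P j

  module Coding (φ : SF) where

    states : List State
    states = cartesianProduct (true ∷ false ∷ []) (concatMap coresOf (subs φ))

    coresOf-present : ∀ θ → θ ∈ subs φ → ∀ {c} → c ∈ coresOf θ → Present φ c
    coresOf-present tt θ∈ (here refl) = θ∈
    coresOf-present (ap _) θ∈ (here refl) = θ∈
    coresOf-present (neg _) θ∈ (here refl) = θ∈
    coresOf-present (and _ _) θ∈ (here refl) = θ∈
    coresOf-present (Dg _ _ _) θ∈ (here refl) = θ∈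
    coresOf-present (EA B φs) θ∈ (here refl) = θ∈
    coresOf-present (EA B φs) θ∈ (there c∈) with _ , _ , refl ← ∈-map⁻ (au B φs) c∈ = θ∈

    states-present : ∀ {p c} → (p , c) ∈ states → Present φ c
    states-present q∈ with concatMap-∈ coresOf (subs φ) (proj₂ (∈-cartesianProduct⁻ (true ∷ false ∷ []) _ q∈))
    ... | θ , θ∈ , c∈ = coresOf-present θ θ∈ c∈

    present-states : ∀ p c → Present φ c → (p , c) ∈ states
    present-states p c pr = ∈-cartesianProduct⁺ (side p) (core∈ c pr)
      where
      side : ∀ p → p ∈ true ∷ false ∷ []
      side true = here refl
      side false = there (here refl)
      core∈ : ∀ c → Present φ c → c ∈ concatMap coresOf (subs φ)
      core∈ (fm θ) pr = ∈-concatMap coresOf pr (fm∈coresOf θ)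
      core∈ (au B φs s) pr = ∈-concatMap coresOf pr (there (∈-map⁺ (au B φs) (complete (S-finite B) s)))

    root∈ : (true , fm φ) ∈ states
    root∈ = present-states true (fm φ) (subs-refl φ)

    N : ℕ
    N = length states

    dec : Fin N → State
    dec = List.lookup states

    enc : Bool → Core → Fin N
    enc p c = indexOf states (index root∈) (p , c)

    dec-enc : ∀ p c → Present φ c → dec (enc p c) ≡ (p , c)
    dec-enc p c pr = lookup-indexOf states (index root∈) (present-states p c pr)

    dec-present : ∀ i → Present φ (proj₂ (dec i))
    dec-present i = states-present (∈-lookup {xs = states} i)

    stateCoding : StateCoding φ
    stateCoding = record { N = N ; dec = dec ; enc = enc ; dec-enc = dec-enc ; dec-present = dec-present }

    tags : List Tag
    tags = map tag states

    tagIndex : Tag → Fin (length tags)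
    tagIndex = indexOf tags (index (∈-map⁺ tag root∈))

    tag∈ : ∀ i → tag (dec i) ∈ tags
    tag∈ i = ∈-map⁺ tag (∈-lookup {xs = states} i)

    maxRank : ℕ
    maxRank = foldr _⊔_ 0 (map (rk ∘ proj₂) states)

    rank : Fin N → Fin (suc maxRank)
    rank i = fromℕ< (s≤s (max-upper (rk ∘ proj₂) (∈-lookup {xs = states} i)))

    toℕ-rank : ∀ i → toℕ (rank i) ≡ rk (proj₂ (dec i))
    toℕ-rank i = toℕ-fromℕ< _

    -- A component is numbered by two digits. The leading one is the rank, so that a drop in rank is
    -- a drop in the order of components; the other separates components of equal rank.
    P : Partition N
    P = record
      { ncomp = suc maxRank * length tags
      ; comp = λ i → combine (rank i) (tagIndex (tag (dec i)))
      ; kind = λ c → tagKind (List.lookup tags (proj₂ (remQuot {suc maxRank} (length tags) c))) }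

    kind-comp : ∀ i → kind P (comp P i) ≡ tagKind (tag (dec i))
    kind-comp i = cong tagKind (trans
      (cong (List.lookup tags ∘ proj₂) (remQuot-combine (rank i) (tagIndex (tag (dec i)))))
      (lookup-indexOf tags _ (tag∈ i)))

    comp-< : ∀ i j → rk (proj₂ (dec i)) < rk (proj₂ (dec j)) → toℕ (comp P i) < toℕ (comp P j)
    comp-< i j lt = combine-monoˡ-< {i = rank i} {j = rank j} _ _
      (subst₂ _<_ (sym (toℕ-rank i)) (sym (toℕ-rank j)) lt)

    comp-tag : ∀ i j → comp P i ≡ comp P j → tag (dec i) ≡ tag (dec j)
    comp-tag i j eq = trans (sym (lookup-indexOf tags _ (tag∈ i))) (trans
      (cong (List.lookup tags) (combine-injectiveʳ (rank i) _ (rank j) _ eq))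
      (lookup-indexOf tags _ (tag∈ j)))

    tag-comp : ∀ i j → tag (dec i) ≡ tag (dec j) → comp P i ≡ comp P j
    tag-comp i j eq = cong₂ combine (toℕ-injective (trans (toℕ-rank i) (trans
      (trans (sym (tag-rk≡ (dec i))) (trans (cong tag-rk eq) (tag-rk≡ (dec j))))
      (sym (toℕ-rank j))))) (cong tagIndex eq)

    componentCoding : ComponentCoding stateCoding
    componentCoding = record
      { P = P ; kind-comp = kind-comp ; comp-< = comp-< ; comp-tag = comp-tag ; tag-comp = tag-comp }

  module Build {φ : SF} {E : StateCoding φ} (K : ComponentCoding E) where
    open StateCoding E
    open ComponentCoding K

    decQ : Fin N → Q
    decQ i = st (proj₁ (dec i)) (proj₂ (dec i))

    base-present : ∀ θ → θ ∈ subs φ → ∀ {b} → b ∈ base θ → Present φ (core b)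
    leaves-present : ∀ B φs → EA B φs ∈ subs φ → ∀ {b} → b ∈ leaves B φs → Present φ (core b)
    base-present (neg θ) θ∈ b∈ = base-present θ (subs-closed φ θ∈ neg◃) b∈
    base-present (and θ θ') θ∈ b∈ =
      [ base-present θ (subs-closed φ θ∈ andˡ◃) , base-present θ' (subs-closed φ θ∈ andʳ◃) ] (∈-++⁻ (base θ) b∈)
    base-present (Dg n p θ) θ∈ (here refl) = subs-closed φ θ∈ Dg◃
    base-present (EA B φs) θ∈ b∈ with ∈-++⁻ (map (λ s → mkBase 1 (s≤s z≤n) (au B φs s)) (elems (S-finite B))) b∈
    ... | inj₁ l with _ , _ , refl ← ∈-map⁻ _ l = θ∈
    ... | inj₂ r = leaves-present B φs θ∈ r
    leaves-present B φs θ∈ b∈ with concatMap-∈ (λ j → base (φs j)) (elems (I-finite B)) b∈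
    ... | j , _ , b∈j = base-present (φs j) (subs-closed φ θ∈ (EA◃ j)) b∈j

    bases-present : ∀ p c → Present φ c → ∀ {b} → b ∈ bases (st p c) → Present φ (core b)
    bases-present p (fm θ) = base-present θ
    bases-present p (au B φs s) = leaves-present B φs

    open Delta enc

    A : GTA nAP
    A = record { nq = N ; δ = mkδ ∘ decQ ; q0 = enc true (fm φ) ; Ω = prio ∘ decQ }

    represents : Represents A
    represents = record
      { dec = decQ ; enc = enc ; δ-eq = λ _ _ → refl ; Ω-eq = λ _ → refl ; Present = Present φ
      ; dec-enc = λ p c pr → cong (λ (p , c) → st p c) (dec-enc p c pr)
      ; base-pres = λ i → bases-present _ _ (dec-present i)
      ; step-pres = λ i eq s' → step-pres (dec-present i) eq s' }
      where
      step-pres : ∀ {p p' c B φs s} → Present φ c → st p c ≡ st p' (au B φs s) → ∀ s' → Present φ (au B φs s')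
      step-pres pr refl s' = pr

    language : ∀ {D : Set} (t : KTree nAP D) → Accepts A t ⇔ sat φ t []
    language t = subst (λ q → Accepts A t ⇔ QSem q t [])
      (cong (λ (p , c) → st p c) (dec-enc true (fm φ) (subs-refl φ))) (accepts⇔ represents t)

    module WithInit (b : Base) (pr : Present φ (core b)) (r : Bool) where

      open LiftDelta enc
      open Represents represents using () renaming (dec-enc to decQ-enc; base-pres to base-presQ; step-pres to step-presQ)

      decI : Fin (suc N) → Q
      decI fzero = ini b r
      decI (fsuc i) = decQ i

      represents-ini : Represents (withInit A (atom (at b r)))
      represents-ini = record
        { dec = decI ; enc = λ p c → fsuc (enc p c)
        ; δ-eq = λ { fzero a → cong atom (lift-at b r) ; (fsuc i) a → lift-mkδ (decQ i) a }
        ; Ω-eq = λ { fzero → refl ; (fsuc i) → refl }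
        ; Present = Present φ ; dec-enc = decQ-enc
        ; base-pres = λ { fzero (here refl) → pr ; (fsuc i) → base-presQ i }
        ; step-pres = λ { fzero () ; (fsuc i) eq s' → step-presQ i eq s' } }

      language-ini : ∀ {D : Set} (t : KTree nAP D) → Accepts (withInit A (atom (at b r))) t ⇔ Signed r (BSem b t [])
      language-ini = accepts⇔ represents-ini

    tag-au : ∀ {q p B φs} → tag q ≡ ta p B φs → Σ (S B) λ s → q ≡ (p , au B φs s)
    tag-au {_ , au _ _ s} refl = s , refl

    at-states : ∀ b p → statesA (at b p) ≡ enc p (core b) ∷ []
    at-states b true = refl
    at-states b false = refl

    at-grade : ∀ b p → grade (at b p) ≡ num b
    at-grade b true = refl
    at-grade b false = refl

    at-lower : ∀ i b p → b ∈ bases (decQ i) → Lower P (comp P i) (at b p)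
    at-lower i b p b∈ rewrite at-states b p = comp-< _ _ (subst (_< rk (proj₂ (dec i)))
      (cong (rk ∘ proj₂) (sym (dec-enc p (core b) (Represents.base-pres represents i b∈))))
      (bases-rk (decQ i) b∈)) ∷ []

    comp-au : ∀ i {p B φs s} → dec i ≡ (p , au B φs s) → ∀ s' → comp P (enc p (au B φs s')) ≡ comp P i
    comp-au i {p} {B} {φs} eq s' = tag-comp _ _ (trans
      (cong tag (dec-enc p (au B φs s') (subst (λ q → Present φ (proj₂ q)) eq (dec-present i)))) (sym (cong tag eq)))

    dec-succ : ∀ i {p B φs s} → dec i ≡ (p , au B φs s) → ∀ s' → dec (enc p (au B φs s')) ≡ (p , au B φs s')
    dec-succ i {p} {B} {φs} eq s' = dec-enc p (au B φs s') (subst (λ q → Present φ (proj₂ q)) eq (dec-present i))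

    module _ (Pa : Atom N → Set) where

      All-con : ∀ bs f → (∀ b p → b ∈ bs → Pa (at b p)) → All Pa (atomsGC (con bs f))
      All-con bs f h = All-atoms-⋀ (λ b → atom (at b (f b))) Pa bs λ b b∈ → h b (f b) b∈ ∷ []

      All-dis : ∀ bs f → (∀ b p → b ∈ bs → Pa (at b p)) → All Pa (atomsGC (dis bs f))
      All-dis bs f h = All-atoms-⋁ (λ b → atom (at b (not (f b)))) Pa bs λ b b∈ → h b (not (f b)) b∈ ∷ []

      All-fm : ∀ p θ a → (∀ b p → b ∈ base θ → Pa (at b p)) → All Pa (atomsGC (mkδ (st p (fm θ)) a))
      All-fm p θ a h = All-atoms-⋁ (con (base θ)) Pa (filter (λ f → ev a f θ Bool.≟ p) (choices (base θ)))
        λ f _ → All-con (base θ) f h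

    symmetric : Plain φ → Symmetric A
    symmetric plain i a = go (dec i) (dec-present i)
      where
      plain∈ : ∀ θ → θ ∈ subs φ → Plain θ
      plain∈ θ θ∈ = All-subs Plain plain-down φ θ∈ plain
      at-plain : ∀ θ → θ ∈ subs φ → ∀ b p → b ∈ base θ → grade (at b p) ≡ 1
      at-plain θ θ∈ b p b∈ = trans (at-grade b p) (plain-base θ (plain∈ θ θ∈) b∈)
      go : ∀ q → Present φ (proj₂ q) → All (λ x → grade x ≡ 1) (atomsGC (mkδ (st (proj₁ q) (proj₂ q)) a))
      go (p , fm θ) θ∈ = All-fm _ p θ a (at-plain θ θ∈)
      go (true , au B φs s) θ∈ = All-atoms-⋁ (exClause B φs) _ (edges B φs s a) λ (f , s') _ →
        refl ∷ All-con _ (leaves B φs) f λ b p → at-plain (EA B φs) θ∈ b p ∘ leaf∈base B φs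
      go (false , au B φs s) θ∈ = All-atoms-⋀ (unClause B φs) _ (edges B φs s a) λ (f , s') _ →
        refl ∷ All-dis _ (leaves B φs) f λ b p → at-plain (EA B φs) θ∈ b p ∘ leaf∈base B φs

    conjuncts-con : ∀ bs f → conjuncts (con bs f) ≡ map (λ b → atom (at b (f b))) bs
    conjuncts-con bs f = conjuncts-⋀ _ (λ _ → refl) bs

    disjuncts-dis : ∀ bs f → disjuncts (dis bs f) ≡ map (λ b → atom (at b (not (f b)))) bs
    disjuncts-dis bs f = disjuncts-⋁ _ (λ _ → refl) bs

    disjuncts-ex : ∀ B φs s a → disjuncts (mkδ (st true (au B φs s)) a) ≡ map (exClause B φs) (edges B φs s a)
    disjuncts-ex B φs s a = disjuncts-⋁ _ (λ _ → refl) (edges B φs s a)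

    conjuncts-un : ∀ B φs s a → conjuncts (mkδ (st false (au B φs s)) a) ≡ map (unClause B φs) (edges B φs s a)
    conjuncts-un B φs s a = conjuncts-⋀ _ (λ _ → refl) (edges B φs s a)

    decQ-eq : ∀ {i p c} → dec i ≡ (p , c) → decQ i ≡ st p c
    decQ-eq eq = cong (λ (p , c) → st p c) eq

    hesitant : IsHesitant A P
    hesitant i = subst (KindCond P (δ A) (Ω A) i) (sym (kind-comp i)) (go (dec i) refl)
      where
      isLower : ∀ {p c} → dec i ≡ (p , c) → ∀ b r → b ∈ bases (st p c) → Lower P (comp P i) (at b r)
      isLower eq b r b∈ = at-lower i b r (subst (λ q → b ∈ bases q) (sym (decQ-eq eq)) b∈)
      prio-comp : ∀ {p B φs s} → dec i ≡ (p , au B φs s) → ∀ j → comp P j ≡ comp P i →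
        Σ (S B) λ s' → Ω A j ≡ prio (st p (au B φs s'))
      prio-comp eq j ceq with tag-au (trans (comp-tag j i ceq) (cong tag eq))
      ... | s' , eq' = s' , cong prio (decQ-eq eq')
      go : ∀ q → dec i ≡ q → KindCond P (δ A) (Ω A) i (tagKind (tag q))
      go (p , fm θ) eq a = subst (λ q → All (λ s → toℕ (comp P s) < toℕ (comp P i)) (statesGC (mkδ q a)))
        (sym (decQ-eq eq)) (All.concat⁺ (All.map⁺ (All-fm (Lower P (comp P i)) p θ a (isLower eq))))
      go (true , au B φs s) eq = (λ a → subst (λ q → All (ExClause P (comp P i)) (disjuncts (mkδ q a))) (sym (decQ-eq eq))
          (subst (All _) (sym (disjuncts-ex B φs s a)) (All.map⁺ (All.tabulate λ {x} _ → clause x)))) ,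
        1 , 2 , ¬2∣1 , divides 1 refl , ≤-refl , λ j ceq → case prio-comp eq j ceq of λ
          { (s' , e) → [ (λ x → inj₁ (trans e x)) , (λ x → inj₂ (trans e x)) ] (prios ⟦ final B s' ⟧) }
        where
        prios : ∀ x → (if x then 2 else 1) ≡ 1 ⊎ (if x then 2 else 1) ≡ 2
        prios true = inj₂ refl
        prios false = inj₁ refl
        clause : ∀ x → ExClause P (comp P i) (exClause B φs x)
        clause (f , s') = enc true (au B φs s') , comp-au i eq s' , here refl , inj₁ refl ∷
          subst (All _) (sym (conjuncts-con (leaves B φs) f))
            (All.map⁺ (All.tabulate λ {b} b∈ → inj₂ (at b (f b) , refl , isLower eq b (f b) b∈)))
      go (false , au B φs s) eq = (λ a → subst (λ q → All (UnClause P (comp P i)) (conjuncts (mkδ q a))) (sym (decQ-eq eq))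
          (subst (All _) (sym (conjuncts-un B φs s a)) (All.map⁺ (All.tabulate λ {x} _ → clause x)))) ,
        1 , 0 , ¬2∣1 , divides 0 refl , ≤-refl , λ j ceq → case prio-comp eq j ceq of λ
          { (s' , e) → [ (λ x → inj₁ (trans e x)) , (λ x → inj₂ (trans e x)) ] (prios ⟦ final B s' ⟧) }
        where
        prios : ∀ x → (if x then 1 else 0) ≡ 1 ⊎ (if x then 1 else 0) ≡ 0
        prios true = inj₁ refl
        prios false = inj₂ refl
        clause : ∀ x → UnClause P (comp P i) (unClause B φs x)
        clause (f , s') = enc false (au B φs s') , comp-au i eq s' , here refl , inj₁ refl ∷
          subst (All _) (sym (disjuncts-dis (leaves B φs) f))
            (All.map⁺ (All.tabulate λ {b} b∈ → inj₂ (at b (not (f b)) , refl , isLower eq b (not (f b)) b∈)))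

    hgta : HGTA nAP
    hgta = A , P , hesitant

    -- Linearizations: counter-freeness and mutual exclusion.

    leadAtom : Bool → Fin N → Atom N
    leadAtom true = ◇_
    leadAtom false = □_

    leadAtom-states : ∀ p q → statesA (leadAtom p q) ≡ q ∷ []
    leadAtom-states true q = refl
    leadAtom-states false q = refl

    leadAtom-injective : ∀ p {q q'} → leadAtom p q ≡ leadAtom p q' → q ≡ q'
    leadAtom-injective true refl = refl
    leadAtom-injective false refl = refl

    -- The linearization sees only the set of atoms of a clause. The leading atom cannot hide among
    -- the others because it mentions a state of its own component, so successor and letter can both
    -- be recovered from the set.
    leadAtom-not-lower : ∀ p {q c} → comp P q ≡ c → ¬ Lower P c (leadAtom p q)
    leadAtom-not-lower p {q} refl lw with subst (All _) (leadAtom-states p q) lw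
    ... | lt ∷ [] = <-irrefl refl lt

    LetterOf : Bool → (B : NBA) → (I B → SF) → (Base → Bool) → List (Atom N) → Set₁
    LetterOf p B φs f As = ∀ x → x ∈ As ⇔ Σ Base λ b → b ∈ leaves B φs × x ≡ at b (signFor p (f b))

    record Edge (p : Bool) (B : NBA) (φs : I B → SF) (s : S B) (l : Letter nAP N) (s' : S B) : Set₁ where
      field
        f     : Base → Bool
        f∈    : f ∈ choices (leaves B φs)
        stp   : step B s (λ j → ev (proj₁ l) f (φs j)) s'
        atoms : LetterOf p B φs f (proj₂ l)
    open Edge

    clauseAtoms : Bool → Fin N → List Base → (Base → Bool) → List (GC N)
    clauseAtoms p q bs f = atom (leadAtom p q) ∷ map (λ b → atom (at b (signFor p (f b)))) bs

    atom-injective : ∀ {x y : Atom N} → GC.atom x ≡ atom y → x ≡ y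
    atom-injective refl = refl

    module _ (p : Bool) (B : NBA) (φs : I B → SF) (f : Base → Bool) (c : Fin (ncomp P))
      (lw : ∀ b r → b ∈ leaves B φs → Lower P c (at b r)) {q : Fin N} (cq : comp P q ≡ c) where

      side∈ : ∀ {b} → b ∈ leaves B φs → atom (at b (signFor p (f b))) ∈ clauseAtoms p q (leaves B φs) f
      side∈ b∈ = there (∈-map⁺ (λ b → GC.atom (at b (signFor p (f b)))) b∈)

      side-inv : ∀ {x} → atom x ∈ clauseAtoms p q (leaves B φs) f →
        x ≡ leadAtom p q ⊎ Σ Base λ b → b ∈ leaves B φs × x ≡ at b (signFor p (f b))
      side-inv (here eq) = inj₁ (atom-injective eq)
      side-inv (there x∈) with ∈-map⁻ (λ b → GC.atom (at b (signFor p (f b)))) x∈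
      ... | b , b∈ , eq = inj₂ (b , b∈ , atom-injective eq)

      clause⁻ : ∀ {q'' As} → comp P q'' ≡ c → All (Lower P c) As →
        (∀ x → (atom x ∈ clauseAtoms p q (leaves B φs) f) ⇔ (x ≡ leadAtom p q'' ⊎ x ∈ As)) →
        q'' ≡ q × LetterOf p B φs f As
      clause⁻ {q''} {As} cq'' lwAs iff = q''≡q , λ x → mk⇔ (to x) (from x)
        where
        q''≡q : q'' ≡ q
        q''≡q with side-inv (Equivalence.from (iff (leadAtom p q'')) (inj₁ refl))
        ... | inj₁ eq = leadAtom-injective p eq
        ... | inj₂ (b , b∈ , eq) = ⊥-elim (leadAtom-not-lower p cq'' (subst (Lower P c) (sym eq) (lw b (signFor p (f b)) b∈)))
        to : ∀ x → x ∈ As → Σ Base λ b → b ∈ leaves B φs × x ≡ at b (signFor p (f b))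
        to x x∈ with side-inv (Equivalence.from (iff x) (inj₂ x∈))
        ... | inj₂ r = r
        ... | inj₁ eq = ⊥-elim (leadAtom-not-lower p cq (subst (Lower P c) eq (All.lookup lwAs x∈)))
        from : ∀ x → (Σ Base λ b → b ∈ leaves B φs × x ≡ at b (signFor p (f b))) → x ∈ As
        from x (b , b∈ , refl) with Equivalence.to (iff x) (side∈ b∈)
        ... | inj₂ x∈ = x∈
        ... | inj₁ eq = ⊥-elim (leadAtom-not-lower p cq'' (subst (Lower P c) eq (lw b (signFor p (f b)) b∈)))

      clause⁺ : ∀ {As} → LetterOf p B φs f As → All (Lower P c) As ×
        (∀ x → (atom x ∈ clauseAtoms p q (leaves B φs) f) ⇔ (x ≡ leadAtom p q ⊎ x ∈ As))
      clause⁺ {As} h = All.tabulate lowAs , λ x → mk⇔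
        (λ x∈ → case side-inv x∈ of λ { (inj₁ eq) → inj₁ eq ; (inj₂ r) → inj₂ (Equivalence.from (h x) r) })
        λ { (inj₁ refl) → here refl ; (inj₂ x∈) → case Equivalence.to (h x) x∈ of λ { (b , b∈ , refl) → side∈ b∈ } }
        where
        lowAs : ∀ {x} → x ∈ As → Lower P c x
        lowAs {x} x∈ with Equivalence.to (h x) x∈
        ... | b , b∈ , refl = lw b (signFor p (f b)) b∈

    edge∈⁻ : ∀ B φs s a {x} → x ∈ edges B φs s a →
      proj₁ x ∈ choices (leaves B φs) × step B s (λ j → ev a (proj₁ x) (φs j)) (proj₂ x)
    edge∈⁻ B φs s a x∈ with ∈-filter⁻ (λ (f , s') → em₀ (step B s (λ j → ev a f (φs j)) s'))
      {xs = cartesianProduct (choices (leaves B φs)) (elems (S-finite B))} x∈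
    ... | x∈' , stp = proj₁ (∈-cartesianProduct⁻ (choices (leaves B φs)) _ x∈') , stp

    edge∈⁺ : ∀ B φs s a {f s'} → f ∈ choices (leaves B φs) → step B s (λ j → ev a f (φs j)) s' →
      (f , s') ∈ edges B φs s a
    edge∈⁺ B φs s a {s' = s'} f∈ = ∈-filter⁺ (λ (f , s') → em₀ (step B s (λ j → ev a f (φs j)) s'))
      (∈-cartesianProduct⁺ f∈ (complete (S-finite B) s'))

    module _ {q : Fin N} where

      leaf-lower : ∀ {p B φs s} → dec q ≡ (p , au B φs s) → ∀ b r → b ∈ leaves B φs → Lower P (comp P q) (at b r)
      leaf-lower eq b r b∈ = at-lower q b r (subst (λ q → b ∈ bases q) (sym (decQ-eq eq)) b∈)

      trans⁻ : ∀ p {B φs s} → dec q ≡ (p , au B φs s) → ∀ {l q''} → LTrans A P q l q'' →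
        Σ (S B) λ s' → q'' ≡ enc p (au B φs s') × Edge p B φs s l s'
      trans⁻ p {B} {φs} {s} eq {a , As} {q''} tr =
        go p eq (subst (λ k → LTrans' A P k q (a , As) q'') (trans (kind-comp q) (cong (tagKind ∘ tag) eq)) tr)
        where
        go : ∀ p → dec q ≡ (p , au B φs s) → LTrans' A P (sideKind p) q (a , As) q'' →
          Σ (S B) λ s' → q'' ≡ enc p (au B φs s') × Edge p B φs s (a , As) s'
        go true eq (cq , lw , θ , θ∈ , iff) with ∈-map⁻ (exClause B φs)
          (subst (θ ∈_) (trans (cong (λ q → disjuncts (mkδ q a)) (decQ-eq eq)) (disjuncts-ex B φs s a)) θ∈)
        ... | (f , s') , fs∈ , refl with clause⁻ true B φs f (comp P q) (leaf-lower eq) (comp-au q eq s') cq lw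
              (λ x → subst (λ c → (atom x ∈ _ ∷ c) ⇔ _) (conjuncts-con (leaves B φs) f) (iff x))
        ...   | q''≡ , h = s' , q''≡ , record
          { f = f ; f∈ = proj₁ (edge∈⁻ B φs s a fs∈) ; stp = proj₂ (edge∈⁻ B φs s a fs∈) ; atoms = h }
        go false eq (cq , lw , θ , θ∈ , iff) with ∈-map⁻ (unClause B φs)
          (subst (θ ∈_) (trans (cong (λ q → conjuncts (mkδ q a)) (decQ-eq eq)) (conjuncts-un B φs s a)) θ∈)
        ... | (f , s') , fs∈ , refl with clause⁻ false B φs f (comp P q) (leaf-lower eq) (comp-au q eq s') cq lw
              (λ x → subst (λ c → (atom x ∈ _ ∷ c) ⇔ _) (disjuncts-dis (leaves B φs) f) (iff x))
        ...   | q''≡ , h = s' , q''≡ , record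
          { f = f ; f∈ = proj₁ (edge∈⁻ B φs s a fs∈) ; stp = proj₂ (edge∈⁻ B φs s a fs∈) ; atoms = h }

      trans⁺ : ∀ p {B φs s} → dec q ≡ (p , au B φs s) → ∀ {l s'} → Edge p B φs s l s' →
        LTrans A P q l (enc p (au B φs s'))
      trans⁺ p {B} {φs} {s} eq {a , As} {s'} ed =
        subst (λ k → LTrans' A P k q (a , As) (enc p (au B φs s'))) (sym (trans (kind-comp q) (cong (tagKind ∘ tag) eq)))
          (go p eq ed)
        where
        go : ∀ p → dec q ≡ (p , au B φs s) → Edge p B φs s (a , As) s' →
          LTrans' A P (sideKind p) q (a , As) (enc p (au B φs s'))
        go true eq ed with clause⁺ true B φs (f ed) (comp P q) (leaf-lower eq) (comp-au q eq s') (atoms ed)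
        ... | lw , iff = comp-au q eq s' , lw , exClause B φs (f ed , s') ,
          subst (_ ∈_) (sym (trans (cong (λ q → disjuncts (mkδ q a)) (decQ-eq eq)) (disjuncts-ex B φs s a)))
            (∈-map⁺ (exClause B φs) (edge∈⁺ B φs s a (f∈ ed) (stp ed))) ,
          λ x → subst (λ c → (atom x ∈ _ ∷ c) ⇔ _) (sym (conjuncts-con (leaves B φs) (f ed))) (iff x)
        go false eq ed with clause⁺ false B φs (f ed) (comp P q) (leaf-lower eq) (comp-au q eq s') (atoms ed)
        ... | lw , iff = comp-au q eq s' , lw , unClause B φs (f ed , s') ,
          subst (_ ∈_) (sym (trans (cong (λ q → conjuncts (mkδ q a)) (decQ-eq eq)) (conjuncts-un B φs s a)))
            (∈-map⁺ (unClause B φs) (edge∈⁺ B φs s a (f∈ ed) (stp ed))) ,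
          λ x → subst (λ c → (atom x ∈ _ ∷ c) ⇔ _) (sym (disjuncts-dis (leaves B φs) (f ed))) (iff x)

    LTrans-au : ∀ {q l q''} → LTrans A P q l q'' →
      Σ Bool λ p → Σ NBA λ B → Σ (I B → SF) λ φs → Σ (S B) λ s → dec q ≡ (p , au B φs s)
    LTrans-au {q} {l} {q''} tr = go (dec q) refl
      where
      go : ∀ x → dec q ≡ x → Σ Bool λ p → Σ NBA λ B → Σ (I B → SF) λ φs → Σ (S B) λ s → x ≡ (p , au B φs s)
      go (p , au B φs s) _ = p , B , φs , s , refl
      go (p , fm θ) eq =
        ⊥-elim (subst (λ k → LTrans' A P k q l q'') (trans (kind-comp q) (cong (tagKind ∘ tag) eq)) tr)

    signFor-injective : ∀ p {x y} → signFor p x ≡ signFor p y → x ≡ y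
    signFor-injective true eq = eq
    signFor-injective false eq = Bool.not-injective eq

    signFor-not : ∀ p x → signFor p (not x) ≡ not (signFor p x)
    signFor-not true x = refl
    signFor-not false x = refl

    enc-injective : ∀ {p p' c c'} → Present φ c → Present φ c' → enc p c ≡ enc p' c' → (p , c) ≡ (p' , c')
    enc-injective pr pr' eq = trans (sym (dec-enc _ _ pr)) (trans (cong dec eq) (dec-enc _ _ pr'))

    at-injective : ∀ b b' {r r'} → Present φ (core b) → Present φ (core b') → at b r ≡ at b' r' → b ≡ b' × r ≡ r'
    at-injective (mkBase n l c) (mkBase n' l' c') {true} {true} pr pr' eq = go eq
      where
      go : Atom.dia n l (var (enc true c)) ≡ dia n' l' (var (enc true c')) → mkBase n l c ≡ mkBase n' l' c' × true ≡ true
      -- Abstracting the two codes turns the equation between atoms into one that matching can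
      -- solve; equal codes then give equal cores.
      go eq with enc true c in e | enc true c' in e' | eq
      ... | _ | _ | refl with enc-injective pr pr' (trans e (sym e'))
      ...   | refl = refl , refl
    at-injective (mkBase n l c) (mkBase n' l' c') {false} {false} pr pr' eq = go eq
      where
      go : Atom.box n l (var (enc false c)) ≡ box n' l' (var (enc false c')) → mkBase n l c ≡ mkBase n' l' c' × false ≡ false
      go eq with enc false c in e | enc false c' in e' | eq
      ... | _ | _ | refl with enc-injective pr pr' (trans e (sym e'))
      ...   | refl = refl , refl
    at-injective _ _ {true} {false} _ _ ()
    at-injective _ _ {false} {true} _ _ ()

    module _ (p : Bool) {B : NBA} {φs : I B → SF} (B∈ : EA B φs ∈ subs φ) where

      -- The assignment is recovered from the atoms of a letter because at is injective.
      readOff : List (Atom N) → Base → Bool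
      readOff As b = ⟦ at b (signFor p true) ∈ As ⟧

      readOff-eq : ∀ {f As} → LetterOf p B φs f As → ∀ b → b ∈ leaves B φs → f b ≡ readOff As b
      readOff-eq {f} {As} h b b∈ with f b in fb | em₀ (at b (signFor p true) ∈ As)
      ... | true | yes _ = refl
      ... | false | no _ = refl
      ... | true | no ∉ = contradiction
        (Equivalence.from (h _) (b , b∈ , cong (at b ∘ signFor p) (sym fb))) ∉
      ... | false | yes ∈As with Equivalence.to (h _) ∈As
      ...   | b' , b'∈ , eq with at-injective b b' (leaves-present B φs B∈ b∈) (leaves-present B φs B∈ b'∈) eq
      ...     | refl , eq' = contradiction (trans (signFor-injective p eq') fb) λ ()

      word : Letter nAP N → I B → Bool
      word (a , As) j = ev a (readOff As) (φs j)

      word-eq : ∀ {f a As} → LetterOf p B φs f As → ∀ j → ev a f (φs j) ≡ word (a , As) j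
      word-eq {a = a} h j = ev-cong a _ _ (φs j) λ b b∈ → readOff-eq h b (leaf∈ B φs j b∈)

      -- To lift a path of `B` back, the atoms of each letter must come from a complete assignment,
      -- which `readOff` alone cannot guarantee. The letters of a given path of the linearization
      -- have this property.
      SomeEdge : Letter nAP N → Set₁
      SomeEdge l = Σ (S B) λ s → Σ (S B) λ s' → Edge p B φs s l s'

      project : ∀ {q s ρ q''} → dec q ≡ (p , au B φs s) → LPath A P q ρ q'' →
        Σ (S B) λ s'' → dec q'' ≡ (p , au B φs s'') × Path {B} s (map word ρ) s'' × All SomeEdge ρ
      project eq lnil = _ , eq , nil , []
      project {q} {s} eq (lcons {l = l} tr π) with trans⁻ p eq tr
      ... | s' , refl , ed with project (dec-succ q eq s') π
      ...   | s'' , eq'' , π' , es = s'' , eq'' , cons (step-cong B (word-eq (atoms ed)) (stp ed)) π' , (s , s' , ed) ∷ es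

      -- The list of states may repeat an entry, so an index need not be the one chosen by `enc`.
      -- Every transition ends in an index of the form `enc`; the empty path may not, which is why
      -- it is excluded.
      lift-path : ∀ {q s ρ s''} → dec q ≡ (p , au B φs s) → ρ ≢ [] → All SomeEdge ρ → Path {B} s (map word ρ) s'' →
        LPath A P q ρ (enc p (au B φs s''))
      lift-path {ρ = []} eq ne _ _ = contradiction refl ne
      lift-path {q} {s} {l ∷ ρ} eq _ ((_ , _ , ed) ∷ es) (cons {s' = s'} x π) = go ρ es π
        where
        tr : LTrans A P q l (enc p (au B φs s'))
        tr = trans⁺ p eq record
          { f = f ed ; f∈ = f∈ ed ; stp = step-cong B (sym ∘ word-eq (atoms ed)) x ; atoms = atoms ed }
        go : ∀ ρ {s''} → All SomeEdge ρ → Path {B} s' (map word ρ) s'' → LPath A P q (l ∷ ρ) (enc p (au B φs s''))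
        go [] _ nil = lcons tr lnil
        go ρ@(_ ∷ _) es π = lcons tr (lift-path (dec-succ q eq s') (λ ()) es π)

    LPath-end : ∀ {q l ρ q''} → LPath A P q (l ∷ ρ) q'' →
      Σ (Fin N) λ q' → Σ (Letter nAP N) λ l' → LTrans A P q' l' q''
    LPath-end (lcons tr lnil) = _ , _ , tr
    LPath-end (lcons _ π@(lcons _ _)) = LPath-end π

    LPath-enc : ∀ {q l ρ q'' p B φs s} → LPath A P q (l ∷ ρ) q'' → dec q'' ≡ (p , au B φs s) → q'' ≡ enc p (au B φs s)
    LPath-enc π eq with LPath-end π
    ... | q' , _ , tr with LTrans-au tr
    ...   | p' , B' , φs' , s' , eq' with trans⁻ p' eq' tr
    ...     | s₁ , refl , _ with trans (sym (dec-succ q' eq' s₁)) eq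
    ...       | refl = refl

    au-present : ∀ {q p B φs s} → dec q ≡ (p , au B φs s) → EA B φs ∈ subs φ
    au-present {q} eq = subst (λ q → Present φ (proj₂ q)) eq (dec-present q)

    counterFree : AllCounterFree φ → LinCounterFree A P
    counterFree cf n n>0 q [] π = lnil
    counterFree cf (suc n) n>0 q ρ@(_ ∷ _) π@(lcons tr _) with LTrans-au tr
    ... | p , B , φs , s , eq with project p (au-present eq) eq π
    ...   | s'' , eq'' , π' , es with trans (sym eq) eq''
    ...     | refl = subst (LPath A P q ρ) (sym (LPath-enc π eq))
      -- The first copy of ρ already provides an edge for each of its letters.
      (lift-path p (au-present eq) eq (λ ()) (All.++⁻ˡ ρ es)
        (proj₁ (All-subs AllCounterFree counterFree-down φ (au-present eq) cf) (suc n) n>0 s (map letters ρ)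
          (subst (λ ρ' → Path {B} s ρ' s) (map-power (suc n)) π')))
      where
      letters : Letter nAP N → I B → Bool
      letters = word p (au-present eq)
      map-power : ∀ n → map letters (concat (replicate n ρ)) ≡ concat (replicate n (map letters ρ))
      map-power n = trans (sym (List.concat-map (replicate n ρ))) (cong concat (List.map-replicate (map letters) n ρ))

    -- Both letters come from assignments on the same `leaves`; as the sets differ, the assignments
    -- clash on some b. Started in the two atoms about b, the automaton accepts by `BSem b` and by
    -- its negation.
    mutualExclusion : MutualExclusion A P
    mutualExclusion c k≢ As Bs (q , q₁ , a , refl , tr) (q' , q₁' , a' , eqc , tr') differ
      with LTrans-au tr
    ... | p , B , φs , s , eq with tag-au (trans (comp-tag q' q eqc) (cong tag eq))
    ...   | s' , eq' with trans⁻ p eq tr | trans⁻ p eq' tr'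
    ...     | _ , _ , ed | _ , _ , ed' with agree? (f ed) (f ed') (leaves B φs)
    ...       | inj₁ same = ⊥-elim (differ λ x → mk⇔
      (λ x∈ → Equivalence.from (atoms ed' x) (case Equivalence.to (atoms ed x) x∈ of λ
        { (b , b∈ , e) → b , b∈ , trans e (cong (at b ∘ signFor p) (same b b∈)) }))
      (λ x∈ → Equivalence.from (atoms ed x) (case Equivalence.to (atoms ed' x) x∈ of λ
        { (b , b∈ , e) → b , b∈ , trans e (cong (at b ∘ signFor p) (sym (same b b∈))) })))
    ...       | inj₂ (b , b∈ , ne) = at b r , at b (not r) ,
      Equivalence.from (atoms ed _) (b , b∈ , refl) ,
      Equivalence.from (atoms ed' _) (b , b∈ , cong (at b) (sym (trans (cong (signFor p) ne) (signFor-not p (f ed b))))) ,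
      λ D t → mk⇔
        (λ x y → signed-not r (Equivalence.to (WithInit.language-ini b pr r t) x)
          (Equivalence.to (WithInit.language-ini b pr (not r) t) y))
        (λ ny → Equivalence.from (WithInit.language-ini b pr r t)
          (excluded r (ny ∘ Equivalence.from (WithInit.language-ini b pr (not r) t))))
      where
      r : Bool
      r = signFor p (f ed b)
      pr : Present φ (core b)
      pr = leaves-present B φs (au-present eq) b∈
      excluded : ∀ {X : Set} r → ¬ Signed (not r) X → Signed r X
      excluded true h = byContradiction h
      excluded false h = h

-- Finite state spaces and generalised Büchi automata.

⊤-finite : Finite ⊤
⊤-finite = record { elems = tt ∷ [] ; complete = λ _ → here refl }

⊥-finite : Finite ⊥
⊥-finite = record { elems = [] ; complete = λ () }

Bool-finite : Finite Bool
Bool-finite = record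
  { elems = true ∷ false ∷ [] ; complete = λ { true → here refl ; false → there (here refl) } }

Fin-finite : ∀ m → Finite (Fin m)
Fin-finite m = record { elems = allFin m ; complete = ∈-allFin }

Σ-finite : ∀ {A : Set} {B : A → Set} → Finite A → (∀ a → Finite (B a)) → Finite (Σ A B)
Σ-finite fa fb = record
  { elems = concatMap (λ a → map (a ,_) (elems (fb a))) (elems fa)
  ; complete = λ (a , b) → ∈-concatMap _ (complete fa a) (∈-map⁺ (a ,_) (complete (fb a) b)) }

×-finite : ∀ {A B : Set} → Finite A → Finite B → Finite (A × B)
×-finite fa fb = Σ-finite fa λ _ → fb

⊎-finite : ∀ {A B : Set} → Finite A → Finite B → Finite (A ⊎ B)
⊎-finite fa fb = record
  { elems = map inj₁ (elems fa) ++ map inj₂ (elems fb)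
  ; complete = λ { (inj₁ a) → ∈-++⁺ˡ (∈-map⁺ inj₁ (complete fa a))
                 ; (inj₂ b) → ∈-++⁺ʳ _ (∈-map⁺ inj₂ (complete fb b)) } }

-- Tuples; unlike functions Fin m → A they are equal when their components are.
Tuple : ∀ m → (Fin m → Set) → Set
Tuple zero A = ⊤
Tuple (suc m) A = A fzero × Tuple m (A ∘ fsuc)

proj : ∀ {m} {A : Fin m → Set} → Tuple m A → ∀ q → A q
proj (a , as) fzero = a
proj (a , as) (fsuc q) = proj as q

tuple : ∀ {m} {A : Fin m → Set} → (∀ q → A q) → Tuple m A
tuple {zero} f = tt
tuple {suc m} f = f fzero , tuple (f ∘ fsuc)

proj-tuple : ∀ {m} {A : Fin m → Set} (f : ∀ q → A q) q → proj {A = A} (tuple f) q ≡ f q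
proj-tuple f fzero = refl
proj-tuple f (fsuc q) = proj-tuple (f ∘ fsuc) q

Tuple-finite : ∀ m {A : Fin m → Set} → (∀ q → Finite (A q)) → Finite (Tuple m A)
Tuple-finite zero f = ⊤-finite
Tuple-finite (suc m) f = ×-finite (f fzero) (Tuple-finite m (f ∘ fsuc))

Vec-finite : ∀ m → Finite (Vec Bool m)
Vec-finite zero = record { elems = Vec.[] ∷ [] ; complete = λ { Vec.[] → here refl } }
Vec-finite (suc m) = record
  { elems = List.cartesianProductWith Vec._∷_ (elems Bool-finite) (elems (Vec-finite m))
  ; complete = λ { (b Vec.∷ v) →
      ∈-cartesianProductWith⁺ Vec._∷_ (complete Bool-finite b) (complete (Vec-finite m) v) } }

lookup-ext : ∀ {m} {u v : Vec Bool m} → (∀ k → lookup u k ≡ lookup v k) → u ≡ v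
lookup-ext {u = u} {v} h = trans (sym (tabulate∘lookup u)) (trans (tabulate-cong h) (tabulate∘lookup v))

-- A generalised Büchi automaton with an output: acc j are the acceptance sets, and out s is what the
-- automaton predicts, in state s, about the rest of the word.
record GBA : Set₁ where
  field
    I         : Set
    I-finite  : Finite I
    S         : Set
    S-finite  : Finite S
    J         : Set
    J-finite  : Finite J
    step      : S → (I → Bool) → S → Set
    step-cong : ∀ {s v v' s'} → (∀ i → v i ≡ v' i) → step s v s' → step s v' s'
    acc       : J → S → Set
    out       : S → Set

  IsRun : (ℕ → I → Bool) → (ℕ → S) → Set
  IsRun v ρ = ∀ i → step (ρ i) (v i) (ρ (suc i))

  Fair : (ℕ → S) → Set
  Fair ρ = ∀ j N → Σ ℕ λ i → N ≤ i × acc j (ρ i)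

-- All runs are meant, fair or not, because counter-freeness speaks of arbitrary loops.
Aperiodic : GBA → Set
Aperiodic G = ∀ L v ρ → (∀ i j → v (i + L) j ≡ v i j) → IsRun v ρ → ∀ i → ρ (i + L) ≡ ρ i
  where open GBA G

-- Paths over powers of a word as periodic runs.

module _ {B : NBA} where
  open NBA B

  letterAt : List (I → Bool) → ℕ → I → Bool
  letterAt [] k = λ _ → false
  letterAt (v ∷ ρ) zero = v
  letterAt (v ∷ ρ) (suc k) = letterAt ρ k

  stateAlong : ∀ {s ρ s'} → Path {B} s ρ s' → ℕ → S
  stateAlong {s} nil k = s
  stateAlong {s} (cons _ π) zero = s
  stateAlong (cons _ π) (suc k) = stateAlong π k

  stateAlong-0 : ∀ {s ρ s'} (π : Path {B} s ρ s') → stateAlong π 0 ≡ s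
  stateAlong-0 nil = refl
  stateAlong-0 (cons _ _) = refl

  stateAlong-end : ∀ {s ρ s'} (π : Path {B} s ρ s') → stateAlong π (length ρ) ≡ s'
  stateAlong-end nil = refl
  stateAlong-end (cons _ π) = stateAlong-end π

  stateAlong-step : ∀ {s ρ s'} (π : Path {B} s ρ s') k → k < length ρ →
    step (stateAlong π k) (letterAt ρ k) (stateAlong π (suc k))
  stateAlong-step (cons x π) zero lt = subst (step _ _) (sym (stateAlong-0 π)) x
  stateAlong-step (cons x π) (suc k) (s≤s lt) = stateAlong-step π k lt

  pathFrom : ∀ ρ (f : ℕ → S) → (∀ k → k < length ρ → step (f k) (letterAt ρ k) (f (suc k))) →
    Path {B} (f 0) ρ (f (length ρ))
  pathFrom [] f h = nil
  pathFrom (v ∷ ρ) f h = cons (h 0 (s≤s z≤n)) (pathFrom ρ (f ∘ suc) λ k lt → h (suc k) (s≤s lt))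

  letterAt-++ˡ : ∀ ρ σ k → k < length ρ → letterAt (ρ ++ σ) k ≡ letterAt ρ k
  letterAt-++ˡ (v ∷ ρ) σ zero lt = refl
  letterAt-++ˡ (v ∷ ρ) σ (suc k) (s≤s lt) = letterAt-++ˡ ρ σ k lt

  letterAt-++ʳ : ∀ ρ σ k → letterAt (ρ ++ σ) (k + length ρ) ≡ letterAt σ k
  letterAt-++ʳ [] σ k = cong (letterAt σ) (+-identityʳ k)
  letterAt-++ʳ (v ∷ ρ) σ k = trans (cong (letterAt (v ∷ ρ ++ σ)) (+-suc k (length ρ))) (letterAt-++ʳ ρ σ k)

  length-power : ∀ n (ρ : List (I → Bool)) → length (concat (replicate n ρ)) ≡ n * length ρ
  length-power zero ρ = refl
  length-power (suc n) ρ = trans (List.length-++ ρ) (cong (length ρ +_) (length-power n ρ))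

  letterAt-power : ∀ n ρ .{{_ : NonZero (length ρ)}} k → k < n * length ρ →
    letterAt (concat (replicate n ρ)) k ≡ letterAt ρ (k % length ρ)
  letterAt-power (suc n) ρ k lt with k <? length ρ
  ... | yes k<L = trans (letterAt-++ˡ ρ _ k k<L) (cong (letterAt ρ) (sym (m<n⇒m%n≡m k<L)))
  ... | no k≮L = trans (trans (cong (letterAt (ρ ++ _)) (sym split)) (letterAt-++ʳ ρ _ k'))
      (trans (letterAt-power n ρ k' (+-cancelʳ-< (length ρ) k' _ lt'))
        (cong (letterAt ρ) (trans (sym ([m+n]%n≡m%n k' (length ρ))) (cong (_% length ρ) split))))
    where
    k' : ℕ
    k' = k ∸ length ρ
    split : k' + length ρ ≡ k
    split = m∸n+n≡m (≮⇒≥ k≮L)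
    lt' : k' + length ρ < n * length ρ + length ρ
    lt' = subst₂ _<_ (sym split) (+-comm (length ρ) (n * length ρ)) lt

suc-% : ∀ k M .{{_ : NonZero M}} → suc k % M ≡ suc (k % M) % M
suc-% k M = trans (cong (λ i → suc i % M) (m≡m%n+[m/n]*n k M)) ([m+kn]%n≡m%n (suc (k % M)) (k / M) M)

-- A path over a power of ρ, traversed for ever, is an infinite run on a word of period `length ρ`;
-- in this form `Aperiodic` can be applied to it.
record Loop (B : NBA) (s : NBA.S B) (ρ : List (NBA.I B → Bool)) .{{_ : NonZero (length ρ)}} : Set where
  open NBA B
  field
    period      : ℕ
    period>0    : 0 < period
    states      : ℕ → S
    states-0    : states 0 ≡ s
    states-end  : states period ≡ s
    states-step : ∀ k → step (states k) (letterAt {B} ρ (k % length ρ)) (states (suc k))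

unroll : ∀ (B : NBA) n s ρ .{{_ : NonZero (length ρ)}} → 0 < n →
  Path {B} s (concat (replicate n ρ)) s → Loop B s ρ
unroll B n s ρ n>0 π = record
  { period = M ; period>0 = M>0 ; states = x
  ; states-0 = trans (cong (stateAlong π) (m<n⇒m%n≡m M>0)) (stateAlong-0 π)
  ; states-end = trans (cong (stateAlong π) (n%n≡0 M)) (stateAlong-0 π)
  ; states-step = λ k → subst₂ (step (x k)) (letter k) (next k)
      (stateAlong-step π (k % M) (subst (k % M <_) (sym (length-power {B} n ρ)) (m%n<n k M))) }
  where
  open NBA B
  L M : ℕ
  L = length ρ
  M = n * L
  M>0 : 0 < M
  M>0 = *-mono-≤ n>0 (>-nonZero⁻¹ L)
  instance
    M≢0 : NonZero M
    M≢0 = >-nonZero M>0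
  x : ℕ → S
  x k = stateAlong π (k % M)
  letter : ∀ k → letterAt {B} (concat (replicate n ρ)) (k % M) ≡ letterAt {B} ρ (k % L)
  letter k = trans (letterAt-power {B} n ρ (k % M) (m%n<n k M))
    (cong (letterAt {B} ρ) (m∣n⇒o%n%m≡o%m L M k (divides n refl)))
  next : ∀ k → stateAlong π (suc (k % M)) ≡ x (suc k)
  -- At the end of a round the index jumps back to 0; the path has returned to s there, so the run
  -- continues.
  next k with m≤n⇒m<n∨m≡n (m%n<n k M)
  ... | inj₁ lt = cong (stateAlong π) (sym (trans (suc-% k M) (m<n⇒m%n≡m lt)))
  ... | inj₂ eq = trans (trans (cong (stateAlong π) (trans eq (sym (length-power {B} n ρ)))) (stateAlong-end π))
      (trans (sym (stateAlong-0 π)) (cong (stateAlong π)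
        (sym (trans (suc-% k M) (trans (cong (_% M) eq) (n%n≡0 M))))))

-- From generalised to ordinary Büchi acceptance.

module Degeneralise (em : ExcludedMiddle (lsuc lzero)) (G : GBA) where
  open Classical em
  open GBA G

  K : ℕ
  K = length (elems J-finite)

  accAt : Fin K → S → Set
  accAt κ = acc (List.lookup (elems J-finite) κ)

  -- In (s , Y , b), the set Y of conditions met since the last reset may be forgotten at will, and b
  -- marks a reset, which is possible only when Y is full. This nondeterminism is what makes the
  -- automaton counter-free.
  S' : Set
  S' = S × Vec Bool K × Bool

  step' : S' → (I → Bool) → S' → Set
  step' (s , Y , b) v (s' , Y' , b') = step s v s'
    × (∀ κ → lookup Y' κ ≡ true → (b ≡ false × lookup Y κ ≡ true) ⊎ accAt κ s)
    × (b' ≡ true → ∀ κ → lookup Y' κ ≡ true)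

  final' : S' → Set
  final' (_ , _ , b) = b ≡ true

  nba : NBA
  nba = record
    { I = I ; I-finite = I-finite
    ; S = S' ; S-finite = ×-finite S-finite (×-finite (Vec-finite K) Bool-finite)
    ; start = λ (s , _) → out s ; final = final' ; step = step'
    ; step-cong = λ eq (x , y) → step-cong eq x , y }

  -- A reset bars inheritance from earlier memory, so tracing a recorded condition backwards must
  -- end in a real visit no earlier than the reset.
  collected : (v : ℕ → I → Bool) (r : ℕ → S') → (∀ k → step' (r k) (v k) (r (suc k))) → final' (r 0) →
    ∀ k κ → lookup (proj₁ (proj₂ (r (suc k)))) κ ≡ true → Σ ℕ λ j → j ≤ k × accAt κ (proj₁ (r j))
  collected v r st reset k κ y with proj₁ (proj₂ (st k)) κ y
  ... | inj₂ a = k , ≤-refl , a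
  collected v r st reset zero κ y | inj₁ (b , _) = contradiction (trans (sym reset) b) λ ()
  collected v r st reset (suc k) κ y | inj₁ (_ , y') with collected v r st reset k κ y'
  ... | j , j≤k , a = j , m≤n⇒m≤1+n j≤k , a

  fair : (v : ℕ → I → Bool) (r : ℕ → S') → (∀ k → step' (r k) (v k) (r (suc k))) →
    (∀ N → Σ ℕ λ i → N ≤ i × final' (r i)) → Fair (proj₁ ∘ r)
  fair v r st inf j N with inf N
  ... | i , N≤i , bi with inf (suc i)
  ...   | suc i' , s≤s i≤i' , bi' with collected (λ k → v (k + i)) (λ k → r (k + i)) (λ k → st (k + i)) bi
          (i' ∸ i) (index (complete J-finite j))
          (proj₂ (proj₂ (st (i' ∸ i + i)))
            (subst (λ k → final' (r (suc k))) (sym (m∸n+n≡m i≤i')) bi') (index (complete J-finite j)))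
  ...     | k , _ , a = k + i , ≤-trans N≤i (m≤n+m i k) ,
            subst (λ j → acc j (proj₁ (r (k + i)))) (sym (lookup-index (complete J-finite j))) a

  module Latch (v : ℕ → I → Bool) (ρ : ℕ → S) (run : IsRun v ρ) (fairρ : Fair ρ) where

    collect : ℕ → Vec Bool K × Bool → Vec Bool K
    collect i (Y , b) = tabulate λ κ → ⟦ (b ≡ false × lookup Y κ ≡ true) ⊎ accAt κ (ρ i) ⟧

    -- The greedy resolution of the nondeterminism: remember every visit, reset as soon as the
    -- memory is full.
    latch : ℕ → Vec Bool K × Bool
    latch zero = Vec.replicate K false , false
    latch (suc i) = collect i (latch i) , ⟦ (∀ κ → lookup (collect i (latch i)) κ ≡ true) ⟧

    lifted : ℕ → S'
    lifted i = ρ i , latch i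

    lookup-collect : ∀ i κ → lookup (proj₁ (latch (suc i))) κ
      ≡ ⟦ (proj₂ (latch i) ≡ false × lookup (proj₁ (latch i)) κ ≡ true) ⊎ accAt κ (ρ i) ⟧
    lookup-collect i κ = lookup∘tabulate _ κ

    lifted-run : ∀ i → step' (lifted i) (v i) (lifted (suc i))
    lifted-run i = run i , (λ κ y → ⟦⟧⁻ (trans (sym (lookup-collect i κ)) y)) , ⟦⟧⁻

    infinitely-reset : ∀ N → Σ ℕ λ i → N ≤ i × final' (lifted i)
    infinitely-reset N = byContradiction λ none → none (found none)
      where
      found : ¬ (Σ ℕ λ i → N ≤ i × final' (lifted i)) → Σ ℕ λ i → N ≤ i × final' (lifted i)
      -- Without resets from N on nothing is forgotten, so at a common time all conditions have been
      -- recorded and a reset is due.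
      found none = suc (T + N) , m≤n⇒m≤1+n (m≤n+m N T) , ⟦⟧⁺ (λ κ → full κ {T} (proj₂ bound κ (∈-allFin κ)))
        where
        Met : Fin K → ℕ → Set
        Met κ n = Σ ℕ λ i → i ≤ n × accAt κ (ρ (i + N))
        bound : Σ ℕ λ n → ∀ κ → κ ∈ allFin K → Met κ n
        bound = eventually-all Met (λ { κ m≤n (i , i≤m , a) → i , ≤-trans i≤m m≤n , a })
          (λ κ → case fairρ (List.lookup (elems J-finite) κ) N of λ { (i , N≤i , a) → i ∸ N , i ∸ N , ≤-refl ,
            subst (λ k → accAt κ (ρ k)) (sym (m∸n+n≡m N≤i)) a })
          (allFin K)
        T : ℕ
        T = proj₁ bound
        unmarked : ∀ i → N ≤ i → proj₂ (latch i) ≡ false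
        unmarked i le with proj₂ (latch i) in eq
        ... | false = refl
        ... | true = ⊥-elim (none (i , le , eq))
        full : ∀ κ {n} → Met κ n → lookup (proj₁ (latch (suc (n + N)))) κ ≡ true
        full κ {n} (i , i≤n , a) with m≤n⇒m<n∨m≡n i≤n
        ... | inj₂ refl = trans (lookup-collect (i + N) κ) (⟦⟧⁺ (inj₂ a))
        full κ {suc n} (i , i≤n , a) | inj₁ (s≤s i≤n') = trans (lookup-collect (suc n + N) κ)
          (⟦⟧⁺ (inj₁ (unmarked (suc n + N) (m≤n+m N (suc n)) , full κ {n} (i , i≤n' , a))))

  module _ (aperiodic : Aperiodic G) where

    -- Aperiodicity closes the `S` part after one copy of ρ; only the memory has to be chosen. If s
    -- is unmarked, Y may stay constant. If s is marked, a full set must be collected within one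
    -- copy, and it can be: the long loop visits every condition, and by periodicity each visit
    -- recurs at the same position modulo the length of ρ.
    loop : ∀ s ρ .{{_ : NonZero (length ρ)}} → Loop nba s ρ → Path {nba} s ρ s
    loop s@(s₀ , Y , b) ρ l = close b refl
      where
      open Loop l
      L : ℕ
      L = length ρ
      v : ℕ → I → Bool
      v k = letterAt {nba} ρ (k % L)
      y : ℕ → S
      y k = proj₁ (states k)
      y-periodic : ∀ k → y (k + L) ≡ y k
      y-periodic = aperiodic L v y (λ k j → cong (λ k → letterAt {nba} ρ k j) ([m+n]%n≡m%n k L))
        (λ k → proj₁ (states-step k))
      y-multiple : ∀ n k → y (k + n * L) ≡ y k
      y-multiple zero k = cong y (+-identityʳ k)
      y-multiple (suc n) k = trans (cong y (trans (cong (k +_) (+-comm L (n * L))) (sym (+-assoc k (n * L) L))))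
        (trans (y-periodic (k + n * L)) (y-multiple n k))
      y-0 : y 0 ≡ s₀
      y-0 = cong proj₁ states-0
      y-L : y L ≡ s₀
      y-L = trans (y-periodic 0) y-0
      y-step : ∀ k → k < L → step (y k) (letterAt {nba} ρ k) (y (suc k))
      y-step k lt = subst (λ i → step (y k) (letterAt {nba} ρ i) (y (suc k))) (m<n⇒m%n≡m lt) (proj₁ (states-step k))

      close : ∀ x → b ≡ x → Path {nba} s ρ s
      close false refl = subst₂ (λ u w → Path {nba} u ρ w) (cong (_, (Y , false)) y-0) (cong (_, (Y , false)) y-L)
        (pathFrom {nba} ρ (λ k → y k , Y , false) λ k lt → y-step k lt , (λ κ e → inj₁ (refl , e)) , λ ())
      close true refl = subst₂ (λ u w → Path {nba} u ρ w) (cong (_, (Y , true)) y-0) f-L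
        (pathFrom {nba} ρ f f-step)
        where
        predecessor : ∀ {n} → 0 < n → Σ ℕ λ k → suc k ≡ n
        predecessor {suc n} _ = n , refl
        end : Σ ℕ λ k → suc k ≡ period
        end = predecessor period>0
        states-last : states (suc (proj₁ end)) ≡ s
        states-last = trans (cong states (proj₂ end)) states-end
        Y-full : ∀ κ → lookup Y κ ≡ true
        -- The long loop re-enters the marked state s, and entering a marked state demands a full
        -- set.
        Y-full κ = trans (cong (λ u → lookup (proj₁ (proj₂ u)) κ) (sym states-last))
          (proj₂ (proj₂ (states-step (proj₁ end))) (cong (proj₂ ∘ proj₂) states-last) κ)
        Met : ℕ → Fin K → Set
        Met k κ = Σ ℕ λ j → j < k × accAt κ (y j)
        all-met : ∀ κ → Met L κ
        all-met κ with collected v states states-step (cong (proj₂ ∘ proj₂) states-0) (proj₁ end) κ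
          (trans (cong (λ u → lookup (proj₁ (proj₂ u)) κ) states-last) (Y-full κ))
        ... | j , _ , a = j % L , m%n<n j L , subst (accAt κ)
          (trans (cong y (m≡m%n+[m/n]*n j L)) (y-multiple (j / L) (j % L))) a
        -- The marks are at positions 0 and `L` only; in between the memory holds exactly what was
        -- met since the start.
        mark : ℕ → Vec Bool K × Bool
        mark zero = Y , true
        mark (suc k) with suc k ≟ L
        ... | yes _ = Y , true
        ... | no _ = tabulate (λ κ → ⟦ Met (suc k) κ ⟧) , false
        mark-L : ∀ k → k ≡ L → mark k ≡ (Y , true)
        mark-L zero _ = refl
        mark-L (suc k) eq with suc k ≟ L
        ... | yes _ = refl
        ... | no ne = contradiction eq ne
        mark-met : ∀ k κ → lookup (proj₁ (mark (suc k))) κ ≡ true → Met (suc k) κ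
        mark-met k κ e with suc k ≟ L
        ... | yes eq = subst (λ n → Met n κ) (sym eq) (all-met κ)
        ... | no _ = ⟦⟧⁻ (trans (sym (lookup∘tabulate _ κ)) e)
        met-mark : ∀ k κ → suc k < L → Met (suc k) κ → proj₂ (mark (suc k)) ≡ false × lookup (proj₁ (mark (suc k))) κ ≡ true
        met-mark k κ lt met with suc k ≟ L
        ... | yes eq = contradiction eq (<⇒≢ lt)
        ... | no _ = refl , trans (lookup∘tabulate _ κ) (⟦⟧⁺ met)
        mark-full : ∀ k → proj₂ (mark (suc k)) ≡ true → ∀ κ → lookup (proj₁ (mark (suc k))) κ ≡ true
        mark-full k e κ with suc k ≟ L
        ... | yes _ = Y-full κ
        mark-step : ∀ k → k < L → ∀ κ → Met (suc k) κ →
          (proj₂ (mark k) ≡ false × lookup (proj₁ (mark k)) κ ≡ true) ⊎ accAt κ (y k)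
        mark-step k lt κ (j , s≤s j≤k , a) with m≤n⇒m<n∨m≡n j≤k
        ... | inj₂ refl = inj₂ a
        mark-step (suc k) lt κ (j , s≤s j≤k , a) | inj₁ j<k = inj₁ (met-mark k κ lt (j , j<k , a))
        f : ℕ → S'
        f k = y k , mark k
        f-L : f L ≡ s
        f-L = cong₂ _,_ y-L (mark-L L refl)
        f-step : ∀ k → k < L → step' (f k) (letterAt {nba} ρ k) (f (suc k))
        f-step k lt = y-step k lt , (λ κ e → mark-step k lt κ (mark-met k κ e)) , mark-full k

    counterFreeNBA : CounterFreeNBA nba
    counterFreeNBA n n>0 s [] π = nil
    counterFreeNBA n n>0 s ρ@(_ ∷ _) π = loop s ρ (unroll nba n s ρ n>0 π)

-- Asking every fair run to predict correctly makes negation a change of output only, and lets a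
-- compound tester trust the predictions of its parts.
Tests : (G : GBA) → (ℕ → GBA.I G → Bool) → (ℕ → Set) → Set
Tests G v X = (Σ (ℕ → S) λ ρ → IsRun v ρ × Fair ρ)
  × (∀ ρ → IsRun v ρ → Fair ρ → ∀ i → out (ρ i) ⇔ X i)
  where open GBA G

tests-cong : ∀ G {v X X'} → (∀ i → X i ⇔ X' i) → Tests G v X → Tests G v X'
tests-cong G eq (c , s) = c , λ ρ r f i → mk⇔
  (Equivalence.to (eq i) ∘ Equivalence.to (s ρ r f i)) (Equivalence.from (s ρ r f i) ∘ Equivalence.from (eq i))

-- Testers for the path operators.

module Testers (em : ExcludedMiddle (lsuc lzero)) where
  open Classical em

  ⟦⟧-⇔ : ∀ {P} → ⟦ P ⟧ ≡ true ⇔ P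
  ⟦⟧-⇔ = mk⇔ ⟦⟧⁻ ⟦⟧⁺

  -- The state is a guess of the letter about to be read, so that the prediction precedes the input.
  atomG : GBA
  atomG = record
    { I = ⊤ ; I-finite = ⊤-finite ; S = Bool ; S-finite = Bool-finite ; J = ⊥ ; J-finite = ⊥-finite
    ; step = λ s v s' → s ≡ v tt ; step-cong = λ eq e → trans e (eq tt)
    ; acc = λ () ; out = _≡ true }

  atomG-tests : ∀ v → Tests atomG v (λ i → v i tt ≡ true)
  atomG-tests v = ((λ i → v i tt) , (λ _ → refl) , λ ()) ,
    λ ρ r f i → mk⇔ (trans (sym (r i))) (trans (r i))

  atomG-aperiodic : Aperiodic atomG
  atomG-aperiodic L v ρ per r i = trans (r (i + L)) (trans (per i tt) (sym (r i)))

  negG : GBA → GBA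
  negG G = record
    { I = I ; I-finite = I-finite ; S = S ; S-finite = S-finite ; J = J ; J-finite = J-finite
    ; step = step ; step-cong = step-cong ; acc = acc ; out = ¬_ ∘ out }
    where open GBA G

  negG-tests : ∀ G {v X} → Tests G v X → Tests (negG G) v (¬_ ∘ X)
  negG-tests G (c , s) = c , λ ρ r f i → mk⇔
    (λ no x → no (Equivalence.from (s ρ r f i) x)) (λ no o → no (Equivalence.to (s ρ r f i) o))

  module _ (G₁ G₂ : GBA) where
    private
      module A = GBA G₁
      module B = GBA G₂

    andG : GBA
    andG = record
      { I = A.I ⊎ B.I ; I-finite = ⊎-finite A.I-finite B.I-finite
      ; S = A.S × B.S ; S-finite = ×-finite A.S-finite B.S-finite
      ; J = A.J ⊎ B.J ; J-finite = ⊎-finite A.J-finite B.J-finite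
      ; step = λ (s₁ , s₂) v (s₁' , s₂') → A.step s₁ (v ∘ inj₁) s₁' × B.step s₂ (v ∘ inj₂) s₂'
      ; step-cong = λ eq (x , y) → A.step-cong (eq ∘ inj₁) x , B.step-cong (eq ∘ inj₂) y
      ; acc = λ { (inj₁ j) (s₁ , _) → A.acc j s₁ ; (inj₂ j) (_ , s₂) → B.acc j s₂ }
      ; out = λ (s₁ , s₂) → A.out s₁ × B.out s₂ }

    andG-tests : ∀ v {X₁ X₂} → Tests G₁ (λ i → v i ∘ inj₁) X₁ → Tests G₂ (λ i → v i ∘ inj₂) X₂ →
      Tests andG v (λ i → X₁ i × X₂ i)
    andG-tests v ((ρ₁ , r₁ , f₁) , s₁) ((ρ₂ , r₂ , f₂) , s₂) =
      ((λ i → ρ₁ i , ρ₂ i) , (λ i → r₁ i , r₂ i) , λ { (inj₁ j) → f₁ j ; (inj₂ j) → f₂ j }) ,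
      λ ρ r f i →
        let e₁ = s₁ (proj₁ ∘ ρ) (proj₁ ∘ r) (f ∘ inj₁) i
            e₂ = s₂ (proj₂ ∘ ρ) (proj₂ ∘ r) (f ∘ inj₂) i
        in mk⇔ (λ (x , y) → Equivalence.to e₁ x , Equivalence.to e₂ y)
               (λ (x , y) → Equivalence.from e₁ x , Equivalence.from e₂ y)

    andG-aperiodic : Aperiodic G₁ → Aperiodic G₂ → Aperiodic andG
    andG-aperiodic p₁ p₂ L v ρ per r i = cong₂ _,_
      (p₁ L _ (proj₁ ∘ ρ) (λ i j → per i (inj₁ j)) (proj₁ ∘ r) i)
      (p₂ L _ (proj₂ ∘ ρ) (λ i j → per i (inj₂ j)) (proj₂ ∘ r) i)

  module _ (G : GBA) where
    open GBA G

    nextG : GBA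
    nextG = record
      { I = I ; I-finite = I-finite ; S = S × Bool ; S-finite = ×-finite S-finite Bool-finite
      ; J = J ; J-finite = J-finite
      ; step = λ (s , b) v (s' , b') → step s v s' × b ≡ ⟦ out s' ⟧
      ; step-cong = λ eq (x , y) → step-cong eq x , y
      ; acc = λ j (s , _) → acc j s ; out = λ (_ , b) → b ≡ true }

    nextG-tests : ∀ {v X} → Tests G v X → Tests nextG v (X ∘ suc)
    nextG-tests ((ρ , r , f) , s) =
      ((λ i → ρ i , ⟦ out (ρ (suc i)) ⟧) , (λ i → r i , refl) , f) ,
      λ ρ' r' f' i → let e = s (proj₁ ∘ ρ') (proj₁ ∘ r') f' (suc i) in
        mk⇔ (λ b → Equivalence.to e (⟦⟧⁻ (trans (sym (proj₂ (r' i))) b)))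
            (λ x → trans (proj₂ (r' i)) (⟦⟧⁺ (Equivalence.from e x)))

    nextG-aperiodic : Aperiodic G → Aperiodic nextG
    nextG-aperiodic p L v ρ per r i = cong₂ _,_ (same i)
      (trans (proj₂ (r (i + L))) (trans (cong (λ s → ⟦ out s ⟧) (same (suc i))) (sym (proj₂ (r i)))))
      where
      same : ∀ i → proj₁ (ρ (i + L)) ≡ proj₁ (ρ i)
      same = p L v (proj₁ ∘ ρ) per (proj₁ ∘ r)

  Until : (ℕ → Set) → (ℕ → Set) → ℕ → Set
  Until X Y i = Σ ℕ λ j → i ≤ j × Y j × (∀ k → i ≤ k → k < j → X k)

  until-fold : ∀ {X Y i} → Y i ⊎ (X i × Until X Y (suc i)) → Until X Y i
  until-fold {i = i} (inj₁ y) = i , ≤-refl , y , λ k i≤k k<i → contradiction (<-≤-trans k<i i≤k) (<-irrefl refl)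
  until-fold {X} {i = i} (inj₂ (x , j , i<j , y , h)) = j , <⇒≤ i<j , y , before
    where
    before : ∀ k → i ≤ k → k < j → X k
    before k i≤k k<j with m≤n⇒m<n∨m≡n i≤k
    ... | inj₁ i<k = h k i<k k<j
    ... | inj₂ refl = x

  until-unfold : ∀ {X Y i} → Until X Y i → Y i ⊎ (X i × Until X Y (suc i))
  until-unfold {i = i} (j , i≤j , y , h) with m≤n⇒m<n∨m≡n i≤j
  ... | inj₂ refl = inj₁ y
  ... | inj₁ i<j = inj₂ (h i ≤-refl i<j , j , i<j , y , λ k i<k → h k (<⇒≤ i<k))

  -- Applied to y i = x (i + L) and k = L, this shows that a solution x of the expansion law of "until"
  -- whose coefficients A and C have period L has period L itself.
  diverge : ∀ {A C : ℕ → Set} (x y : ℕ → Bool) →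
    (∀ i → x i ≡ true ⇔ (A i ⊎ (C i × x (suc i) ≡ true))) →
    (∀ i → y i ≡ true ⇔ (A i ⊎ (C i × y (suc i) ≡ true))) →
    ∀ i → x i ≡ true → y i ≡ false → ∀ k → x (k + i) ≡ true × y (k + i) ≡ false
  diverge x y ex ey i xi yi zero = xi , yi
  diverge x y ex ey i xi yi (suc k) with diverge x y ex ey i xi yi k
  ... | xk , yk with Equivalence.to (ex (k + i)) xk
  ...   | inj₁ a = contradiction (trans (sym (Equivalence.from (ey (k + i)) (inj₁ a))) yk) λ ()
  ...   | inj₂ (c , x') with y (suc k + i) in y'
  ...     | false = x' , refl
  ...     | true = contradiction (trans (sym (Equivalence.from (ey (k + i)) (inj₂ (c , y')))) yk) λ ()

  module _ (G₁ G₂ : GBA) where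
    private
      module A = GBA G₁
      module B = GBA G₂

    -- The bit obeys the expansion law, whose greatest solution also promises an until that is never
    -- fulfilled. The extra acceptance set rules this out: infinitely often the promise is absent or
    -- being fulfilled.
    untilG : GBA
    untilG = record
      { I = A.I ⊎ B.I ; I-finite = ⊎-finite A.I-finite B.I-finite
      ; S = A.S × B.S × Bool ; S-finite = ×-finite A.S-finite (×-finite B.S-finite Bool-finite)
      ; J = A.J ⊎ B.J ⊎ ⊤ ; J-finite = ⊎-finite A.J-finite (⊎-finite B.J-finite ⊤-finite)
      ; step = λ (s₁ , s₂ , b) v (s₁' , s₂' , b') → A.step s₁ (v ∘ inj₁) s₁' × B.step s₂ (v ∘ inj₂) s₂'
          × (b ≡ true ⇔ (B.out s₂ ⊎ (A.out s₁ × b' ≡ true)))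
      ; step-cong = λ eq (x , y , z) → A.step-cong (eq ∘ inj₁) x , B.step-cong (eq ∘ inj₂) y , z
      ; acc = λ { (inj₁ j) (s₁ , _) → A.acc j s₁ ; (inj₂ (inj₁ j)) (_ , s₂ , _) → B.acc j s₂
                ; (inj₂ (inj₂ tt)) (_ , s₂ , b) → b ≡ false ⊎ B.out s₂ }
      ; out = λ (_ , _ , b) → b ≡ true }

    untilG-tests : ∀ v {X₁ X₂} → Tests G₁ (λ i → v i ∘ inj₁) X₁ → Tests G₂ (λ i → v i ∘ inj₂) X₂ →
      Tests untilG v (Until X₁ X₂)
    untilG-tests v {X₁} {X₂} ((ρ₁ , r₁ , f₁) , s₁) ((ρ₂ , r₂ , f₂) , s₂) = (ρ , run , fairρ) , sound
      where
      open GBA untilG using (IsRun; Fair)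
      o₁ : ∀ i → A.out (ρ₁ i) ⇔ X₁ i
      o₁ = s₁ ρ₁ r₁ f₁
      o₂ : ∀ i → B.out (ρ₂ i) ⇔ X₂ i
      o₂ = s₂ ρ₂ r₂ f₂
      ρ : ℕ → A.S × B.S × Bool
      ρ i = ρ₁ i , ρ₂ i , ⟦ Until X₁ X₂ i ⟧
      run : IsRun v ρ
      run i = r₁ i , r₂ i , mk⇔
        (λ b → case until-unfold (⟦⟧⁻ b) of λ
          { (inj₁ y) → inj₁ (Equivalence.from (o₂ i) y)
          ; (inj₂ (x , u)) → inj₂ (Equivalence.from (o₁ i) x , ⟦⟧⁺ u) })
        (λ { (inj₁ y) → ⟦⟧⁺ (until-fold (inj₁ (Equivalence.to (o₂ i) y)))
           ; (inj₂ (x , b)) → ⟦⟧⁺ (until-fold (inj₂ (Equivalence.to (o₁ i) x , ⟦⟧⁻ b))) })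
      fairρ : Fair ρ
      fairρ (inj₁ j) = f₁ j
      fairρ (inj₂ (inj₁ j)) = f₂ j
      fairρ (inj₂ (inj₂ tt)) N with em₀ (Until X₁ X₂ N)
      ... | yes (j , N≤j , y , _) = j , N≤j , inj₂ (Equivalence.from (o₂ j) y)
      ... | no ¬u = N , ≤-refl , inj₁ (⟦⟧-false⁺ ¬u)
      sound : ∀ ρ → IsRun v ρ → Fair ρ → ∀ i → proj₂ (proj₂ (ρ i)) ≡ true ⇔ Until X₁ X₂ i
      sound ρ r f i = mk⇔
        (λ b → case f (inj₂ (inj₂ tt)) i of λ { (j , i≤j , a) → forward (j ∸ i) i
          (subst (λ k → b' k ≡ false ⊎ B.out (σ₂ k)) (sym (m∸n+n≡m i≤j)) a) b })
        (λ { (j , i≤j , y , h) → backward (j ∸ i) i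
          (subst X₂ (sym (m∸n+n≡m i≤j)) y) (λ k i≤k k< → h k i≤k (subst (k <_) (m∸n+n≡m i≤j) k<)) })
        where
        σ₁ : ℕ → A.S
        σ₁ k = proj₁ (ρ k)
        σ₂ : ℕ → B.S
        σ₂ k = proj₁ (proj₂ (ρ k))
        b' : ℕ → Bool
        b' k = proj₂ (proj₂ (ρ k))
        e₁ : ∀ k → A.out (σ₁ k) ⇔ X₁ k
        e₁ = s₁ σ₁ (proj₁ ∘ r) (f ∘ inj₁)
        e₂ : ∀ k → B.out (σ₂ k) ⇔ X₂ k
        e₂ = s₂ σ₂ (λ k → proj₁ (proj₂ (r k))) (f ∘ inj₂ ∘ inj₁)
        law : ∀ k → b' k ≡ true ⇔ (B.out (σ₂ k) ⊎ (A.out (σ₁ k) × b' (suc k) ≡ true))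
        law k = proj₂ (proj₂ (r k))
        backward : ∀ d i → X₂ (d + i) → (∀ k → i ≤ k → k < d + i → X₁ k) → b' i ≡ true
        backward zero i y h = Equivalence.from (law i) (inj₁ (Equivalence.from (e₂ i) y))
        backward (suc d) i y h = Equivalence.from (law i) (inj₂
          ( Equivalence.from (e₁ i) (h i ≤-refl (s≤s (m≤n+m i d)))
          , backward d (suc i) (subst X₂ (sym (+-suc d i)) y)
              (λ k i<k k< → h k (<⇒≤ i<k) (subst (k <_) (+-suc d i) k<)) ))
        forward : ∀ d i → b' (d + i) ≡ false ⊎ B.out (σ₂ (d + i)) → b' i ≡ true → Until X₁ X₂ i
        forward d i a b with Equivalence.to (law i) b
        ... | inj₁ y = until-fold (inj₁ (Equivalence.to (e₂ i) y))
        forward zero i (inj₁ ¬b) b | inj₂ _ = contradiction (trans (sym b) ¬b) λ ()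
        forward zero i (inj₂ y) b | inj₂ _ = until-fold (inj₁ (Equivalence.to (e₂ i) y))
        forward (suc d) i a b | inj₂ (x , b⁺) = until-fold (inj₂ (Equivalence.to (e₁ i) x ,
          forward d (suc i) (subst (λ k → b' k ≡ false ⊎ B.out (σ₂ k)) (sym (+-suc d i)) a) b⁺))

    untilG-aperiodic : Aperiodic G₁ → Aperiodic G₂ → Aperiodic untilG
    untilG-aperiodic p₁ p₂ L v ρ per r i = cong₂ _,_ (same₁ i) (cong₂ _,_ (same₂ i) same-b)
      where
      same₁ : ∀ i → proj₁ (ρ (i + L)) ≡ proj₁ (ρ i)
      same₁ = p₁ L _ (proj₁ ∘ ρ) (λ i j → per i (inj₁ j)) (proj₁ ∘ r)
      same₂ : ∀ i → proj₁ (proj₂ (ρ (i + L))) ≡ proj₁ (proj₂ (ρ i))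
      same₂ = p₂ L _ (λ k → proj₁ (proj₂ (ρ k))) (λ i j → per i (inj₂ j)) (λ k → proj₁ (proj₂ (r k)))
      b : ℕ → Bool
      b k = proj₂ (proj₂ (ρ k))
      O₁ O₂ : ℕ → Set
      O₁ k = A.out (proj₁ (ρ k))
      O₂ k = B.out (proj₁ (proj₂ (ρ k)))
      law : ∀ k → b k ≡ true ⇔ (O₂ k ⊎ (O₁ k × b (suc k) ≡ true))
      law k = proj₂ (proj₂ (r k))
      law-L : ∀ k → b (k + L) ≡ true ⇔ (O₂ k ⊎ (O₁ k × b (suc k + L) ≡ true))
      law-L k = subst₂ (λ s₁ s₂ → b (k + L) ≡ true ⇔ (B.out s₂ ⊎ (A.out s₁ × b (suc k + L) ≡ true)))
        (same₁ k) (same₂ k) (law (k + L))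
      same-b : b (i + L) ≡ b i
      same-b with b i in x | b (i + L) in y
      ... | true | true = refl
      ... | false | false = refl
      ... | true | false = contradiction
        (trans (sym (proj₁ (diverge b (λ k → b (k + L)) law law-L i x y L)))
          (trans (cong b (+-comm L i)) y)) λ ()
      ... | false | true = contradiction
        (trans (sym y) (trans (cong b (+-comm i L)) (proj₂ (diverge (λ k → b (k + L)) b law-L law i y x L)))) λ ()

  -- The tester for ⟨B⟩ψ.

  module Diamond {nAP : ℕ} (B : NFA nAP) where
    open NFA B renaming (trans to arrow)

    module _ (a : ℕ → Label nAP) (T : Fin m → ℕ → Set) (Z : ℕ → Set) where

      Holds : ℕ → Set
      Holds i = Σ ℕ λ j → i ≤ j × Σ (ℕ → Fin m) λ q →
          init (q i) ≡ true
        × acc (q j) ≡ true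
        × (∀ k → i ≤ k → k < j → arrow (q k) (a k) (q (suc k)) ≡ true)
        × (∀ k → i ≤ k → k ≤ j → T (q k) k)
        × Z j

      -- The form of `Holds` that can be compared with a step relation: the length of the run of `B`
      -- is exposed, and positions are peeled off one at a time.
      data Good : ℕ → Fin m → ℕ → Set where
        done : ∀ {q i} → T q i → acc q ≡ true → Z i → Good 0 q i
        next : ∀ {n q q' i} → T q i → arrow q (a i) q' ≡ true → Good n q' (suc i) → Good (suc n) q i

      holds⇒good : ∀ n i (q : ℕ → Fin m) → acc (q (n + i)) ≡ true →
        (∀ k → i ≤ k → k < n + i → arrow (q k) (a k) (q (suc k)) ≡ true) →
        (∀ k → i ≤ k → k ≤ n + i → T (q k) k) → Z (n + i) → Good n (q i) i
      holds⇒good zero i q ac st te z = done (te i ≤-refl ≤-refl) ac z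
      holds⇒good (suc n) i q ac st te z = next (te i ≤-refl (m≤n+m i (suc n))) (st i ≤-refl (s≤s (m≤n+m i n)))
        (holds⇒good n (suc i) q (subst (λ k → acc (q k) ≡ true) (sym (+-suc n i)) ac)
          (λ k i<k k< → st k (<⇒≤ i<k) (subst (k <_) (+-suc n i) k<))
          (λ k i<k k≤ → te k (<⇒≤ i<k) (subst (k ≤_) (+-suc n i) k≤))
          (subst Z (sym (+-suc n i)) z))

      record Trace (n : ℕ) (q₀ : Fin m) (i : ℕ) : Set where
        field
          q     : ℕ → Fin m
          q-i   : q i ≡ q₀
          q-acc : acc (q (n + i)) ≡ true
          q-stp : ∀ k → i ≤ k → k < n + i → arrow (q k) (a k) (q (suc k)) ≡ true
          q-tst : ∀ k → i ≤ k → k ≤ n + i → T (q k) k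
          end   : Z (n + i)
      open Trace

      good⇒trace : ∀ {n q₀ i} → Good n q₀ i → Trace n q₀ i
      good⇒trace {q₀ = q₀} {i} (done x ac z) = record
        { q = λ _ → q₀ ; q-i = refl ; q-acc = ac ; end = z
        ; q-stp = λ k i≤k k<i → contradiction (<-≤-trans k<i i≤k) (<-irrefl refl)
        ; q-tst = λ k i≤k k≤i → subst (T q₀) (≤-antisym i≤k k≤i) x }
      good⇒trace {suc n} {q₀} {i} (next x tr g) = record
        { q = q⁺ ; q-i = at-i ; q-acc = accepts
        ; q-stp = stp ; q-tst = tst ; end = subst Z (+-suc n i) (end t) }
        where
        t = good⇒trace g
        -- Only positions from i on are constrained; the earlier ones share the value at i.
        q⁺ : ℕ → Fin m
        q⁺ k with k ≤? i
        ... | yes _ = q₀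
        ... | no _ = q t k
        at-i : q⁺ i ≡ q₀
        at-i with i ≤? i
        ... | yes _ = refl
        ... | no i≰i = contradiction ≤-refl i≰i
        after : ∀ {k} → i < k → q⁺ k ≡ q t k
        after {k} i<k with k ≤? i
        ... | yes k≤i = contradiction (<-≤-trans i<k k≤i) (<-irrefl refl)
        ... | no _ = refl
        accepts : acc (q⁺ (suc n + i)) ≡ true
        accepts = subst (λ s → acc s ≡ true) (sym (after (s≤s (m≤n+m i n))))
          (subst (λ k → acc (q t k) ≡ true) (+-suc n i) (q-acc t))
        stp : ∀ k → i ≤ k → k < suc n + i → arrow (q⁺ k) (a k) (q⁺ (suc k)) ≡ true
        stp k i≤k k< with m≤n⇒m<n∨m≡n i≤k
        ... | inj₂ refl = subst₂ (λ s s' → arrow s (a i) s' ≡ true) (sym at-i)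
          (sym (trans (after (n<1+n i)) (q-i t))) tr
        ... | inj₁ i<k = subst₂ (λ s s' → arrow s (a k) s' ≡ true) (sym (after i<k)) (sym (after (<-trans i<k (n<1+n k))))
          (q-stp t k i<k (subst (k <_) (sym (+-suc n i)) k<))
        tst : ∀ k → i ≤ k → k ≤ suc n + i → T (q⁺ k) k
        tst k i≤k k≤ with m≤n⇒m<n∨m≡n i≤k
        ... | inj₂ refl = subst (λ s → T s i) (sym at-i) x
        ... | inj₁ i<k = subst (λ s → T s k) (sym (after i<k)) (q-tst t k i<k (subst (k ≤_) (sym (+-suc n i)) k≤))

      Reached : Fin m → ℕ → Set
      Reached q i = Σ ℕ λ n → Good n q i

      holds⇔ : ∀ i → (Σ (Fin m) λ q → init q ≡ true × Reached q i) ⇔ Holds i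
      holds⇔ i = mk⇔
        (λ { (s , ini , n , g) → let t = good⇒trace g in n + i , m≤n+m i n , q t ,
               subst (λ s → init s ≡ true) (sym (q-i t)) ini , q-acc t , q-stp t , q-tst t , end t })
        (λ { (j , i≤j , q , ini , ac , st , te , z) → q i , ini , j ∸ i ,
               from (j ∸ i) (m∸n+n≡m i≤j) q ac st te z })
        where
        from : ∀ n {j} → n + i ≡ j → (q : ℕ → Fin m) → acc (q j) ≡ true →
          (∀ k → i ≤ k → k < j → arrow (q k) (a k) (q (suc k)) ≡ true) →
          (∀ k → i ≤ k → k ≤ j → T (q k) k) → Z j → Good n (q i) i
        from n refl = holds⇒good n i

    module _ (Gs : Fin m → GBA) (G₀ : GBA) where
      private
        module Sub (q : Fin m) = GBA (Gs q)
        module Z = GBA G₀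

      Letters : Set
      Letters = Fin nAP ⊎ Σ (Fin m) Sub.I ⊎ Z.I

      States : Set
      States = Tuple m Sub.S × Z.S × Vec Bool m × Vec Bool m × Bool

      -- Ok: the states of B from which ⟨B⟩ can still be fulfilled. Pending: those that have to be
      -- fulfilled before the next breakpoint, which is marked by the flag.
      Ok Pending Done : States → Fin m → Set
      Ok (_ , _ , P , _ , _) q = lookup P q ≡ true
      Pending (_ , _ , _ , O , r) q = r ≡ false × lookup O q ≡ true
      Done (_ , s , _) q = acc q ≡ true × Z.out s

      Test : States → Fin m → Set
      Test (σ , _) q = Sub.out q (proj σ q)

      Breakpoint : States → Set
      Breakpoint (_ , _ , _ , _ , r) = r ≡ true

      Succ : (Fin nAP → Bool) → Fin m → (Fin m → Set) → Set
      Succ l q X = Σ (Fin m) λ q' → arrow q (tabulate l) q' ≡ true × X q'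

      -- `ok` alone is the expansion law, which endless postponement also satisfies. No state is
      -- pending at a breakpoint, so a pending chain has to end in `Done` before it; `reload` puts
      -- all promises under this regime after each breakpoint.
      record Step (x : States) (v : Letters → Bool) (y : States) : Set where
        field
          sub     : ∀ q → Sub.step q (proj (proj₁ x) q) (λ j → v (inj₂ (inj₁ (q , j)))) (proj (proj₁ y) q)
          zed     : Z.step (proj₁ (proj₂ x)) (v ∘ inj₂ ∘ inj₂) (proj₁ (proj₂ y))
          ok      : ∀ q → Ok x q ⇔ (Test x q × (Done x q ⊎ Succ (v ∘ inj₁) q (Ok y)))
          pending : ∀ q → Pending x q → Ok x q × (Done x q ⊎ Succ (v ∘ inj₁) q (Pending y))
          reload  : Breakpoint x → ∀ q → Ok y q → Pending y q
      open Step

      Step-cong : ∀ {x v v' y} → (∀ i → v i ≡ v' i) → Step x v y → Step x v' y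
      Step-cong {x} {v} {v'} {y} eq st = record
        { sub = λ q → Sub.step-cong q (λ j → eq _) (sub st q)
        ; zed = Z.step-cong (λ j → eq _) (zed st)
        ; ok = λ q → subst (λ l → Ok x q ⇔ (Test x q × (Done x q ⊎
            (Σ (Fin m) λ q' → arrow q l q' ≡ true × Ok y q')))) same (ok st q)
        ; pending = λ q → subst (λ l → Pending x q → Ok x q × (Done x q ⊎
            (Σ (Fin m) λ q' → arrow q l q' ≡ true × Pending y q'))) same (pending st q)
        ; reload = reload st }
        where
        same : tabulate (v ∘ inj₁) ≡ tabulate (v' ∘ inj₁)
        same = tabulate-cong (eq ∘ inj₁)

      diaG : GBA
      diaG = record
        { I = Letters ; I-finite = ⊎-finite (Fin-finite nAP) (⊎-finite (Σ-finite (Fin-finite m) Sub.I-finite) Z.I-finite)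
        ; S = States ; S-finite = ×-finite (Tuple-finite m Sub.S-finite)
            (×-finite Z.S-finite (×-finite (Vec-finite m) (×-finite (Vec-finite m) Bool-finite)))
        ; J = Σ (Fin m) Sub.J ⊎ Z.J ⊎ ⊤
        ; J-finite = ⊎-finite (Σ-finite (Fin-finite m) Sub.J-finite) (⊎-finite Z.J-finite ⊤-finite)
        ; step = Step ; step-cong = Step-cong
        ; acc = λ { (inj₁ (q , j)) (σ , _) → Sub.acc q j (proj σ q)
                  ; (inj₂ (inj₁ j)) (_ , s , _) → Z.acc j s
                  ; (inj₂ (inj₂ tt)) x → Breakpoint x }
        ; out = λ x → Σ (Fin m) λ q → init q ≡ true × Ok x q }

      module _ (v : ℕ → Letters → Bool) {T : Fin m → ℕ → Set} {Zt : ℕ → Set}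
        (subTests : ∀ q → Tests (Gs q) (λ i j → v i (inj₂ (inj₁ (q , j)))) (T q))
        (zedTests : Tests G₀ (λ i → v i ∘ inj₂ ∘ inj₂) Zt) where

        open GBA diaG using (IsRun; Fair)

        a : ℕ → Label nAP
        a i = tabulate (v i ∘ inj₁)

        module Sound (ρ : ℕ → States) (run : IsRun v ρ) (fairρ : Fair ρ) where

          test⇔ : ∀ q i → Test (ρ i) q ⇔ T q i
          test⇔ q = proj₂ (subTests q) (λ i → proj (proj₁ (ρ i)) q) (λ i → sub (run i) q) (λ j → fairρ (inj₁ (q , j)))

          z⇔ : ∀ i → Z.out (proj₁ (proj₂ (ρ i))) ⇔ Zt i
          z⇔ = proj₂ zedTests (λ i → proj₁ (proj₂ (ρ i))) (λ i → zed (run i)) (fairρ ∘ inj₂ ∘ inj₁)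

          good⇒ok : ∀ {n q i} → Good a T Zt n q i → Ok (ρ i) q
          good⇒ok {q = q} {i} (done x ac z) = Equivalence.from (ok (run i) q)
            (Equivalence.from (test⇔ q i) x , inj₁ (ac , Equivalence.from (z⇔ i) z))
          good⇒ok {q = q} {i} (next x tr g) = Equivalence.from (ok (run i) q)
            (Equivalence.from (test⇔ q i) x , inj₂ (_ , tr , good⇒ok g))

          fulfilled : ∀ {i q} → Ok (ρ i) q → Done (ρ i) q → Reached a T Zt q i
          fulfilled {i} {q} p (ac , z) = 0 ,
            done (Equivalence.to (test⇔ q i) (proj₁ (Equivalence.to (ok (run i) q) p))) ac (Equivalence.to (z⇔ i) z)

          continue : ∀ {i q q'} → Ok (ρ i) q → arrow q (a i) q' ≡ true → Reached a T Zt q' (suc i) → Reached a T Zt q i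
          continue {i} {q} p tr (n , g) = suc n ,
            next (Equivalence.to (test⇔ q i) (proj₁ (Equivalence.to (ok (run i) q) p))) tr g

          shift : ∀ {i d} → Breakpoint (ρ (suc d + i)) → Breakpoint (ρ (d + suc i))
          shift {i} {d} = subst (Breakpoint ∘ ρ) (sym (+-suc d i))

          pending⇒reached : ∀ d i q → Breakpoint (ρ (d + i)) → Pending (ρ i) q → Reached a T Zt q i
          pending⇒reached zero i q br (nb , _) = contradiction (trans (sym br) nb) λ ()
          pending⇒reached (suc d) i q br p with pending (run i) q p
          ... | k , inj₁ dn = fulfilled k dn
          ... | k , inj₂ (q' , tr , p') = continue k tr (pending⇒reached d (suc i) q' (shift {i} {d} br) p')

          nextBreak : ∀ i → Σ ℕ λ d → Breakpoint (ρ (d + i))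
          nextBreak i with fairρ (inj₂ (inj₂ tt)) i
          ... | j , i≤j , br = j ∸ i , subst (Breakpoint ∘ ρ) (sym (m∸n+n≡m i≤j)) br

          -- Up to the next breakpoint the promise is merely passed on; there `reload` turns it into
          -- an obligation, and a second breakpoint bounds the rest.
          ok⇒reached : ∀ d i q → Breakpoint (ρ (d + i)) → Ok (ρ i) q → Reached a T Zt q i
          ok⇒reached d i q br p with proj₂ (Equivalence.to (ok (run i) q) p)
          ... | inj₁ dn = fulfilled p dn
          ok⇒reached zero i q br p | inj₂ (q' , tr , p') with nextBreak (suc i)
          ... | d , br' = continue p tr (pending⇒reached d (suc i) q' br' (reload (run i) br q' p'))
          ok⇒reached (suc d) i q br p | inj₂ (q' , tr , p') =
            continue p tr (ok⇒reached d (suc i) q' (shift {i} {d} br) p')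

          ok⇔ : ∀ i q → Ok (ρ i) q ⇔ Reached a T Zt q i
          ok⇔ i q = mk⇔ (case nextBreak i of λ { (d , br) → ok⇒reached d i q br }) (λ { (_ , g) → good⇒ok g })

        module Complete where

          σ : ∀ q → ℕ → Sub.S q
          σ q = proj₁ (proj₁ (subTests q))

          ζ : ℕ → Z.S
          ζ = proj₁ (proj₁ zedTests)

          Within : ℕ → Fin m → ℕ → Set
          Within n q i = Σ ℕ λ k → k ≤ n × Good a T Zt k q i

          -- One deadline serves all states of `B` at once: they are finitely many, and those that
          -- are not `Reached` ask for none. It restarts the clock after each breakpoint.
          bound : ∀ i → Σ ℕ λ n → ∀ q → Reached a T Zt q i → Within n q i
          bound i with eventually-all (λ q n → Reached a T Zt q i → Within n q i)
            (λ { q m≤n h r → case h r of λ { (k , k≤ , g) → k , ≤-trans k≤ m≤n , g } })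
            (λ q → case em₀ (Reached a T Zt q i) of λ
              { (yes (n , g)) → n , λ _ → n , ≤-refl , g ; (no ¬r) → 0 , λ r → contradiction r ¬r })
            (allFin m)
          ... | n , h = n , λ q → h q (∈-allFin q)

          -- The time left to the next breakpoint, where nothing marks the breakpoint itself.
          tick : ℕ → Maybe ℕ → Maybe ℕ
          tick i nothing = just (proj₁ (bound (suc i)))
          tick i (just zero) = nothing
          tick i (just (suc n)) = just n

          clock : ℕ → Maybe ℕ
          clock zero = nothing
          clock (suc i) = tick i (clock i)

          obligations : ℕ → Maybe ℕ → Vec Bool m
          obligations i nothing = Vec.replicate m false
          obligations i (just n) = tabulate λ q → ⟦ Within n q i ⟧

          ρ : ℕ → States
          ρ i = tuple (λ q → σ q i) , ζ i , tabulate (λ q → ⟦ Reached a T Zt q i ⟧) ,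
            obligations i (clock i) , is-nothing (clock i)

          ok⇔ : ∀ i q → Ok (ρ i) q ⇔ Reached a T Zt q i
          ok⇔ i q = mk⇔ (λ e → ⟦⟧⁻ (trans (sym (lookup∘tabulate _ q)) e)) (λ r → trans (lookup∘tabulate _ q) (⟦⟧⁺ r))

          test⇔ : ∀ i q → Test (ρ i) q ⇔ T q i
          test⇔ i q = subst (λ s → Sub.out q s ⇔ T q i) (sym (proj-tuple (λ q → σ q i) q))
            (proj₂ (subTests q) (σ q) (proj₁ (proj₂ (proj₁ (subTests q)))) (proj₂ (proj₂ (proj₁ (subTests q)))) i)

          z⇔ : ∀ i → Z.out (ζ i) ⇔ Zt i
          z⇔ = proj₂ zedTests ζ (proj₁ (proj₂ (proj₁ zedTests))) (proj₂ (proj₂ (proj₁ zedTests)))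

          pending⇒ : ∀ i q → Pending (ρ i) q → Σ ℕ λ n → clock i ≡ just n × Within n q i
          pending⇒ i q (nb , o) with clock i
          ... | just n = n , refl , ⟦⟧⁻ (trans (sym (lookup∘tabulate _ q)) o)

          pending⇐ : ∀ i q {n} → clock i ≡ just n → Within n q i → Pending (ρ i) q
          pending⇐ i q eq w rewrite eq = refl , trans (lookup∘tabulate _ q) (⟦⟧⁺ w)

          stepAt : ∀ i → Step (ρ i) (v i) (ρ (suc i))
          stepAt i = record
            { sub = λ q → subst₂ (λ s s' → Sub.step q s _ s') (sym (proj-tuple (λ q → σ q i) q))
                (sym (proj-tuple (λ q → σ q (suc i)) q)) (proj₁ (proj₂ (proj₁ (subTests q))) i)
            ; zed = proj₁ (proj₂ (proj₁ zedTests)) i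
            ; ok = λ q → mk⇔ (λ k → unfold q (Equivalence.to (ok⇔ i q) k)) (λ h → Equivalence.from (ok⇔ i q) (fold q h))
            ; pending = pend ; reload = λ br q k → fresh br q (Equivalence.to (ok⇔ (suc i) q) k) }
            where
            unfold : ∀ q → Reached a T Zt q i → Test (ρ i) q × (Done (ρ i) q ⊎ Succ (v i ∘ inj₁) q (Ok (ρ (suc i))))
            unfold q (_ , done x ac z) = Equivalence.from (test⇔ i q) x , inj₁ (ac , Equivalence.from (z⇔ i) z)
            unfold q (_ , next x tr g) = Equivalence.from (test⇔ i q) x , inj₂ (_ , tr , Equivalence.from (ok⇔ (suc i) _) (_ , g))
            fold : ∀ q → Test (ρ i) q × (Done (ρ i) q ⊎ Succ (v i ∘ inj₁) q (Ok (ρ (suc i)))) → Reached a T Zt q i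
            fold q (x , inj₁ (ac , z)) = 0 , done (Equivalence.to (test⇔ i q) x) ac (Equivalence.to (z⇔ i) z)
            fold q (x , inj₂ (q' , tr , k)) with Equivalence.to (ok⇔ (suc i) q') k
            ... | n , g = suc n , next (Equivalence.to (test⇔ i q) x) tr g
            pend : ∀ q → Pending (ρ i) q → Ok (ρ i) q × (Done (ρ i) q ⊎ Succ (v i ∘ inj₁) q (Pending (ρ (suc i))))
            pend q p with pending⇒ i q p
            ... | n , eq , k , k≤n , g = Equivalence.from (ok⇔ i q) (k , g) , go n eq k≤n g
              where
              go : ∀ {k} n → clock i ≡ just n → k ≤ n → Good a T Zt k q i →
                Done (ρ i) q ⊎ Succ (v i ∘ inj₁) q (Pending (ρ (suc i)))
              go n eq k≤n (done x ac z) = inj₁ (ac , Equivalence.from (z⇔ i) z)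
              -- When the clock shows zero only length zero is left, so no unfulfilled obligation
              -- meets the breakpoint that follows.
              go (suc n) eq (s≤s k≤n) (next {q' = q'} x tr g) = inj₂ (q' , tr , pending⇐ (suc i) q' (cong (tick i) eq) (_ , k≤n , g))
            fresh : Breakpoint (ρ i) → ∀ q → Reached a T Zt q (suc i) → Pending (ρ (suc i)) q
            fresh br q r = pending⇐ (suc i) q (cong (tick i) (at-break (clock i) br)) (proj₂ (bound (suc i)) q r)
              where
              at-break : ∀ c → is-nothing c ≡ true → c ≡ nothing
              at-break nothing _ = refl

          rings : ∀ n i → clock i ≡ just n → Σ ℕ λ j → i ≤ j × clock j ≡ nothing
          rings zero i eq = suc i , n≤1+n i , cong (tick i) eq
          rings (suc n) i eq with rings n (suc i) (cong (tick i) eq)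
          ... | j , i<j , e = j , <⇒≤ i<j , e

          fairAt : Fair ρ
          fairAt (inj₁ (q , j)) N with proj₂ (proj₂ (proj₁ (subTests q))) j N
          ... | i , N≤i , x = i , N≤i , subst (Sub.acc q j) (sym (proj-tuple (λ q → σ q i) q)) x
          fairAt (inj₂ (inj₁ j)) = proj₂ (proj₂ (proj₁ zedTests)) j
          fairAt (inj₂ (inj₂ tt)) N with clock N in eq
          ... | nothing = N , ≤-refl , cong is-nothing eq
          ... | just n with rings n N eq
          ...   | j , N≤j , e = j , N≤j , cong is-nothing e

        diaG-tests : Tests diaG v (Holds a T Zt)
        diaG-tests = (Complete.ρ , Complete.stepAt , Complete.fairAt) , λ ρ r f i →
          let ok⇔ = Sound.ok⇔ ρ r f i ; h⇔ = holds⇔ a T Zt i in mk⇔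
            (λ { (q , ini , k) → Equivalence.to h⇔ (q , ini , Equivalence.to (ok⇔ q) k) })
            (λ h → case Equivalence.from h⇔ h of λ { (q , ini , rch) → q , ini , Equivalence.from (ok⇔ q) rch })

-- Translation of the two logics.

module Translation (em : ExcludedMiddle (lsuc lzero)) (nAP : ℕ) where
  open Classical em
  open Logic em nAP
  open Construction em nAP
  open Testers em

  exists : (G : GBA) → (GBA.I G → SF) → SF
  exists G φs = EA (Degeneralise.nba em G) φs

  module _ (G : GBA) (φs : GBA.I G → SF) {D : Set} (t : KTree nAP D) (w : List D) (X : (ℕ → D) → ℕ → Set)
    (tests : ∀ ds → Tests G (λ i → val φs t (pnode w ds i)) (X ds)) where
    open Degeneralise em G

    -- An accepting run along a path projects to a fair run of the tester, and a fair run lifts back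
    -- by `Latch`. In both directions the first prediction is the truth by `Tests`.
    exists-sat : sat (exists G φs) t w ⇔ (Σ (ℕ → D) λ ds → IsPath t w ds × X ds 0)
    exists-sat = mk⇔
      (λ { (_ , o , runFrom ds path ρ refl steps , inf) → ds , path ,
        Equivalence.to (proj₂ (tests ds) (proj₁ ∘ ρ) (proj₁ ∘ steps) (fair _ ρ steps inf) 0) o })
      (λ { (ds , path , x) →
        let (ρ , run , f) , sound = tests ds
            open Latch (λ i → val φs t (pnode w ds i)) ρ run f
        in lifted 0 , Equivalence.from (sound ρ run f 0) x , runFrom ds path lifted refl lifted-run , infinitely-reset })

  module CTL where
    private module C = CCTL nAP
    open C using (st; pneg; pand; X; U)

    pathG : C.PF → GBA
    pathG (st φ) = atomG
    pathG (pneg ψ) = negG (pathG ψ)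
    pathG (pand ψ χ) = andG (pathG ψ) (pathG χ)
    pathG (X ψ) = nextG (pathG ψ)
    pathG (U ψ χ) = untilG (pathG ψ) (pathG χ)

    state : C.SF → SF
    leaf : (ψ : C.PF) → GBA.I (pathG ψ) → SF
    state C.tt = tt
    state (C.ap p) = ap p
    state (C.neg φ) = neg (state φ)
    state (C.and φ ψ) = and (state φ) (state ψ)
    state (C.E ψ) = exists (pathG ψ) (leaf ψ)
    state (C.Dg n p φ) = Dg n p (state φ)
    leaf (st φ) _ = state φ
    leaf (pneg ψ) j = leaf ψ j
    leaf (pand ψ χ) (inj₁ j) = leaf ψ j
    leaf (pand ψ χ) (inj₂ j) = leaf χ j
    leaf (X ψ) j = leaf ψ j
    leaf (U ψ χ) (inj₁ j) = leaf ψ j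
    leaf (U ψ χ) (inj₂ j) = leaf χ j

    module _ {D : Set} (t : KTree nAP D) where
      state-sat : ∀ φ w → sat (state φ) t w ⇔ C.sat t φ w
      path-tests : ∀ ψ w ds → Tests (pathG ψ) (λ i → val (leaf ψ) t (pnode w ds i)) (C.psat t ψ w ds)
      state-sat C.tt w = ⇔-id _
      state-sat (C.ap p) w = ⇔-id _
      state-sat (C.neg φ) w = ¬-cong-⇔ (state-sat φ w)
      state-sat (C.and φ ψ) w = state-sat φ w ×-⇔ state-sat ψ w
      state-sat (C.E ψ) w = exists-sat (pathG ψ) (leaf ψ) t w (C.psat t ψ w) (path-tests ψ w)
      state-sat (C.Dg n p φ) w = atLeast-⇔
        (λ d → node t (d ∷ w) × sat (state φ) t (d ∷ w)) (λ d → node t (d ∷ w) × C.sat t φ (d ∷ w))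
        (λ d → ⇔-id _ ×-⇔ state-sat φ (d ∷ w))
      path-tests (st φ) w ds = tests-cong atomG (λ i → state-sat φ (pnode w ds i) ⇔-∘ ⟦⟧-⇔) (atomG-tests _)
      path-tests (pneg ψ) w ds = negG-tests (pathG ψ) (path-tests ψ w ds)
      path-tests (pand ψ χ) w ds = andG-tests (pathG ψ) (pathG χ) (λ i → val (leaf (pand ψ χ)) t (pnode w ds i)) (path-tests ψ w ds) (path-tests χ w ds)
      path-tests (X ψ) w ds = nextG-tests (pathG ψ) (path-tests ψ w ds)
      path-tests (U ψ χ) w ds = untilG-tests (pathG ψ) (pathG χ) (λ i → val (leaf (U ψ χ)) t (pnode w ds i)) (path-tests ψ w ds) (path-tests χ w ds)

    pathG-aperiodic : ∀ ψ → Aperiodic (pathG ψ)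
    pathG-aperiodic (st φ) = atomG-aperiodic
    pathG-aperiodic (pneg ψ) = pathG-aperiodic ψ
    pathG-aperiodic (pand ψ χ) = andG-aperiodic (pathG ψ) (pathG χ) (pathG-aperiodic ψ) (pathG-aperiodic χ)
    pathG-aperiodic (X ψ) = nextG-aperiodic (pathG ψ) (pathG-aperiodic ψ)
    pathG-aperiodic (U ψ χ) = untilG-aperiodic (pathG ψ) (pathG χ) (pathG-aperiodic ψ) (pathG-aperiodic χ)

    state-counterFree : ∀ φ → AllCounterFree (state φ)
    leaf-counterFree : ∀ ψ j → AllCounterFree (leaf ψ j)
    state-counterFree C.tt = tt
    state-counterFree (C.ap p) = tt
    state-counterFree (C.neg φ) = state-counterFree φ
    state-counterFree (C.and φ ψ) = state-counterFree φ , state-counterFree ψ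
    state-counterFree (C.E ψ) = Degeneralise.counterFreeNBA em (pathG ψ) (pathG-aperiodic ψ) , leaf-counterFree ψ
    state-counterFree (C.Dg n p φ) = state-counterFree φ
    leaf-counterFree (st φ) _ = state-counterFree φ
    leaf-counterFree (pneg ψ) j = leaf-counterFree ψ j
    leaf-counterFree (pand ψ χ) (inj₁ j) = leaf-counterFree ψ j
    leaf-counterFree (pand ψ χ) (inj₂ j) = leaf-counterFree χ j
    leaf-counterFree (X ψ) j = leaf-counterFree ψ j
    leaf-counterFree (U ψ χ) (inj₁ j) = leaf-counterFree ψ j
    leaf-counterFree (U ψ χ) (inj₂ j) = leaf-counterFree χ j

    state-plain : ∀ φ → C.IsCTL φ → Plain (state φ)
    leaf-plain : ∀ ψ → C.IsCTLp ψ → ∀ j → Plain (leaf ψ j)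
    state-plain C.tt h = tt
    state-plain (C.ap p) h = tt
    state-plain (C.neg φ) h = state-plain φ h
    state-plain (C.and φ ψ) (h , h') = state-plain φ h , state-plain ψ h'
    state-plain (C.E ψ) h = leaf-plain ψ h
    state-plain (C.Dg n p φ) (h , h') = h , state-plain φ h'
    leaf-plain (st φ) h _ = state-plain φ h
    leaf-plain (pneg ψ) h j = leaf-plain ψ h j
    leaf-plain (pand ψ χ) (h , _) (inj₁ j) = leaf-plain ψ h j
    leaf-plain (pand ψ χ) (_ , h) (inj₂ j) = leaf-plain χ h j
    leaf-plain (X ψ) h j = leaf-plain ψ h j
    leaf-plain (U ψ χ) (h , _) (inj₁ j) = leaf-plain ψ h j
    leaf-plain (U ψ χ) (_ , h) (inj₂ j) = leaf-plain χ h j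

  module DL where
    private module C = CCDL nAP
    open C using (st; pneg; pand; dia)

    pathG : C.PF → GBA
    pathG (st φ) = atomG
    pathG (pneg ψ) = negG (pathG ψ)
    pathG (pand ψ χ) = andG (pathG ψ) (pathG χ)
    pathG (dia B τ ψ) = Diamond.diaG B (λ q → pathG (τ q)) (pathG ψ)

    state : C.SF → SF
    leaf : (ψ : C.PF) → GBA.I (pathG ψ) → SF
    state C.tt = tt
    state (C.ap p) = ap p
    state (C.neg φ) = neg (state φ)
    state (C.and φ ψ) = and (state φ) (state ψ)
    state (C.E ψ) = exists (pathG ψ) (leaf ψ)
    state (C.Dg n p φ) = Dg n p (state φ)
    leaf (st φ) _ = state φ
    leaf (pneg ψ) j = leaf ψ j
    leaf (pand ψ χ) (inj₁ j) = leaf ψ j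
    leaf (pand ψ χ) (inj₂ j) = leaf χ j
    leaf (dia B τ ψ) (inj₁ p) = ap p
    leaf (dia B τ ψ) (inj₂ (inj₁ (q , j))) = leaf (τ q) j
    leaf (dia B τ ψ) (inj₂ (inj₂ j)) = leaf ψ j

    module _ {D : Set} (t : KTree nAP D) where
      state-sat : ∀ φ w → sat (state φ) t w ⇔ C.sat t φ w
      path-tests : ∀ ψ w ds → Tests (pathG ψ) (λ i → val (leaf ψ) t (pnode w ds i)) (C.psat t ψ w ds)
      state-sat C.tt w = ⇔-id _
      state-sat (C.ap p) w = ⇔-id _
      state-sat (C.neg φ) w = ¬-cong-⇔ (state-sat φ w)
      state-sat (C.and φ ψ) w = state-sat φ w ×-⇔ state-sat ψ w
      state-sat (C.E ψ) w = exists-sat (pathG ψ) (leaf ψ) t w (C.psat t ψ w) (path-tests ψ w)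
      state-sat (C.Dg n p φ) w = atLeast-⇔
        (λ d → node t (d ∷ w) × sat (state φ) t (d ∷ w)) (λ d → node t (d ∷ w) × C.sat t φ (d ∷ w))
        (λ d → ⇔-id _ ×-⇔ state-sat φ (d ∷ w))
      path-tests (st φ) w ds = tests-cong atomG (λ i → state-sat φ (pnode w ds i) ⇔-∘ ⟦⟧-⇔) (atomG-tests _)
      path-tests (pneg ψ) w ds = negG-tests (pathG ψ) (path-tests ψ w ds)
      path-tests (pand ψ χ) w ds = andG-tests (pathG ψ) (pathG χ) (λ i → val (leaf (pand ψ χ)) t (pnode w ds i)) (path-tests ψ w ds) (path-tests χ w ds)
      path-tests (dia B τ ψ) w ds = tests-cong (pathG (dia B τ ψ))
        -- The tester receives the label bit by bit through the formulas `ap p`; tabulating the bits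
        -- restores the label.
        (λ i → mk⇔ (read (λ k → readLabel (pnode w ds k))) (read (λ k → sym (readLabel (pnode w ds k)))))
        (Diamond.diaG-tests B (λ q → pathG (τ q)) (pathG ψ)
          (λ i → val (leaf (dia B τ ψ)) t (pnode w ds i)) (λ q → path-tests (τ q) w ds) (path-tests ψ w ds))
        where
        HoldsFor : (ℕ → Label nAP) → ℕ → Set
        HoldsFor a = Diamond.Holds B a (λ q → C.psat t (τ q) w ds) (C.psat t ψ w ds)
        readLabel : ∀ u → tabulate (λ p → ⟦ lookup (lab t u) p ≡ true ⟧) ≡ lab t u
        readLabel u = lookup-ext λ p → trans (lookup∘tabulate _ p) (bit (lookup (lab t u) p))
          where
          bit : ∀ b → ⟦ b ≡ true ⟧ ≡ b
          bit true = ⟦⟧⁺ refl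
          bit false = ⟦⟧-false⁺ λ ()
        read : ∀ {a a' : ℕ → Label nAP} {i} → (∀ k → a k ≡ a' k) →
          HoldsFor a i → HoldsFor a' i
        read eq (j , i≤j , q , ini , ac , stp , rest) = j , i≤j , q , ini , ac ,
          (λ k i≤k k<j → subst (λ l → NFA.trans B (q k) l (q (suc k)) ≡ true) (eq k) (stp k i≤k k<j)) , rest

    state-plain : ∀ φ → C.IsCDL φ → Plain (state φ)
    leaf-plain : ∀ ψ → C.IsCDLp ψ → ∀ j → Plain (leaf ψ j)
    state-plain C.tt h = tt
    state-plain (C.ap p) h = tt
    state-plain (C.neg φ) h = state-plain φ h
    state-plain (C.and φ ψ) (h , h') = state-plain φ h , state-plain ψ h'
    state-plain (C.E ψ) h = leaf-plain ψ h
    state-plain (C.Dg n p φ) (h , h') = h , state-plain φ h'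
    leaf-plain (st φ) h _ = state-plain φ h
    leaf-plain (pneg ψ) h j = leaf-plain ψ h j
    leaf-plain (pand ψ χ) (h , _) (inj₁ j) = leaf-plain ψ h j
    leaf-plain (pand ψ χ) (_ , h) (inj₂ j) = leaf-plain χ h j
    leaf-plain (dia B τ ψ) h (inj₁ p) = tt
    leaf-plain (dia B τ ψ) (h , _) (inj₂ (inj₁ (q , j))) = leaf-plain (τ q) (h q) j
    leaf-plain (dia B τ ψ) (_ , h) (inj₂ (inj₂ j)) = leaf-plain ψ h j

  module Of (φ : SF) = Build (Coding.componentCoding φ)

theorem10 : ExcludedMiddle (lsuc lzero) → (nAP : ℕ) →
    (∀ (φ : CCDL.SF nAP) → Σ (HGTA nAP) λ H →
    SameLang (proj₁ H) (λ t → CCDL.Models nAP φ t)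
    × (CCDL.IsCDL nAP φ → Symmetric (proj₁ H)))
    × (∀ (φ : CCTL.SF nAP) → Σ (HGTA nAP) λ H →
    CounterFree H
    × SameLang (proj₁ H) (λ t → CCTL.Models nAP φ t)
    × (CCTL.IsCTL nAP φ → Symmetric (proj₁ H)))
theorem10 em nAP = ccdl , cctl
  where
  open Logic em nAP using (sat)
  open Translation em nAP

  ccdl : ∀ φ → Σ (HGTA nAP) λ H → SameLang (proj₁ H) (λ t → CCDL.Models nAP φ t)
    × (CCDL.IsCDL nAP φ → Symmetric (proj₁ H))
  ccdl φ = hgta , (λ D t → DL.state-sat t φ [] ⇔-∘ language t) , symmetric ∘ DL.state-plain φ
    where open Of (DL.state φ)

  cctl : ∀ φ → Σ (HGTA nAP) λ H → CounterFree H × SameLang (proj₁ H) (λ t → CCTL.Models nAP φ t)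
    × (CCTL.IsCTL nAP φ → Symmetric (proj₁ H))
  cctl φ = hgta , (counterFree (CTL.state-counterFree φ) , mutualExclusion) ,
    (λ D t → CTL.state-sat t φ [] ⇔-∘ language t) , symmetric ∘ CTL.state-plain φ
    where open Of (CTL.state φ)
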